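{- Suppose that $G$ is a complete graph or an odd cycle with $|V(G)| \geq 3$. Suppose $H$ is a graph on at least two vertices that contains a Hamilton path $w_1, w_2, \ldots, w_m$ such that, for each $i$, $w_i$ has at most $k$ neighbors (in $H$) among $w_1, \ldots, w_{i-1}$. Then $AT(G \square H) \leq \Delta(G)+k$.
   Context: All graphs are finite and simple, and digraphs are simple. $\Delta(G)$ is the maximum degree of $G$. A Hamilton path $w_1,\ldots,w_m$ of $H$ is a listing of all vertices of $H$, each exactly once, with consecutive vertices adjacent in $H$. The Cartesian product $G \square H$ has vertex set $V(G)\times V(H)$, with $(u,v)$ adjacent to $(u',v')$ iff either $u=u'$ and $vv'\in E(H)$, or $v=v'$ and $uu'\in E(G)$. A circulation contained in a digraph $D$ is a spanning subdigraph $E$ of $D$ such that $d^-_E(v)=d^+_E(v)$ (indegree equals outdegree in $E$) for every $v\in V(D)$; it is even (resp. odd) if it has an even (resp. odd) number of edges (the edgeless circulation is even). The Alon-Tarsi number $AT(G)$ is the smallest $k$ for which there is an orientation $D$ of $G$ with maximum indegree $k-1$ such that the number of even circulations and the number of odd circulations contained in $D$ are different. -}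

module Defs where

open import Data.Empty using (⊥)
open import Data.Fin.Base using (Fin; toℕ; remQuot) renaming (_<_ to _<ᶠ_)
open import Data.Fin.Permutation using (Permutation′; _⟨$⟩ʳ_)
open import Data.Fin.Properties using (all?)
  renaming (_≟_ to _≟ᶠ_; _<?_ to _<ᶠ?_; <-asym to <ᶠ-asym; <-cmp to <ᶠ-cmp)
open import Data.Fin.Subset using (Subset; Side; inside; outside; _∈_)
open import Data.Fin.Subset.Properties using (_∈?_)
open import Data.List.Base
  using (List; []; _∷_; length; filter; map; allFin; cartesianProductWith)
open import Data.List.Extrema.Nat using (max)
open import Data.List.Membership.Propositional using (lose; find) renaming (_∈_ to _∈ˡ_)
open import Data.List.Membership.Propositional.Properties
  using (∈-allFin; ∈-cartesianProductWith⁺)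
open import Data.List.Properties using (filter-some; filter-none)
import Data.List.Relation.Unary.All as All
import Data.List.Relation.Unary.Any as Any
open import Data.List.Relation.Unary.Any using (here; there)
open import Data.List.Relation.Unary.Unique.Propositional using (Unique)
import Data.List.Relation.Unary.Unique.Propositional.Properties as Unique
open import Data.List.Relation.Unary.AllPairs using ([]; _∷_)
open import Data.Nat.Base using (ℕ; zero; suc; _*_; _<_; _≤_)
open import Data.Nat.Divisibility using (_∣_; _∣?_; _∣0)
open import Data.Nat.Induction using (<-rec)
open import Data.Nat.ListAction using (sum)
open import Data.Nat.Properties using (_≟_; anyUpTo?; m<n⇒n≢0; ≮⇒≥)
open import Data.Product.Base using (Σ; ∃; ∃-syntax; _×_; _,_; proj₁; proj₂)
open import Data.Sum.Base using (_⊎_; inj₁; inj₂)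
open import Data.Vec.Base using (Vec; []; _∷_; lookup; tabulate)
open import Data.Vec.Properties using (lookup∘tabulate; lookup⇒[]=; []=⇒lookup; ∷-injective)
open import Function.Bundles using (_⇔_)
open import Level using (0ℓ)
open import Relation.Binary.Core using (Rel)
open import Relation.Binary.Definitions
  using (Decidable; Symmetric; Irreflexive; tri<; tri≈; tri>)
open import Relation.Binary.PropositionalEquality
  using (_≡_; _≢_; refl; sym; trans; cong; subst)
open import Relation.Nullary.Decidable
  using (Dec; yes; no; does; map′; ¬?; _×-dec_; _⊎-dec_; _→-dec_; dec-true)
open import Relation.Nullary.Negation using (¬_; contradiction)
open import Relation.Unary using (Pred) renaming (Decidable to Decidable₁)

private
  variable
    m n k : ℕ

count : {P : Pred (Fin n) 0ℓ} → Decidable₁ P → ℕ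
count {n} P? = length (filter P? (allFin n))

maximum : (Fin n → ℕ) → ℕ
maximum {n} f = max 0 (map f (allFin n))

record Graph (n : ℕ) : Set₁ where
  infix 4 _~_ _~?_
  field
    _~_    : Rel (Fin n) 0ℓ
    _~?_   : Decidable _~_
    symm   : Symmetric _~_
    irrefl : Irreflexive _≡_ _~_

degree : Graph n → Fin n → ℕ
degree G u = count (u ~?_) where open Graph G

Δ : Graph n → ℕ
Δ G = maximum (degree G)

IsComplete : Graph n → Set
IsComplete G = ∀ u v → u ≢ v → u ~ v where open Graph G

-- j follows i in the cyclic order 0, 1, …, n - 1, 0.
CyclicSuc : Rel (Fin n) 0ℓ
CyclicSuc {n} i j = toℕ j ≡ suc (toℕ i) ⊎ (suc (toℕ i) ≡ n × toℕ j ≡ 0)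

IsCycle : Graph n → Set
IsCycle {n} G =
  3 ≤ n ×
  (Σ (Permutation′ n) λ c → ∀ i j → (c ⟨$⟩ʳ i ~ c ⟨$⟩ʳ j) ⇔ (CyclicSuc i j ⊎ CyclicSuc j i))
  where open Graph G

IsOddCycle : Graph n → Set
IsOddCycle {n} G = IsCycle G × ¬ (2 ∣ n)

record HamiltonPath (H : Graph m) : Set where
  open Graph H
  field
    vertices    : Permutation′ m
    consecutive : ∀ i j → toℕ j ≡ suc (toℕ i) → vertices ⟨$⟩ʳ i ~ vertices ⟨$⟩ʳ j

backDegree : {H : Graph m} → HamiltonPath H → Fin m → ℕ
backDegree {H = H} P i = count λ j → (j <ᶠ? i) ×-dec (w j ~? w i)
  where
  open Graph H
  w = HamiltonPath.vertices P ⟨$⟩ʳ_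

-- The vertex combine u v of G □ H stands for the pair (u , v).
infixr 7 _□_
_□_ : Graph n → Graph m → Graph (n * m)
_□_ {n} {m} G H = record
  { _~_    = λ x y → Adj (pair x) (pair y)
  ; _~?_   = λ x y → adj? (pair x) (pair y)
  ; symm   = adj-sym
  ; irrefl = λ { refl → adj-irrefl }
  }
  where
  module G = Graph G
  module H = Graph H

  pair : Fin (n * m) → Fin n × Fin m
  pair = remQuot m

  Adj : Rel (Fin n × Fin m) 0ℓ
  Adj (u , v) (u′ , v′) = (u ≡ u′ × v H.~ v′) ⊎ (v ≡ v′ × u G.~ u′)

  adj? : Decidable Adj
  adj? (u , v) (u′ , v′) =
    ((u ≟ᶠ u′) ×-dec (v H.~? v′)) ⊎-dec ((v ≟ᶠ v′) ×-dec (u G.~? u′))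

  adj-sym : ∀ {p q} → Adj p q → Adj q p
  adj-sym (inj₁ (e , a)) = inj₁ (sym e , H.symm a)
  adj-sym (inj₂ (e , a)) = inj₂ (sym e , G.symm a)

  adj-irrefl : ∀ {p} → ¬ Adj p p
  adj-irrefl (inj₁ (_ , a)) = H.irrefl refl a
  adj-irrefl (inj₂ (_ , a)) = G.irrefl refl a

-- A digraph is given by the vector of its out-neighbourhoods, so that _≡_
-- on Digraph n is equality of arc sets.  Loops are not excluded here; an
-- orientation of a graph, and hence each of its subdigraphs, has none.
Digraph : ℕ → Set
Digraph n = Vec (Subset n) n

Arc : Digraph n → Rel (Fin n) 0ℓ
Arc D u v = v ∈ lookup D u

arc? : (D : Digraph n) → Decidable (Arc D)
arc? D u v = v ∈? lookup D u

indegree outdegree : Digraph n → Fin n → ℕ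
indegree  D v = count λ u → arc? D u v
outdegree D v = count λ w → arc? D v w

maxIndegree : Digraph n → ℕ
maxIndegree D = maximum (indegree D)

size : Digraph n → ℕ
size {n} D = sum (map (outdegree D) (allFin n))

allVecs : {A : Set} → List A → ∀ n → List (Vec A n)
allVecs xs zero    = [] ∷ []
allVecs xs (suc n) = cartesianProductWith _∷_ xs (allVecs xs n)

digraphs : ∀ n → List (Digraph n)
digraphs n = allVecs (allVecs (outside ∷ inside ∷ []) n) n

record IsCirculationIn (D E : Digraph n) : Set where
  constructor circulation
  field
    contained : ∀ u v → Arc E u v → Arc D u v
    balanced  : ∀ v → indegree E v ≡ outdegree E v

isCirculationIn? : (D E : Digraph n) → Dec (IsCirculationIn D E)
isCirculationIn? D E =
  map′ (λ (c , b) → circulation c b) (λ (circulation c b) → c , b)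
    (all? (λ u → all? λ v → arc? E u v →-dec arc? D u v) ×-dec
     all? (λ v → indegree E v ≟ outdegree E v))

#evenCirculations #oddCirculations : Digraph n → ℕ
#evenCirculations {n} D =
  length (filter (λ E → isCirculationIn? D E ×-dec (2 ∣? size E)) (digraphs n))
#oddCirculations {n} D =
  length (filter (λ E → isCirculationIn? D E ×-dec ¬? (2 ∣? size E)) (digraphs n))

record IsOrientation (G : Graph n) (D : Digraph n) : Set where
  constructor orientation
  open Graph G
  field
    sound   : ∀ u v → Arc D u v → u ~ v
    covers  : ∀ u v → u ~ v → Arc D u v ⊎ Arc D v u
    oneWay  : ∀ u v → Arc D u v → ¬ Arc D v u

isOrientation? : (G : Graph n) (D : Digraph n) → Dec (IsOrientation G D)
isOrientation? G D =
  map′ (λ (s , c , o) → orientation s c o) (λ (orientation s c o) → s , c , o)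
    (all? (λ u → all? λ v → arc? D u v →-dec (u ~? v)) ×-dec
     all? (λ u → all? λ v → (u ~? v) →-dec (arc? D u v ⊎-dec arc? D v u)) ×-dec
     all? (λ u → all? λ v → arc? D u v →-dec ¬? (arc? D v u)))
  where open Graph G

-- The maximum indegree is k - 1 (over ℤ, so that k = 0 is impossible).
record Realizes (G : Graph n) (k : ℕ) (D : Digraph n) : Set where
  constructor realizes
  field
    isOrientation : IsOrientation G D
    maxIndegree+1 : suc (maxIndegree D) ≡ k
    even≢odd      : #evenCirculations D ≢ #oddCirculations D

AlonTarsi : Graph n → ℕ → Set
AlonTarsi G k = ∃ (Realizes G k)

IsLeast : Pred ℕ 0ℓ → ℕ → Set
IsLeast P k = P k × (∀ j → P j → k ≤ j)

allVecs-complete : {A : Set} {xs : List A} → (∀ x → x ∈ˡ xs) →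
                   (v : Vec A n) → v ∈ˡ allVecs xs n
allVecs-complete c []      = here refl
allVecs-complete c (x ∷ v) = ∈-cartesianProductWith⁺ _∷_ (c x) (allVecs-complete c v)

allVecs-unique : {A : Set} {xs : List A} → Unique xs → ∀ n → Unique (allVecs xs n)
allVecs-unique u zero    = All.[] ∷ []
allVecs-unique u (suc n) =
  Unique.cartesianProductWith⁺ _∷_ ∷-injective u (allVecs-unique u n)

digraphs-complete : (D : Digraph n) → D ∈ˡ digraphs n
digraphs-complete = allVecs-complete (allVecs-complete sides)
  where
  sides : (s : Side) → s ∈ˡ outside ∷ inside ∷ []
  sides outside = here refl
  sides inside  = there (here refl)

digraphs-unique : ∀ n → Unique (digraphs n)
digraphs-unique n =
  allVecs-unique (allVecs-unique (((λ ()) All.∷ All.[]) ∷ All.[] ∷ []) n) n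

alonTarsi? : (G : Graph n) → Decidable₁ (AlonTarsi G)
alonTarsi? {n} G k =
  map′ (λ p → let D , _ , r = find p in D , r) (λ (D , r) → lose (digraphs-complete D) r)
    (Any.any? realizes? (digraphs n))
  where
  realizes? : Decidable₁ (Realizes G k)
  realizes? D =
    map′ (λ (o , i , e) → realizes o i e) (λ (realizes o i e) → o , i , e)
      (isOrientation? G D ×-dec (suc (maxIndegree D) ≟ k) ×-dec
       ¬? (#evenCirculations D ≟ #oddCirculations D))

least : {P : Pred ℕ 0ℓ} → Decidable₁ P → ∃ P → ∃ (IsLeast P)
least {P} P? (b , Pb) = <-rec (λ b → P b → ∃ (IsLeast P)) step b Pb
  where
  step : ∀ b → (∀ {j} → j < b → P j → ∃ (IsLeast P)) → P b → ∃ (IsLeast P)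
  step b rec Pb with anyUpTo? P? b
  ... | yes (j , j<b , Pj) = rec j<b Pj
  ... | no ∄j              = b , Pb , λ j Pj → ≮⇒≥ λ j<b → ∄j (j , j<b , Pj)

-- Every graph has an orientation whose only circulation is the edgeless
-- one, namely the orientation of each edge towards its larger end.  So AT
-- below is a total function.

fromDec : {R : Rel (Fin n) 0ℓ} → Decidable R → Digraph n
fromDec R? = tabulate λ u → tabulate λ v → does (R? u v)

module _ {R : Rel (Fin n) 0ℓ} (R? : Decidable R) where

  private
    entry : ∀ u v → lookup (lookup (fromDec R?) u) v ≡ does (R? u v)
    entry u v =
      trans (cong (λ s → lookup s v) (lookup∘tabulate _ u)) (lookup∘tabulate _ v)

  fromDec⁺ : ∀ u v → R u v → Arc (fromDec R?) u v
  fromDec⁺ u v r = lookup⇒[]= v _ (trans (entry u v) (dec-true (R? u v) r))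

  fromDec⁻ : ∀ u v → Arc (fromDec R?) u v → R u v
  fromDec⁻ u v a with R? u v | trans (sym (entry u v)) ([]=⇒lookup a)
  ... | yes r | _  = r
  ... | no _  | ()

count-some : {P : Pred (Fin n) 0ℓ} (P? : Decidable₁ P) → ∀ i → P i → count P? ≢ 0
count-some P? i p = m<n⇒n≢0 (filter-some P? (lose (∈-allFin i) p))

count-none : {P : Pred (Fin n) 0ℓ} (P? : Decidable₁ P) → (∀ i → ¬ P i) → count P? ≡ 0
count-none P? ¬p = cong length (filter-none P? (All.universal ¬p (allFin _)))

count-witness : {P : Pred (Fin n) 0ℓ} (P? : Decidable₁ P) → count P? ≢ 0 → ∃ P
count-witness {n} P? c≢0 with Any.any? P? (allFin n)
... | yes p = let i , _ , q = find p in i , q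
... | no ∄p = contradiction (count-none P? λ i q → ∄p (lose (∈-allFin i) q)) c≢0

arcless-size : (E : Digraph n) → (∀ u v → ¬ Arc E u v) → size E ≡ 0
arcless-size {n} E ∄arc = go (allFin n)
  where
  go : ∀ us → sum (map (outdegree E) us) ≡ 0
  go []       = refl
  go (u ∷ us) rewrite count-none (arc? E u) (∄arc u) = go us

acyclic-orientation : (G : Graph n) →
  ∃[ D ] IsOrientation G D × #evenCirculations D ≢ #oddCirculations D
acyclic-orientation {n} G =
  D , orientation sound covers oneWay , λ e → even≢0 (trans e odd≡0)
  where
  open Graph G

  _↗_ : Rel (Fin n) 0ℓ
  u ↗ v = u <ᶠ v × u ~ v

  _↗?_ : Decidable _↗_
  u ↗? v = (u <ᶠ? v) ×-dec (u ~? v)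

  D : Digraph n
  D = fromDec _↗?_

  arc⁻ : ∀ u v → Arc D u v → u ↗ v
  arc⁻ = fromDec⁻ _↗?_

  sound : ∀ u v → Arc D u v → u ~ v
  sound u v a = proj₂ (arc⁻ u v a)

  covers : ∀ u v → u ~ v → Arc D u v ⊎ Arc D v u
  covers u v e with <ᶠ-cmp u v
  ... | tri< u<v _ _ = inj₁ (fromDec⁺ _↗?_ u v (u<v , e))
  ... | tri≈ _ u≡v _ = contradiction e (irrefl u≡v)
  ... | tri> _ _ v<u = inj₂ (fromDec⁺ _↗?_ v u (v<u , symm e))

  oneWay : ∀ u v → Arc D u v → ¬ Arc D v u
  oneWay u v a b = <ᶠ-asym (proj₁ (arc⁻ u v a)) (proj₁ (arc⁻ v u b))

  arcless : ∀ {E} → IsCirculationIn D E → ∀ u v → ¬ Arc E u v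
  arcless {E} (circulation contained balanced) u = <-rec Q step (toℕ u) u refl
    where
    Q : ℕ → Set
    Q t = ∀ u → toℕ u ≡ t → ∀ v → ¬ Arc E u v

    step : ∀ t → (∀ {s} → s < t → Q s) → Q t
    step _ rec u refl v a =
      let indegree≢0 = λ e → count-some (arc? E u) v a (trans (sym (balanced u)) e)
          t , b      = count-witness (λ t → arc? E t u) indegree≢0
      in rec (proj₁ (arc⁻ t u (contained t u b))) t refl u b

  odd≡0 : #oddCirculations D ≡ 0
  odd≡0 = cong length (filter-none _ (All.universal
    (λ E (c , odd) → odd (subst (2 ∣_) (sym (arcless-size E (arcless c))) (2 ∣0)))
    (digraphs n)))

  even≢0 : #evenCirculations D ≢ 0
  even≢0 = m<n⇒n≢0 (filter-some _ (lose (digraphs-complete edgeless)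
    ( circulation (λ u v a → contradiction a (∄arc u v))
        (λ v → trans (count-none (λ u → arc? edgeless u v) (λ u → ∄arc u v))
                     (sym (count-none (arc? edgeless v) (∄arc v))))
    , subst (2 ∣_) (sym (arcless-size edgeless ∄arc)) (2 ∣0) )))
    where
    never? : Decidable {A = Fin n} {B = Fin n} λ _ _ → ⊥
    never? _ _ = no λ ()

    edgeless : Digraph n
    edgeless = fromDec never?

    ∄arc : ∀ u v → ¬ Arc edgeless u v
    ∄arc u v a = fromDec⁻ never? u v a

alonTarsi-nonempty : (G : Graph n) → ∃ (AlonTarsi G)
alonTarsi-nonempty G =
  let D , o , e = acyclic-orientation G in suc (maxIndegree D) , D , realizes o refl e

private
  least-alonTarsi : (G : Graph n) → ∃ (IsLeast (AlonTarsi G))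
  least-alonTarsi G = least (alonTarsi? G) (alonTarsi-nonempty G)

AT : Graph n → ℕ
AT G = proj₁ (least-alonTarsi G)

AT-isLeast : (G : Graph n) → IsLeast (AlonTarsi G) (AT G)
AT-isLeast G = proj₂ (least-alonTarsi G)

-- The coefficient of x^t in the product of x_v - x_u over the edges uv of a graph is, up to sign, the
-- difference between the numbers of even and odd circulations in any orientation with indegrees t, and
-- it is zero if there is no such orientation.  So it suffices to find a monomial with nonzero
-- coefficient and all exponents less than Δ(G) + k.
--
-- The copies of G at w_m, …, w_1 are treated in this order.  Let the current polynomial be the one of
-- the subgraph on the remaining copies, multiplied by a linear form whose coefficients c on the copy
-- at w_i are not constant.  If w_i has d earlier neighbours, fix exponents s + d on its copy, where
-- s ≤ Δ(G) - 1 has total degree |E(G)|.  The monomial x^s does not occur in the polynomial of G, hence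
-- exactly one of the edges leaving the copy downwards contributes its lower end, and what is left is
-- the polynomial of the remaining copies multiplied by a new linear form.  On each neighbouring copy
-- its coefficients are those of x^(s + e_v) in (∑ c_u x_u) times the polynomial of G, up to sign.
-- For a complete graph or an odd cycle, s can be chosen such that these are again not constant; this
-- applies to the copy at w_(i-1) because of the Hamilton path.  At w_1 one nonzero coefficient
-- is left.  At w_m, where there is no linear form yet, s has total degree |E(G)| - 1 instead.

module Submission where

open import Defs
open import Data.Bool.Base using (true; false; if_then_else_)
open import Data.Fin.Base as Fin using (Fin; zero; suc; toℕ; _↑ˡ_; _↑ʳ_; combine)
open import Data.Fin.Induction using (>-weakInduction)
open import Data.Fin.Permutation as Permutation
  using (Permutation′; _⟨$⟩ʳ_; _⟨$⟩ˡ_; _∘ₚ_; inverseˡ; inverseʳ)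
open import Data.Fin.Permutation.Components using (transpose)
import Data.Fin.Properties as Fin
open import Data.Fin.Subset.Properties using (⊆-antisym)
import Data.Integer.Properties as ℤ
open import Data.Integer.Tactic.RingSolver using (solve-∀)
open import Data.List.Base as List
  using (List; []; _∷_; _++_; length; filter; map; allFin; cartesianProduct; tabulate)
open import Data.List.Extrema.Nat using (max<v⁺; xs≤max)
import Data.List.Membership.DecPropositional as DecMembership
open import Data.List.Membership.Propositional using (_∈_; _∉_)
open import Data.List.Membership.Propositional.Properties
  using (∈-filter⁺; ∈-filter⁻; ∈-map⁺; ∈-map⁻; ∈-++⁻; ∈-++⁺ˡ; ∈-++⁺ʳ; ∈-allFin;
         ∈-cartesianProduct⁺; ∈-cartesianProduct⁻)
open import Data.List.Membership.Propositional.Properties.WithK using (unique∧set⇒bag)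
import Data.List.Properties as List
open import Data.List.Relation.Binary.BagAndSetEquality using (∼bag⇒↭)
open import Data.List.Relation.Binary.Permutation.Propositional as Perm using (_↭_)
open import Data.List.Relation.Binary.Pointwise.Base using (Pointwise; []; _∷_)
open import Data.List.Relation.Unary.All as All using (All; []; _∷_)
import Data.List.Relation.Unary.All.Properties as All
open import Data.List.Relation.Unary.AllPairs as AllPairs using (AllPairs; []; _∷_)
import Data.List.Relation.Unary.AllPairs.Properties as AllPairs
open import Data.List.Relation.Unary.Any using (here; there)
open import Data.List.Relation.Unary.Unique.Propositional using (Unique)
import Data.List.Relation.Unary.Unique.Propositional.Properties as Unique
import Data.Nat.Base as ℕ
open import Data.Nat.Base using (ℕ; zero; suc)
open import Data.Nat.Divisibility using (_∣_; _∣?_; divides; ∣m+n∣m⇒∣n; ∣-refl)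
open import Data.Nat.ListAction using (sum)
import Data.Nat.Properties as ℕ
open import Data.Product.Base using (∃-syntax; ∃₂; _×_; _,_; proj₁; proj₂; swap; _,′_)
open import Data.Product.Properties using (≡-dec)
open import Data.Sum.Base as Sum using (_⊎_; inj₁; inj₂; [_,_]′)
open import Data.Vec.Base using (lookup)
open import Data.Vec.Properties using (tabulate∘lookup; tabulate-cong)
open import Function.Base using (_∘_; case_of_; id; _⟨_⟩_)
open import Function.Bundles using (mk⇔; module Equivalence)
open import Level using (0ℓ)
open import Relation.Binary.Core using (Rel)
open import Relation.Binary.Definitions using (Decidable; Symmetric; Irreflexive; tri<; tri≈; tri>)
open import Relation.Binary.PropositionalEquality
open import Relation.Nullary.Decidable
  using (Dec; yes; no; does; dec-true; dec-false; does-⇔; ¬?; _×-dec_; _⊎-dec_; _→-dec_)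
open import Relation.Nullary.Negation using (¬_; contradiction)
open import Relation.Unary using (Pred) renaming (Decidable to Decidable₁)

open ≡-Reasoning

private
  variable
    A B : Set
    n N : ℕ

-- The invariant excludes constant linear forms because these die at once. With all c_u equal and
-- all s_u less than Δ(G), the next form is zero. For K_n, the polynomial times ∑ x_u is
-- antisymmetric of degree one more, so each of its monomials contains an exponent n, which s + e_v
-- cannot reach. For an odd cycle the new coefficients at adjacent vertices are opposite, hence all
-- of them vanish.
--
-- A non-constant form survives for different reasons in the two cases. In K_n, an s with three
-- equal exponents reduces everything to moves of one unit among three vertices, all of whose
-- coefficients agree up to sign. In an odd cycle, s = (1, ..., 1) is forced by the bound and the
-- degree, and the sum of the new coefficients at two adjacent vertices is the difference of the old
-- ones.
--
-- The bound is attained with no slack except at w_1: there are no edges downwards left to take over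
-- the variable of the linear form, so an exponent may grow to Δ(G), and k ≥ 1 is what makes this
-- admissible. The edge w_1 w_2 of the Hamilton path supplies k ≥ 1.

module _ where

  open import Data.Integer.Base
    using (ℤ; 0ℤ; 1ℤ; -1ℤ; _+_; _-_; _*_; -_; _≤_; _<_; +≤+; +<+; -<+; -[1+_])
    renaming (+_ to pos)

  -- Signed sums over lists

  ∑ : List A → (A → ℤ) → ℤ
  ∑ []       f = 0ℤ
  ∑ (x ∷ xs) f = f x + ∑ xs f

  ∑-cong-∈ : ∀ (xs : List A) {f g : A → ℤ} → (∀ {x} → x ∈ xs → f x ≡ g x) → ∑ xs f ≡ ∑ xs g
  ∑-cong-∈ []       e = refl
  ∑-cong-∈ (x ∷ xs) e = cong₂ _+_ (e (here refl)) (∑-cong-∈ xs (e ∘ there))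

  ∑-cong : ∀ (xs : List A) {f g : A → ℤ} → (∀ x → f x ≡ g x) → ∑ xs f ≡ ∑ xs g
  ∑-cong xs e = ∑-cong-∈ xs λ {x} _ → e x

  ∑-zero : ∀ (xs : List A) {f : A → ℤ} → (∀ x → f x ≡ 0ℤ) → ∑ xs f ≡ 0ℤ
  ∑-zero []       e = refl
  ∑-zero (x ∷ xs) e = cong₂ _+_ (e x) (∑-zero xs e)

  private
    interchange : ∀ a b c d → (a + b) + (c + d) ≡ (a + c) + (b + d)
    interchange = solve-∀

  ∑-+ : ∀ (xs : List A) (f g : A → ℤ) → ∑ xs (λ x → f x + g x) ≡ ∑ xs f + ∑ xs g
  ∑-+ []       f g = refl
  ∑-+ (x ∷ xs) f g =
    trans (cong ((f x + g x) +_) (∑-+ xs f g)) (interchange (f x) (g x) (∑ xs f) (∑ xs g))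

  ∑-*ˡ : ∀ (xs : List A) a (f : A → ℤ) → ∑ xs (λ x → a * f x) ≡ a * ∑ xs f
  ∑-*ˡ []       a f = sym (ℤ.*-zeroʳ a)
  ∑-*ˡ (x ∷ xs) a f =
    trans (cong (a * f x +_) (∑-*ˡ xs a f)) (sym (ℤ.*-distribˡ-+ a (f x) (∑ xs f)))

  ∑-neg : ∀ (xs : List A) (f : A → ℤ) → ∑ xs (λ x → - f x) ≡ - ∑ xs f
  ∑-neg []       f = refl
  ∑-neg (x ∷ xs) f =
    trans (cong (- f x +_) (∑-neg xs f)) (sym (ℤ.neg-distrib-+ (f x) (∑ xs f)))

  ∑-comm : ∀ (xs : List A) (ys : List B) (f : A → B → ℤ) →
           ∑ xs (λ x → ∑ ys (f x)) ≡ ∑ ys (λ y → ∑ xs (λ x → f x y))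
  ∑-comm []       ys f = sym (∑-zero ys λ _ → refl)
  ∑-comm (x ∷ xs) ys f =
    trans (cong (∑ ys (f x) +_) (∑-comm xs ys f)) (sym (∑-+ ys (f x) _))

  ∑-++ : ∀ (xs ys : List A) (f : A → ℤ) → ∑ (xs ++ ys) f ≡ ∑ xs f + ∑ ys f
  ∑-++ []       ys f = sym (ℤ.+-identityˡ _)
  ∑-++ (x ∷ xs) ys f =
    trans (cong (f x +_) (∑-++ xs ys f)) (sym (ℤ.+-assoc (f x) (∑ xs f) (∑ ys f)))

  ∑-map : ∀ (h : A → B) xs (f : B → ℤ) → ∑ (map h xs) f ≡ ∑ xs (f ∘ h)
  ∑-map h []       f = refl
  ∑-map h (x ∷ xs) f = cong (f (h x) +_) (∑-map h xs f)

  ∑-× : ∀ (xs : List A) (ys : List B) (f : A × B → ℤ) →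
        ∑ (cartesianProduct xs ys) f ≡ ∑ xs (λ x → ∑ ys (λ y → f (x , y)))
  ∑-× []       ys f = refl
  ∑-× (x ∷ xs) ys f =
    trans (∑-++ (map (x ,_) ys) _ f) (cong₂ _+_ (∑-map (x ,_) ys f) (∑-× xs ys f))

  ∑-↭ : ∀ {xs ys : List A} (f : A → ℤ) → xs ↭ ys → ∑ xs f ≡ ∑ ys f
  ∑-↭ f Perm.refl         = refl
  ∑-↭ f (Perm.prep x p)   = cong (f x +_) (∑-↭ f p)
  ∑-↭ f (Perm.swap {xs} {ys} x y p) = trans (cong (λ s → f x + (f y + s)) (∑-↭ f p)) (lemma (f x) (f y) (∑ ys f))
    where
    lemma : ∀ a b c → a + (b + c) ≡ b + (a + c)
    lemma = solve-∀
  ∑-↭ f (Perm.trans p q)  = trans (∑-↭ f p) (∑-↭ f q)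

  ∑-one : ∀ (xs : List A) → ∑ xs (λ _ → 1ℤ) ≡ pos (length xs)
  ∑-one []       = refl
  ∑-one (x ∷ xs) = trans (cong (1ℤ +_) (∑-one xs)) refl

  𝟙 : Dec A → ℤ
  𝟙 d = if does d then 1ℤ else 0ℤ

  𝟙-yes : (d : Dec A) → A → 𝟙 d ≡ 1ℤ
  𝟙-yes d a = cong (if_then 1ℤ else 0ℤ) (dec-true d a)

  𝟙-no : (d : Dec A) → ¬ A → 𝟙 d ≡ 0ℤ
  𝟙-no d ¬a = cong (if_then 1ℤ else 0ℤ) (dec-false d ¬a)

  𝟙-⇔ : (a? : Dec A) (b? : Dec B) → (A → B) → (B → A) → 𝟙 a? ≡ 𝟙 b?
  𝟙-⇔ a? b? f g = cong (if_then 1ℤ else 0ℤ) (does-⇔ (mk⇔ f g) a? b?)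

  0≤𝟙 : (d : Dec A) → 0ℤ ≤ 𝟙 d
  0≤𝟙 d with does d
  ... | true  = +≤+ ℕ.z≤n
  ... | false = +≤+ ℕ.z≤n

  𝟙≤1 : (d : Dec A) → 𝟙 d ≤ 1ℤ
  𝟙≤1 d with does d
  ... | true  = ℤ.≤-refl
  ... | false = +≤+ ℕ.z≤n

  δ : Fin n → Fin n → ℤ
  δ v u = 𝟙 (v Fin.≟ u)

  δ-≡ : (v : Fin n) → δ v v ≡ 1ℤ
  δ-≡ v = 𝟙-yes (v Fin.≟ v) refl

  δ-≢ : {v u : Fin n} → v ≢ u → δ v u ≡ 0ℤ
  δ-≢ {v = v} {u} = 𝟙-no (v Fin.≟ u)

  δ-injective : (f : Fin n → Fin N) → (∀ {i j} → f i ≡ f j → i ≡ j) → ∀ v u → δ (f v) (f u) ≡ δ v u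
  δ-injective f inj v u = 𝟙-⇔ (f v Fin.≟ f u) (v Fin.≟ u) inj (cong f)

  ∑-allFin-suc : (f : Fin (suc n) → ℤ) → ∑ (allFin (suc n)) f ≡ f zero + ∑ (allFin n) (f ∘ suc)
  ∑-allFin-suc {n} f = cong (f zero +_)
    (trans (cong (λ xs → ∑ xs f) (sym (List.map-tabulate {n = n} id suc))) (∑-map suc (allFin n) f))

  ∑-*δ : (f : Fin n → ℤ) (v : Fin n) → ∑ (allFin n) (λ u → f u * δ v u) ≡ f v
  ∑-*δ {suc n} f zero = begin
    ∑ (allFin (suc n)) (λ u → f u * δ zero u)             ≡⟨ ∑-allFin-suc (λ u → f u * δ zero u) ⟩
    f zero * 1ℤ + ∑ (allFin n) (λ u → f (suc u) * 0ℤ)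
      ≡⟨ cong₂ _+_ (ℤ.*-identityʳ (f zero)) (∑-zero (allFin n) (λ u → ℤ.*-zeroʳ (f (suc u)))) ⟩
    f zero + 0ℤ                                           ≡⟨ ℤ.+-identityʳ (f zero) ⟩
    f zero                                                ∎
  ∑-*δ {suc n} f (suc v) = begin
    ∑ (allFin (suc n)) (λ u → f u * δ (suc v) u)          ≡⟨ ∑-allFin-suc (λ u → f u * δ (suc v) u) ⟩
    f zero * 0ℤ + ∑ (allFin n) (λ u → f (suc u) * δ v u)  ≡⟨ cong₂ _+_ (ℤ.*-zeroʳ (f zero)) (∑-*δ (f ∘ suc) v) ⟩
    0ℤ + f (suc v)                                        ≡⟨ ℤ.+-identityˡ (f (suc v)) ⟩
    f (suc v)                                             ∎

  ∑-δ : (v : Fin n) → ∑ (allFin n) (δ v) ≡ 1ℤ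
  ∑-δ {n} v = trans (∑-cong (allFin n) λ u → sym (ℤ.*-identityˡ (δ v u))) (∑-*δ (λ _ → 1ℤ) v)

  δ-sym : (u v : Fin n) → δ u v ≡ δ v u
  δ-sym u v = 𝟙-⇔ (u Fin.≟ v) (v Fin.≟ u) sym sym

  -- Coefficients of products of binomials

  Exponent : ℕ → Set
  Exponent n = Fin n → ℤ

  infixl 6 _⊕_ _⊖_
  _⊕_ _⊖_ : Exponent n → Fin n → Exponent n
  (t ⊕ v) u = t u + δ v u
  (t ⊖ v) u = t u - δ v u

  Edge : ℕ → Set
  Edge n = Fin n × Fin n

  isZero? : (t : Exponent n) → Dec (∀ v → t v ≡ 0ℤ)
  isZero? t = Fin.all? λ v → t v ℤ.≟ 0ℤ

  -- coeff es t is the coefficient of x^t in the product of x_v - x_u over the edges (u , v).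
  -- Exponents are integers, so that shifting them needs no side conditions.
  coeff : List (Edge n) → Exponent n → ℤ
  coeff []             t = 𝟙 (isZero? t)
  coeff ((u , v) ∷ es) t = coeff es (t ⊖ v) - coeff es (t ⊖ u)

  coeff-[]-zero : ∀ (t : Exponent n) → ¬ (∀ v → t v ≡ 0ℤ) → coeff [] t ≡ 0ℤ
  coeff-[]-zero t ¬z = 𝟙-no (isZero? t) ¬z

  coeff-[]-one : ∀ (t : Exponent n) → (∀ v → t v ≡ 0ℤ) → coeff [] t ≡ 1ℤ
  coeff-[]-one t z = 𝟙-yes (isZero? t) z

  coeff-cong : ∀ (es : List (Edge n)) {s t : Exponent n} → (∀ v → s v ≡ t v) → coeff es s ≡ coeff es t
  coeff-cong []             {s} {t} e = 𝟙-⇔ (isZero? s) (isZero? t)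
    (λ z v → trans (sym (e v)) (z v)) (λ z v → trans (e v) (z v))
  coeff-cong ((u , v) ∷ es) e =
    cong₂ _-_ (coeff-cong es λ w → cong (_- δ v w) (e w)) (coeff-cong es λ w → cong (_- δ u w) (e w))

  degree∑ : Exponent n → ℤ
  degree∑ {n} = ∑ (allFin n)

  degree∑-⊖ : ∀ (t : Exponent n) v → degree∑ (t ⊖ v) ≡ degree∑ t - 1ℤ
  degree∑-⊖ {n} t v = trans (∑-+ (allFin n) t (λ u → - δ v u))
    (cong (degree∑ t +_) (trans (∑-neg (allFin n) (δ v)) (cong -_ (∑-δ v))))

  degree∑-⊕ : ∀ (t : Exponent n) v → degree∑ (t ⊕ v) ≡ degree∑ t + 1ℤ
  degree∑-⊕ {n} t v = trans (∑-+ (allFin n) t (δ v)) (cong (degree∑ t +_) (∑-δ v))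

  private
    -1-cancel : ∀ d ℓ → d - 1ℤ ≡ ℓ → d ≡ 1ℤ + ℓ
    -1-cancel d ℓ e = trans (lemma d) (cong (λ x → 1ℤ + x) e)
      where
      lemma : ∀ d → d ≡ 1ℤ + (d - 1ℤ)
      lemma = solve-∀

  coeff-homogeneous : ∀ (es : List (Edge n)) t → degree∑ t ≢ pos (length es) → coeff es t ≡ 0ℤ
  coeff-homogeneous {n} [] t d≢0 = coeff-[]-zero t λ z → d≢0 (∑-zero (allFin n) z)
  coeff-homogeneous ((u , v) ∷ es) t d≢ = cong₂ _-_ (drop v) (drop u)
    where
    drop : ∀ w → coeff es (t ⊖ w) ≡ 0ℤ
    drop w = coeff-homogeneous es (t ⊖ w)
      λ e → d≢ (-1-cancel (degree∑ t) (pos (length es)) (trans (sym (degree∑-⊖ t w)) e))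

  coeff-negative : ∀ (es : List (Edge n)) t v → t v < 0ℤ → coeff es t ≡ 0ℤ
  coeff-negative []             t v neg = coeff-[]-zero t λ z → ℤ.<-irrefl (z v) neg
  coeff-negative ((a , b) ∷ es) t v neg = cong₂ _-_ (drop b) (drop a)
    where
    drop : ∀ w → coeff es (t ⊖ w) ≡ 0ℤ
    drop w = coeff-negative es (t ⊖ w) v
      (ℤ.≤-<-trans (ℤ.≤-trans (ℤ.+-monoʳ-≤ (t v) (ℤ.neg-mono-≤ (0≤𝟙 (w Fin.≟ v)))) (ℤ.≤-reflexive (ℤ.+-identityʳ (t v)))) neg)

  coeff-↭ : ∀ {es es′ : List (Edge n)} → es ↭ es′ → ∀ t → coeff es t ≡ coeff es′ t
  coeff-↭ Perm.refl                      t = refl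
  coeff-↭ (Perm.prep (u , v) p)          t = cong₂ _-_ (coeff-↭ p (t ⊖ v)) (coeff-↭ p (t ⊖ u))
  coeff-↭ (Perm.trans p q)               t = trans (coeff-↭ p t) (coeff-↭ q t)
  coeff-↭ (Perm.swap {es} {es′} (a , b) (c , d) p) t =
    trans (cong₂ _-_ (cong₂ _-_ (move b d) (move b c)) (cong₂ _-_ (move a d) (move a c)))
          (lemma (coeff es′ (t ⊖ d ⊖ b)) (coeff es′ (t ⊖ c ⊖ b)) (coeff es′ (t ⊖ d ⊖ a)) (coeff es′ (t ⊖ c ⊖ a)))
    where
    exchange′ : ∀ x y z → x - y - z ≡ x - z - y
    exchange′ = solve-∀
    move : ∀ x y → coeff es (t ⊖ x ⊖ y) ≡ coeff es′ (t ⊖ y ⊖ x)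
    move x y = trans (coeff-↭ p (t ⊖ x ⊖ y)) (coeff-cong es′ λ w → exchange′ (t w) (δ x w) (δ y w))
    lemma : ∀ p q r s → p - q - (r - s) ≡ p - r - (q - s)
    lemma = solve-∀

  mapEdge : (Fin n → Fin N) → Edge n → Edge N
  mapEdge f (u , v) = f u , f v

  coeff-map : ∀ (f : Fin n → Fin N) (g : Fin N → Fin n) →
              (∀ v → f (g v) ≡ v) → (∀ v → g (f v) ≡ v) →
              ∀ es t → coeff (map (mapEdge f) es) t ≡ coeff es (t ∘ f)
  coeff-map f g fg gf []             t = 𝟙-⇔ (isZero? t) (isZero? (t ∘ f))
    (λ z v → z (f v)) (λ z v → trans (cong t (sym (fg v))) (z (g v)))
  coeff-map f g fg gf ((u , v) ∷ es) t = cong₂ _-_ (step v) (step u)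
    where
    f-injective : ∀ {i j} → f i ≡ f j → i ≡ j
    f-injective {i} {j} e = trans (sym (gf i)) (trans (cong g e) (gf j))
    step : ∀ w → coeff (map (mapEdge f) es) (t ⊖ f w) ≡ coeff es (t ∘ f ⊖ w)
    step w = trans (coeff-map f g fg gf es (t ⊖ f w))
      (coeff-cong es λ x → cong (λ d → t (f x) - d) (δ-injective f f-injective w x))


  ↑ˡ≢↑ʳ : ∀ (u : Fin n) (v : Fin N) → u ↑ˡ N ≢ n ↑ʳ v
  ↑ˡ≢↑ʳ {n} {N} u v e
    with trans (sym (Fin.splitAt-↑ˡ n u N)) (trans (cong (Fin.splitAt n) e) (Fin.splitAt-↑ʳ n N v))
  ... | ()

  ⊖-top-top : ∀ (t : Exponent (n ℕ.+ N)) w u → (t ⊖ (w ↑ˡ N)) (u ↑ˡ N) ≡ ((λ u → t (u ↑ˡ N)) ⊖ w) u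
  ⊖-top-top {N = N} t w u =
    cong (λ d → t (u ↑ˡ N) - d) (δ-injective (_↑ˡ N) (Fin.↑ˡ-injective N _ _) w u)

  ⊖-top-bottom : ∀ (t : Exponent (n ℕ.+ N)) w u → (t ⊖ (w ↑ˡ N)) (n ↑ʳ u) ≡ t (n ↑ʳ u)
  ⊖-top-bottom {n} t w u =
    trans (cong (λ d → t (n ↑ʳ u) - d) (δ-≢ (↑ˡ≢↑ʳ w u))) (ℤ.+-identityʳ _)

  ⊖-bottom-bottom : ∀ (t : Exponent (n ℕ.+ N)) w u → (t ⊖ (n ↑ʳ w)) (n ↑ʳ u) ≡ ((λ u → t (n ↑ʳ u)) ⊖ w) u
  ⊖-bottom-bottom {n} t w u =
    cong (λ d → t (n ↑ʳ u) - d) (δ-injective (n ↑ʳ_) (Fin.↑ʳ-injective n _ _) w u)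

  ⊖-bottom-top : ∀ (t : Exponent (n ℕ.+ N)) w u → (t ⊖ (n ↑ʳ w)) (u ↑ˡ N) ≡ t (u ↑ˡ N)
  ⊖-bottom-top {N = N} t w u =
    trans (cong (λ d → t (u ↑ˡ N) - d) (δ-≢ (↑ˡ≢↑ʳ u w ∘ sym))) (ℤ.+-identityʳ _)

  infixr 5 _⊎ᴱ_
  _⊎ᴱ_ : List (Edge n) → List (Edge N) → List (Edge (n ℕ.+ N))
  _⊎ᴱ_ {n} {N} es fs = map (mapEdge (_↑ˡ N)) es ++ map (mapEdge (n ↑ʳ_)) fs

  private
    -‿*ʳ : ∀ a b c → a * c - b * c ≡ (a - b) * c
    -‿*ʳ = solve-∀
    -‿*ˡ : ∀ a b c → a * b - a * c ≡ a * (b - c)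
    -‿*ˡ = solve-∀

  -- The two lists share no vertex, so the two polynomials have disjoint sets of variables.
  coeff-⊎ : ∀ (es : List (Edge n)) (fs : List (Edge N)) t →
            coeff (es ⊎ᴱ fs) t ≡ coeff es (λ u → t (u ↑ˡ N)) * coeff fs (λ u → t (n ↑ʳ u))
  coeff-⊎ {n} {N} ((a , b) ∷ es) fs t =
    trans (cong₂ _-_ (step b) (step a))
          (-‿*ʳ (coeff es (top ⊖ b)) (coeff es (top ⊖ a)) (coeff fs (λ u → t (n ↑ʳ u))))
    where
    top = λ u → t (u ↑ˡ N)
    step : ∀ w → coeff (es ⊎ᴱ fs) (t ⊖ (w ↑ˡ N)) ≡ coeff es (top ⊖ w) * coeff fs (λ u → t (n ↑ʳ u))
    step w = trans (coeff-⊎ es fs (t ⊖ (w ↑ˡ N)))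
      (cong₂ _*_ (coeff-cong es (⊖-top-top t w)) (coeff-cong fs (⊖-top-bottom t w)))
  coeff-⊎ {n} {N} [] ((a , b) ∷ fs) t =
    trans (cong₂ _-_ (step b) (step a))
          (-‿*ˡ (coeff {n} [] top) (coeff fs (bottom ⊖ b)) (coeff fs (bottom ⊖ a)))
    where
    top = λ u → t (u ↑ˡ N)
    bottom = λ u → t (n ↑ʳ u)
    step : ∀ w → coeff ([] ⊎ᴱ fs) (t ⊖ (n ↑ʳ w)) ≡ coeff [] top * coeff fs (bottom ⊖ w)
    step w = trans (coeff-⊎ [] fs (t ⊖ (n ↑ʳ w)))
      (cong₂ _*_ (coeff-cong {n} [] (⊖-bottom-top t w)) (coeff-cong fs (⊖-bottom-bottom t w)))
  coeff-⊎ {n} {N} [] [] t = case isZero? top of λ where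
      (yes z) → trans (𝟙-⇔ (isZero? t) (isZero? bottom) (λ z′ v → z′ (n ↑ʳ v)) (both z))
        (trans (sym (ℤ.*-identityˡ _)) (cong (_* coeff {N} [] bottom) (sym (coeff-[]-one top z))))
      (no ¬z) → trans (coeff-[]-zero t λ z′ → ¬z λ v → z′ (v ↑ˡ N))
        (trans (sym (ℤ.*-zeroˡ (coeff {N} [] bottom))) (cong (_* coeff {N} [] bottom) (sym (coeff-[]-zero top ¬z))))
    where
    top = λ u → t (u ↑ˡ N)
    bottom = λ u → t (n ↑ʳ u)
    both : (∀ u → top u ≡ 0ℤ) → (∀ u → bottom u ≡ 0ℤ) → ∀ v → t v ≡ 0ℤ
    both p q v with Fin.splitAt n v in eq
    ... | inj₁ u = trans (cong t (sym (Fin.splitAt⁻¹-↑ˡ eq))) (p u)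
    ... | inj₂ u = trans (cong t (sym (Fin.splitAt⁻¹-↑ʳ eq))) (q u)

  -- Peeling off a layer

  -- The head is the end in the upper copy: contributing the upper end has sign +1, contributing the
  -- lower end has sign -1.
  crossEdge : Fin N × Fin n → Edge (n ℕ.+ N)
  crossEdge {N} {n} (y , u) = n ↑ʳ y , u ↑ˡ N

  multiplicity : List (Fin N × Fin n) → Exponent n
  multiplicity C u = ∑ C λ (_ , v) → δ v u

  private
    top : Exponent (n ℕ.+ N) → Exponent n
    top {N = N} t u = t (u ↑ˡ N)

    bottom : Exponent (n ℕ.+ N) → Exponent N
    bottom {n} t y = t (n ↑ʳ y)

  module _ {n N : ℕ} (gs : List (Edge n)) (lo : List (Edge N)) where

    layered : List (Fin N × Fin n) → List (Edge (n ℕ.+ N))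
    layered C = map crossEdge C ++ gs ⊎ᴱ lo

    private
      degree-top : ∀ (t : Exponent (n ℕ.+ N)) u → degree∑ (top {n} (t ⊖ (u ↑ˡ N))) ≡ degree∑ (top {n} t) - 1ℤ
      degree-top t u = trans (∑-cong (allFin n) (⊖-top-top t u)) (degree∑-⊖ (top {n} t) u)

      degree-bottom : ∀ (t : Exponent (n ℕ.+ N)) y → degree∑ (top {n} (t ⊖ (n ↑ʳ y))) ≡ degree∑ (top {n} t)
      degree-bottom t y = ∑-cong (allFin n) (⊖-bottom-top t y)

    -- In the variables of the top copy the polynomial has degree at most |C| + |gs|, since a
    -- crossing contributes at most one of them. The excess over this bound is `suc r`.
    coeff-layered-above : ∀ C t r → degree∑ (top {n} t) ≡ pos (length C ℕ.+ (suc r ℕ.+ length gs)) →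
                          coeff (layered C) t ≡ 0ℤ
    coeff-layered-above [] t r e = trans (coeff-⊎ gs lo t)
      (cong (_* coeff lo (bottom {n} t)) (coeff-homogeneous gs (top {n} t)
        λ e′ → ℕ.m≢1+n+m (length gs) (ℤ.+-injective (trans (sym e′) e))))
    coeff-layered-above ((y , u) ∷ C) t r e = cong₂ _-_
      (coeff-layered-above C _ r (trans (degree-top t u) (cong (_- 1ℤ) e)))
      -- Choosing the lower end uses up a crossing without lowering the top degree, so the excess
      -- grows by one.
      (coeff-layered-above C _ (suc r) (trans (degree-bottom t y)
        (trans e (cong pos (sym (ℕ.+-suc (length C) (suc r ℕ.+ length gs)))))))

    -- The top degree is the largest possible one, so every crossing has to contribute its upper
    -- end, and the two remaining edge lists are independent.
    coeff-layered-leading : ∀ C t → degree∑ (top {n} t) ≡ pos (length C ℕ.+ length gs) →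
      coeff (layered C) t ≡ coeff gs (λ u → top {n} t u - multiplicity C u) * coeff lo (bottom {n} t)
    coeff-layered-leading [] t e = trans (coeff-⊎ gs lo t)
      (cong (_* coeff lo (bottom {n} t)) (coeff-cong gs λ u → sym (ℤ.+-identityʳ (top {n} t u))))
    coeff-layered-leading ((y , u) ∷ C) t e = begin
      coeff (layered C) t↑ - coeff (layered C) (t ⊖ (n ↑ʳ y))
        ≡⟨ cong₂ _-_ (coeff-layered-leading C t↑ (trans (degree-top t u) (cong (_- 1ℤ) e)))
                     (coeff-layered-above C _ 0 (trans (degree-bottom t y)
                       (trans e (cong pos (sym (ℕ.+-suc (length C) (length gs))))))) ⟩
      coeff gs (λ v → top {n} t↑ v - multiplicity C v) * coeff lo (bottom {n} t↑) - 0ℤ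
        ≡⟨ ℤ.+-identityʳ _ ⟩
      coeff gs (λ v → top {n} t↑ v - multiplicity C v) * coeff lo (bottom {n} t↑)
        ≡⟨ cong₂ _*_ (coeff-cong gs λ v → trans (cong (_- multiplicity C v) (⊖-top-top t u v))
                       (sub-sub (top {n} t v) (δ u v) (multiplicity C v)))
                     (coeff-cong lo (⊖-top-bottom t u)) ⟩
      coeff gs (λ v → top {n} t v - multiplicity ((y , u) ∷ C) v) * coeff lo (bottom {n} t) ∎
      where
      t↑ = t ⊖ (u ↑ˡ N)
      sub-sub : ∀ a b c → a - b - c ≡ a - (b + c)
      sub-sub = solve-∀

    -- The top degree is one below the largest possible one, so exactly one crossing contributes its
    -- lower end. The sum runs over this crossing: the upper end `u` keeps the unit that it would
    -- have given away, and the lower end `y` pays it instead.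
    coeff-layered-subleading : ∀ C t → degree∑ (top {n} t) + 1ℤ ≡ pos (length C ℕ.+ length gs) →
      coeff (layered C) t ≡
      - ∑ C λ (y , u) → coeff gs ((λ v → top {n} t v - multiplicity C v) ⊕ u) * coeff lo (bottom {n} t ⊖ y)
    coeff-layered-subleading [] t e = trans (coeff-⊎ gs lo t)
      (cong (_* coeff lo (bottom {n} t)) (coeff-homogeneous gs (top {n} t)
        λ e′ → ℕ.m≢1+n+m (length gs) {0} (ℤ.+-injective (trans (sym e) (trans (cong (_+ 1ℤ) e′)
          (cong pos (ℕ.+-comm (length gs) 1)))))))
    coeff-layered-subleading ((y , u) ∷ C) t e = begin
      coeff (layered C) t↑ - coeff (layered C) t↓
        ≡⟨ cong₂ _-_ (coeff-layered-subleading C t↑ (trans (cong (_+ 1ℤ) (degree-top t u))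
                        (trans (sub-add (degree∑ (top {n} t))) (cong (_- 1ℤ) e))))
                     (coeff-layered-leading C t↓ (trans (degree-bottom t y)
                        (trans (sub-add′ (degree∑ (top {n} t))) (cong (_- 1ℤ) e)))) ⟩
      - (∑ C λ (z , w) → coeff gs ((λ v → top {n} t↑ v - multiplicity C v) ⊕ w) * coeff lo (bottom {n} t↑ ⊖ z))
        - coeff gs (λ v → top {n} t↓ v - multiplicity C v) * coeff lo (bottom {n} t↓)
        ≡⟨ cong₂ (λ a b → - a - b)
             (∑-cong C λ (z , w) → cong₂ _*_
               (coeff-cong gs λ v → cong (_+ δ w v) (trans (cong (_- multiplicity C v) (⊖-top-top t u v))
                 (sub-sub (top {n} t v) (δ u v) (multiplicity C v))))
               (coeff-cong lo λ v → cong (_- δ z v) (⊖-top-bottom t u v)))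
             (cong₂ _*_ (coeff-cong gs λ v → trans (cong (_- multiplicity C v) (⊖-bottom-top t y v))
                          (restore (top {n} t v) (δ u v) (multiplicity C v)))
                        (coeff-cong lo (⊖-bottom-bottom t y))) ⟩
      - rest - first
        ≡⟨ neg-sum rest first ⟩
      - (first + rest) ∎
      where
      t↑ = t ⊖ (u ↑ˡ N)
      t↓ = t ⊖ (n ↑ʳ y)
      term : Fin N × Fin n → ℤ
      term (z , w) = coeff gs ((λ v → top {n} t v - multiplicity ((y , u) ∷ C) v) ⊕ w) * coeff lo (bottom {n} t ⊖ z)
      first rest : ℤ
      first = term (y , u)
      rest  = ∑ C term
      sub-sub : ∀ a b c → a - b - c ≡ a - (b + c)
      sub-sub = solve-∀
      restore : ∀ a b c → a - c ≡ a - (b + c) + b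
      restore = solve-∀
      sub-add : ∀ a → a - 1ℤ + 1ℤ ≡ a + 1ℤ - 1ℤ
      sub-add = solve-∀
      sub-add′ : ∀ a → a ≡ a + 1ℤ - 1ℤ
      sub-add′ = solve-∀
      neg-sum : ∀ a b → - a - b ≡ - (b + a)
      neg-sum = solve-∀

  -- Reducing linear forms layer by layer

  NonConstant : (Fin n → ℤ) → Set
  NonConstant c = ∃₂ λ u v → c u ≢ c v

  nonConstant⇒≢0 : {c : Fin n → ℤ} → NonConstant c → ∃[ v ] c v ≢ 0ℤ
  nonConstant⇒≢0 {c = c} (u , v , u≢v) with c u ℤ.≟ 0ℤ
  ... | no cu≢0  = u , cu≢0
  ... | yes cu≡0 = v , λ cv≡0 → u≢v (trans cu≡0 (sym cv≡0))

  -- At `v` this is the coefficient of x^(s + e_v) in the product of ∑ c_u x_u and the polynomial of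
  -- `es`.
  transfer : List (Edge n) → Exponent n → (Fin n → ℤ) → Fin n → ℤ
  transfer {n} es s c v = ∑ (allFin n) λ u → c u * coeff es (s ⊖ u ⊕ v)

  -- What the induction over the copies needs to know about G, with `d` in the place of Δ(G):
  -- `initial` serves the first copy and `step` all others. The total degree of `s` is not recorded,
  -- because non-constancy determines it by homogeneity. The condition `coeff es s ≡ 0ℤ` removes the
  -- terms of the linear form that lie on other copies.
  record Reducible (es : List (Edge n)) (d : ℕ) : Set where
    field
      initial : ∃[ s ] (∀ u → s u < pos d) × NonConstant (λ v → coeff es (s ⊕ v))
      step    : ∀ c → NonConstant c →
                ∃[ s ] (∀ u → s u < pos d) × coeff es s ≡ 0ℤ × NonConstant (transfer es s c)

  module _ {i : ℕ} {R : Rel (Fin (suc i)) 0ℓ} (R? : Decidable R) where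

    -- Index `zero` is the uppermost copy, the last one on the path, so that its earlier neighbours
    -- are its neighbours among all remaining indices.
    lowerNeighbours : List (Fin i)
    lowerNeighbours = filter (λ j → R? zero (suc j)) (allFin i)

  crossings : ∀ n {i} → List (Fin i) → List (Fin (i ℕ.* n) × Fin n)
  crossings n J = map (λ (j , u) → combine j u , u) (cartesianProduct J (allFin n))

  layers : List (Edge n) → ∀ i {R : Rel (Fin i) 0ℓ} → Decidable R → List (Edge (i ℕ.* n))
  layers         es zero    R? = []
  layers {n} es (suc i) R? =
    layered es (layers es i (λ a b → R? (suc a) (suc b))) (crossings n (lowerNeighbours R?))

  -- The base clause carries `1 ≤ k` down to the lowest copy, where an exponent receives the
  -- variable of the linear form itself.
  BackBounded : ℕ → ∀ i {R : Rel (Fin i) 0ℓ} → Decidable R → Set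
  BackBounded k zero    R? = 1 ℕ.≤ k
  BackBounded k (suc i) R? =
    length (lowerNeighbours R?) ℕ.≤ k × BackBounded k i (λ a b → R? (suc a) (suc b))

  ∑-crossings : ∀ {i} (J : List (Fin i)) (f : Fin (i ℕ.* n) × Fin n → ℤ) →
                ∑ (crossings n J) f ≡ ∑ J λ j → ∑ (allFin n) λ u → f (combine j u , u)
  ∑-crossings {n} J f = trans (∑-map _ (cartesianProduct J (allFin n)) f) (∑-× J (allFin n) _)

  multiplicity-crossings : ∀ {i} (J : List (Fin i)) (u : Fin n) → multiplicity (crossings n J) u ≡ pos (length J)
  multiplicity-crossings {n} J u = begin
    multiplicity (crossings n J) u                ≡⟨ ∑-crossings J _ ⟩
    (∑ J λ _ → ∑ (allFin n) λ v → δ v u)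
      ≡⟨ ∑-cong J (λ _ → trans (∑-cong (allFin n) λ v → δ-sym v u) (∑-δ u)) ⟩
    (∑ J λ _ → 1ℤ)                                ≡⟨ ∑-one J ⟩
    pos (length J)                                ∎

  degree-multiplicity : (C : List (Fin N × Fin n)) → degree∑ (multiplicity C) ≡ pos (length C)
  degree-multiplicity {n = n} C =
    trans (∑-comm (allFin n) C _) (trans (∑-cong C λ (_ , v) → ∑-δ v) (∑-one C))

  glue : Exponent n → Exponent N → Exponent (n ℕ.+ N)
  glue {n} s t = [ s , t ]′ ∘ Fin.splitAt n

  glue-↑ˡ : ∀ (s : Exponent n) (t : Exponent N) u → glue s t (u ↑ˡ N) ≡ s u
  glue-↑ˡ {n} {N} s t u = cong [ s , t ]′ (Fin.splitAt-↑ˡ n u N)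

  glue-↑ʳ : ∀ (s : Exponent n) (t : Exponent N) y → glue s t (n ↑ʳ y) ≡ t y
  glue-↑ʳ {n} {N} s t y = cong [ s , t ]′ (Fin.splitAt-↑ʳ n N y)

  glue-< : ∀ (s : Exponent n) (t : Exponent N) {b} → (∀ u → s u < b) → (∀ y → t y < b) → ∀ x → glue s t x < b
  glue-< {n} s t s< t< x with Fin.splitAt n x
  ... | inj₁ u = s< u
  ... | inj₂ y = t< y

  module _ {n N : ℕ} (gs : List (Edge n)) (lo : List (Edge N)) (C : List (Fin N × Fin n))
           (s : Exponent n) (t′ : Exponent N) (t : Exponent (n ℕ.+ N))
           (t-top : ∀ u → t (u ↑ˡ N) ≡ s u + multiplicity C u) (t-bottom : ∀ y → t (n ↑ʳ y) ≡ t′ y) where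

    private
      degree-top : degree∑ (λ u → t (u ↑ˡ N)) ≡ degree∑ s + pos (length C)
      degree-top = trans (∑-cong (allFin n) t-top)
        (trans (∑-+ (allFin n) s (multiplicity C)) (cong (degree∑ s +_) (degree-multiplicity C)))

      top-s : ∀ u → t (u ↑ˡ N) - multiplicity C u ≡ s u
      top-s u = trans (cong (_- multiplicity C u) (t-top u)) (lemma (s u) (multiplicity C u))
        where
        lemma : ∀ a b → a + b - b ≡ a
        lemma = solve-∀

    leading : degree∑ s ≡ pos (length gs) → coeff (layered gs lo C) t ≡ coeff gs s * coeff lo t′
    leading e = trans
      (coeff-layered-leading gs lo C t
        (trans degree-top (trans (cong (_+ pos (length C)) e) (ℤ.+-comm (pos (length gs)) (pos (length C))))))
      (cong₂ _*_ (coeff-cong gs top-s) (coeff-cong lo t-bottom))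

    subleading : degree∑ s + 1ℤ ≡ pos (length gs) →
      coeff (layered gs lo C) t ≡ - ∑ C λ (y , u) → coeff gs (s ⊕ u) * coeff lo (t′ ⊖ y)
    subleading e = trans
      (coeff-layered-subleading gs lo C t
        (trans (cong (_+ 1ℤ) degree-top) (trans (lemma (degree∑ s) (pos (length C))) (cong (pos (length C) +_) e))))
      (cong -_ (∑-cong C λ (y , u) → cong₂ _*_
        (coeff-cong gs λ v → cong (_+ δ u v) (top-s v))
        (coeff-cong lo λ z → cong (_- δ y z) (t-bottom z))))
      where
      lemma : ∀ a b → a + b + 1ℤ ≡ b + (a + 1ℤ)
      lemma = solve-∀

  -- The coefficient of x^t in the polynomial of `es` times a linear form that has the same
  -- coefficients `c` on every copy in `J`.
  linear : ∀ {i} → List (Edge (i ℕ.* n)) → List (Fin i) → (Fin n → ℤ) → Exponent (i ℕ.* n) → ℤ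
  linear {n} es J c t = ∑ J λ j → ∑ (allFin n) λ u → c u * coeff es (t ⊖ combine j u)

  module _ {n d k : ℕ} {gs : List (Edge n)} (reducible : Reducible gs d) where

    open Reducible reducible

    private
      extract : ∀ {i} (J : List (Fin i)) (c : Fin n → ℤ) (g : Fin n → Fin n → ℤ) (h : Fin (i ℕ.* n) → ℤ) →
        ∑ (allFin n) (λ u → c u * - ∑ (crossings n J) λ (y , v) → g u v * h y) ≡
        - ∑ J λ j → ∑ (allFin n) λ v → ∑ (allFin n) (λ u → c u * g u v) * h (combine j v)
      extract J c g h = begin
        ∑ F (λ u → c u * - ∑ (crossings n J) λ (y , v) → g u v * h y)
          ≡⟨ ∑-cong F (λ u → trans (cong (λ x → c u * - x) (∑-crossings J _))
               (trans (sym (ℤ.neg-distribʳ-* (c u) _)) (cong -_ (trans (sym (∑-*ˡ J (c u) _))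
                 (∑-cong J λ j → sym (∑-*ˡ F (c u) _)))))) ⟩
        ∑ F (λ u → - ∑ J λ j → ∑ F λ v → c u * (g u v * h (combine j v)))
          ≡⟨ ∑-neg F _ ⟩
        - ∑ F (λ u → ∑ J λ j → ∑ F λ v → c u * (g u v * h (combine j v)))
          ≡⟨ cong -_ (∑-comm F J _) ⟩
        - ∑ J (λ j → ∑ F λ u → ∑ F λ v → c u * (g u v * h (combine j v)))
          ≡⟨ cong -_ (∑-cong J λ j → trans (∑-comm F F _) (∑-cong F λ v →
               trans (∑-cong F λ u → rotate (c u) (g u v) (h (combine j v)))
                     (trans (∑-*ˡ F (h (combine j v)) _) (ℤ.*-comm (h (combine j v)) _)))) ⟩
        - ∑ J (λ j → ∑ F λ v → ∑ F (λ u → c u * g u v) * h (combine j v)) ∎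
        where
        F = allFin n
        rotate : ∀ a b c → a * (b * c) ≡ c * (a * b)
        rotate = solve-∀

      degree-⊖⊕ : ∀ (s : Exponent n) u v → degree∑ (s ⊖ u ⊕ v) ≡ degree∑ s
      degree-⊖⊕ s u v = trans (degree∑-⊕ (s ⊖ u) v) (trans (cong (_+ 1ℤ) (degree∑-⊖ s u)) (lemma (degree∑ s)))
        where
        lemma : ∀ a → a - 1ℤ + 1ℤ ≡ a
        lemma = solve-∀

      -- The polynomial of `gs` is homogeneous: for any other degree of `s` every term of `transfer`
      -- would vanish, and the zero function is constant.
      transfer-degree : ∀ s c → NonConstant (transfer gs s c) → degree∑ s ≡ pos (length gs)
      transfer-degree s c nc with degree∑ s ℤ.≟ pos (length gs)
      ... | yes e = e
      ... | no ≢e =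
        let v , ≢0 = nonConstant⇒≢0 nc
        in contradiction (∑-zero (allFin n) λ u → trans
             (cong (c u *_) (coeff-homogeneous gs (s ⊖ u ⊕ v) λ e → ≢e (trans (sym (degree-⊖⊕ s u v)) e)))
             (ℤ.*-zeroʳ (c u))) ≢0

      initial-degree : ∀ s → NonConstant (λ v → coeff gs (s ⊕ v)) → degree∑ s + 1ℤ ≡ pos (length gs)
      initial-degree s nc with degree∑ s + 1ℤ ℤ.≟ pos (length gs)
      ... | yes e = e
      ... | no ≢e =
        let v , ≢0 = nonConstant⇒≢0 nc
        in contradiction (coeff-homogeneous gs (s ⊕ v) λ e → ≢e (trans (sym (degree∑-⊕ s v)) e)) ≢0

      raise : ∀ {i} → Exponent n → List (Fin i) → Exponent (i ℕ.* n) → Exponent (suc i ℕ.* n)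
      raise s J = glue λ u → s u + multiplicity (crossings n J) u

      raise-↑ˡ : ∀ {i} s (J : List (Fin i)) t′ u →
                 raise s J t′ (u ↑ˡ (i ℕ.* n)) ≡ s u + multiplicity (crossings n J) u
      raise-↑ˡ s J t′ = glue-↑ˡ (λ u → s u + multiplicity (crossings n J) u) t′

      raise-↑ʳ : ∀ {i} s (J : List (Fin i)) t′ y → raise s J t′ (n ↑ʳ y) ≡ t′ y
      raise-↑ʳ s J t′ = glue-↑ʳ (λ u → s u + multiplicity (crossings n J) u) t′

      raise-< : ∀ {i} s (J : List (Fin i)) t′ → length J ℕ.≤ k → (∀ u → s u < pos d) →
                (∀ y → t′ y < pos (d ℕ.+ k)) → ∀ x → raise s J t′ x < pos (d ℕ.+ k)
      raise-< s J t′ J≤k s<d t′< = glue-< (λ u → s u + multiplicity (crossings n J) u) t′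
        (λ u → ℤ.<-≤-trans (ℤ.+-monoˡ-< (multiplicity (crossings n J) u) (s<d u))
          (ℤ.≤-trans (ℤ.≤-reflexive (cong (pos d +_) (multiplicity-crossings J u)))
                     (ℤ.+-monoʳ-≤ (pos d) (+≤+ J≤k)))) t′<

      -- Here the Hamilton path enters: the next copy is among the neighbours, so the new linear
      -- form involves the uppermost remaining copy, as the induction requires.
      lowerNeighbours-path : ∀ {i} {R : Rel (Fin (suc (suc i))) 0ℓ} (R? : Decidable R) → R zero (suc zero) →
        ∃[ J ] lowerNeighbours R? ≡ zero ∷ map suc J
      lowerNeighbours-path {i} R? r = filter P? (allFin i) , (begin
        filter (λ j → R? zero (suc j)) (allFin (suc i))
          ≡⟨ List.filter-accept (λ j → R? zero (suc j)) r ⟩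
        zero ∷ filter (λ j → R? zero (suc j)) (tabulate suc)
          ≡⟨ cong (λ xs → zero ∷ filter (λ j → R? zero (suc j)) xs) (sym (List.map-tabulate (λ j → j) suc)) ⟩
        zero ∷ filter (λ j → R? zero (suc j)) (map suc (allFin i))
          ≡⟨ cong (zero ∷_) (filter-map (allFin i)) ⟩
        zero ∷ map suc (filter P? (allFin i))                              ∎)
        where
        P? = λ j → R? zero (suc (suc j))
        filter-map : ∀ js → filter (λ j → R? zero (suc j)) (map suc js) ≡ map suc (filter P? js)
        filter-map []       = refl
        filter-map (j ∷ js) with does (P? j)
        ... | true  = cong (suc j ∷_) (filter-map js)
        ... | false = filter-map js

    -- The form lives on `zero ∷ map suc J`, the earlier neighbours of the copy just peeled off.
    -- Only its part on copy `zero` matters, since the choice of `s` annihilates the rest; this part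
    -- turns into a form on the earlier neighbours of copy `zero`, to which the induction hypothesis
    -- applies.
    linear-≢0 : ∀ i {R : Rel (Fin (suc i)) 0ℓ} (R? : Decidable R) →
      (∀ a b → toℕ b ≡ suc (toℕ a) → R a b) → BackBounded k (suc i) R? →
      ∀ c → NonConstant c → (J : List (Fin i)) →
      ∃[ t ] (∀ x → t x < pos (d ℕ.+ k)) × linear (layers gs (suc i) R?) (zero ∷ map suc J) c t ≢ 0ℤ
    linear-≢0 zero R? path (_ , 1≤k) c nc [] with step c nc
    ... | s , s<d , _ , nc′ = t , glue-< (s ⊕ v) (λ ()) top< (λ ()) , ≢0 ∘ trans (sym value)
      where
      v  = proj₁ (nonConstant⇒≢0 nc′)
      ≢0 = proj₂ (nonConstant⇒≢0 nc′)
      -- No crossing is left to absorb the variable taken from the form. It is added at a vertex `v`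
      -- with nonzero new coefficient, where the exponent may reach `d`; this is less than `d + k`
      -- by `1 ≤ k`.
      t : Exponent (n ℕ.+ 0)
      t = glue (s ⊕ v) λ ()
      top< : ∀ u → (s ⊕ v) u < pos (d ℕ.+ k)
      top< u = ℤ.<-≤-trans (ℤ.+-mono-<-≤ (s<d u) (𝟙≤1 (v Fin.≟ u))) (+≤+ (ℕ.+-monoʳ-≤ d 1≤k))
      degree-s = transfer-degree s c nc′
      value : linear {n} {1} (layers gs 1 R?) (zero ∷ []) c t ≡ transfer gs s c v
      value = trans (ℤ.+-identityʳ _) (∑-cong (allFin n) λ u → cong (c u *_) (trans
        (leading gs [] [] (s ⊖ u ⊕ v) (λ ()) (t ⊖ (u ↑ˡ 0))
          (λ w → trans (⊖-top-top t u w) (trans (cong (_- δ u w) (glue-↑ˡ (s ⊕ v) (λ ()) w))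
            (shuffle (s w) (δ v w) (δ u w))))
          (λ ())
          (trans (degree-⊖⊕ s u v) degree-s))
        (trans (cong (coeff gs (s ⊖ u ⊕ v) *_) (coeff-[]-one {0} (λ ()) λ ())) (ℤ.*-identityʳ _))))
        where
        shuffle : ∀ a b c → a + b - c ≡ a - c + b + 0ℤ
        shuffle = solve-∀
    linear-≢0 (suc i) R? path (J′≤k , bounded) c nc J with step c nc
    ... | s , s<d , s-zero , nc′
      with lowerNeighbours-path R? (path zero (suc zero) refl)
    ... | J″ , J′≡ with linear-≢0 i (λ a b → R? (suc a) (suc b)) (λ a b e → path (suc a) (suc b) (cong suc e))
                          bounded (transfer gs s c) nc′ J″
    ... | t′ , t′< , ≢0 = t , raise-< s J′ t′ J′≤k s<d t′< ,
          λ e → ≢0 (ℤ.neg-injective (trans (sym value) e))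
      where
      J′ = lowerNeighbours R?
      lo = layers gs (suc i) (λ a b → R? (suc a) (suc b))
      es = layers gs (suc (suc i)) R?
      t = raise s J′ t′
      degree-s = transfer-degree s c nc′
      M′ = suc i ℕ.* n

      -- The form takes a variable of the top copy, which leaves that copy one below its maximal
      -- degree: the subleading case.
      at-top : ∀ u → coeff es (t ⊖ combine {suc (suc i)} zero u) ≡
               - ∑ (crossings n J′) λ (y , v) → coeff gs (s ⊖ u ⊕ v) * coeff lo (t′ ⊖ y)
      at-top u = subleading gs lo (crossings n J′) (s ⊖ u) t′ (t ⊖ (u ↑ˡ M′))
        (λ w → trans (⊖-top-top t u w) (trans (cong (_- δ u w) (raise-↑ˡ s J′ t′ w))
          (shuffle (s w) (multiplicity (crossings n J′) w) (δ u w))))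
        (λ y → trans (⊖-top-bottom {n} t u y) (raise-↑ʳ s J′ t′ y))
        (trans (cong (_+ 1ℤ) (degree∑-⊖ s u)) (trans (restore (degree∑ s)) degree-s))
        where
        shuffle : ∀ a b c → a + b - c ≡ a - c + b
        shuffle = solve-∀
        restore : ∀ a → a - 1ℤ + 1ℤ ≡ a
        restore = solve-∀

      -- The form takes a variable of a lower copy, so the top copy has its maximal degree, and the
      -- leading coefficient contains the factor `coeff gs s`, which is zero.
      below : ∀ j u → coeff es (t ⊖ combine {suc (suc i)} (suc j) u) ≡ 0ℤ
      below j u = trans
        (leading gs lo (crossings n J′) s (t′ ⊖ combine j u) (t ⊖ (n ↑ʳ combine j u))
          (λ w → trans (⊖-bottom-top t (combine j u) w) (raise-↑ˡ s J′ t′ w))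
          (λ y → trans (⊖-bottom-bottom {n} t (combine j u) y) (cong (_- δ (combine j u) y) (raise-↑ʳ s J′ t′ y)))
          degree-s)
        (cong (_* coeff lo (t′ ⊖ combine j u)) s-zero)

      value : linear es (zero ∷ map suc J) c t ≡ - linear lo (zero ∷ map suc J″) (transfer gs s c) t′
      value = begin
        ∑ (allFin n) (λ u → c u * coeff es (t ⊖ combine {suc (suc i)} zero u)) + linear es (map suc J) c t
          ≡⟨ cong₂ _+_ (∑-cong (allFin n) λ u → cong (c u *_) (at-top u))
               (trans (∑-map suc J _) (∑-zero J λ j → ∑-zero (allFin n) λ u →
                 trans (cong (c u *_) (below j u)) (ℤ.*-zeroʳ (c u)))) ⟩
        ∑ (allFin n) (λ u → c u * - ∑ (crossings n J′) λ (y , v) → coeff gs (s ⊖ u ⊕ v) * coeff lo (t′ ⊖ y)) + 0ℤ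
          ≡⟨ ℤ.+-identityʳ _ ⟩
        ∑ (allFin n) (λ u → c u * - ∑ (crossings n J′) λ (y , v) → coeff gs (s ⊖ u ⊕ v) * coeff lo (t′ ⊖ y))
          ≡⟨ extract J′ c (λ u v → coeff gs (s ⊖ u ⊕ v)) (λ y → coeff lo (t′ ⊖ y)) ⟩
        - linear lo J′ (transfer gs s c) t′
          ≡⟨ cong (λ xs → - linear lo xs (transfer gs s c) t′) J′≡ ⟩
        - linear lo (zero ∷ map suc J″) (transfer gs s c) t′ ∎

    coeff-layers-≢0 : ∀ i {R : Rel (Fin (suc (suc i))) 0ℓ} (R? : Decidable R) →
      (∀ a b → toℕ b ≡ suc (toℕ a) → R a b) → BackBounded k (suc (suc i)) R? →
      ∃[ t ] (∀ x → t x < pos (d ℕ.+ k)) × coeff (layers gs (suc (suc i)) R?) t ≢ 0ℤ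
    coeff-layers-≢0 i R? path (J′≤k , bounded) with initial
    ... | s , s<d , nc with lowerNeighbours-path R? (path zero (suc zero) refl)
    ... | J″ , J′≡ with linear-≢0 i (λ a b → R? (suc a) (suc b)) (λ a b e → path (suc a) (suc b) (cong suc e))
                          bounded (λ v → coeff gs (s ⊕ v)) nc J″
    ... | t′ , t′< , ≢0 = raise s J′ t′ , raise-< s J′ t′ J′≤k s<d t′< ,
          λ e → ≢0 (ℤ.neg-injective (trans (sym value) e))
      where
      J′ = lowerNeighbours R?
      lo = layers gs (suc i) (λ a b → R? (suc a) (suc b))
      value : coeff (layers gs (suc (suc i)) R?) (raise s J′ t′) ≡
              - linear lo (zero ∷ map suc J″) (λ v → coeff gs (s ⊕ v)) t′
      value = begin
        coeff (layers gs (suc (suc i)) R?) (raise s J′ t′)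
          ≡⟨ subleading gs lo (crossings n J′) s t′ (raise s J′ t′) (raise-↑ˡ s J′ t′) (raise-↑ʳ s J′ t′) (initial-degree s nc) ⟩
        - ∑ (crossings n J′) (λ (y , u) → coeff gs (s ⊕ u) * coeff lo (t′ ⊖ y))
          ≡⟨ cong -_ (∑-crossings J′ _) ⟩
        - linear lo J′ (λ v → coeff gs (s ⊕ v)) t′
          ≡⟨ cong (λ xs → - linear lo xs (λ v → coeff gs (s ⊕ v)) t′) J′≡ ⟩
        - linear lo (zero ∷ map suc J″) (λ v → coeff gs (s ⊕ v)) t′ ∎

  -- Edge enumerations and their orientations

  unique∧set⇒↭ : {xs ys : List A} → Unique xs → Unique ys →
                 (∀ {x} → x ∈ xs → x ∈ ys) → (∀ {x} → x ∈ ys → x ∈ xs) → xs ↭ ys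
  unique∧set⇒↭ xs! ys! f g = ∼bag⇒↭ (unique∧set⇒bag xs! ys! (mk⇔ f g))

  -- An undirected edge is stored as a pair in one of its two directions, so different entries must
  -- differ up to reversal.
  Distinct : Rel (Edge n) 0ℓ
  Distinct e e′ = e ≢ e′ × e ≢ swap e′

  record Enumerates (R : Rel (Fin n) 0ℓ) (es : List (Edge n)) : Set where
    field
      distinct : AllPairs Distinct es
      sound    : ∀ {u v} → (u , v) ∈ es → R u v
      complete : ∀ {u v} → R u v → (u , v) ∈ es ⊎ (v , u) ∈ es

    unique : Unique es
    unique = AllPairs.map proj₁ distinct

    module _ (irreflexive : Irreflexive _≡_ R) where

      oneWay : ∀ {u v} → (u , v) ∈ es → (v , u) ∉ es
      oneWay p q = go distinct p q λ { refl → irreflexive refl (sound p) }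
        where
        go : ∀ {fs u v} → AllPairs Distinct fs → (u , v) ∈ fs → (v , u) ∈ fs → ¬ (u ≢ v)
        go (_ ∷ _)  (here refl) (here refl) u≢v = u≢v refl
        go (d ∷ _)  (here refl) (there q)   _   = proj₂ (All.lookup d q) refl
        go (d ∷ _)  (there p)   (here refl) _   = proj₂ (All.lookup d p) refl
        go (_ ∷ ds) (there p)   (there q)   u≢v = go ds p q u≢v

  Flip : Rel (Edge n) 0ℓ
  Flip e d = d ≡ e ⊎ d ≡ swap e

  flips-∈⁺ : ∀ {es ds : List (Edge n)} → Pointwise Flip es ds →
             ∀ {u v} → (u , v) ∈ es → (u , v) ∈ ds ⊎ (v , u) ∈ ds
  flips-∈⁺ (inj₁ refl ∷ _) (here refl) = inj₁ (here refl)
  flips-∈⁺ (inj₂ refl ∷ _) (here refl) = inj₂ (here refl)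
  flips-∈⁺ (_ ∷ fs)        (there p)   = Sum.map there there (flips-∈⁺ fs p)

  flips-∈⁻ : ∀ {es ds : List (Edge n)} → Pointwise Flip es ds →
             ∀ {u v} → (u , v) ∈ ds → (u , v) ∈ es ⊎ (v , u) ∈ es
  flips-∈⁻ (inj₁ refl ∷ _) (here refl) = inj₁ (here refl)
  flips-∈⁻ (inj₂ refl ∷ _) (here refl) = inj₂ (here refl)
  flips-∈⁻ (_ ∷ fs)        (there p)   = Sum.map there there (flips-∈⁻ fs p)

  distinct-flip : ∀ {e e′ d d′ : Edge n} → Flip e d → Flip e′ d′ → Distinct e e′ → Distinct d d′
  distinct-flip (inj₁ refl) (inj₁ refl) (≢ , ≢ˢ) = ≢ , ≢ˢ
  distinct-flip (inj₁ refl) (inj₂ refl) (≢ , ≢ˢ) = ≢ˢ , ≢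
  distinct-flip (inj₂ refl) (inj₁ refl) (≢ , ≢ˢ) = ≢ˢ ∘ cong swap , ≢ ∘ cong swap
  distinct-flip (inj₂ refl) (inj₂ refl) (≢ , ≢ˢ) = ≢ ∘ cong swap , ≢ˢ ∘ cong swap

  distinct-flips : ∀ {es ds : List (Edge n)} → Pointwise Flip es ds → AllPairs Distinct es → AllPairs Distinct ds
  distinct-flips []       []       = []
  distinct-flips (f ∷ fs) (p ∷ ps) = all f fs p ∷ distinct-flips fs ps
    where
    all : ∀ {e d es ds} → Flip e d → Pointwise Flip es ds → All (Distinct e) es → All (Distinct d) ds
    all f []        []       = []
    all f (f′ ∷ fs) (p ∷ ps) = distinct-flip f f′ p ∷ all f fs ps

  enumerates-flips : ∀ {R : Rel (Fin n) 0ℓ} {es ds} → Symmetric R →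
                     Pointwise Flip es ds → Enumerates R es → Enumerates R ds
  enumerates-flips R-sym fs enum = record
    { distinct = distinct-flips fs distinct
    ; sound    = [ sound , R-sym ∘ sound ]′ ∘ flips-∈⁻ fs
    ; complete = [ flips-∈⁺ fs , Sum.swap ∘ flips-∈⁺ fs ]′ ∘ complete
    }
    where open Enumerates enum

  -- Reversing an edge negates its binomial. The resulting sign is the same for all exponents, hence
  -- the quantifiers inside the disjunction.
  coeff-flips : ∀ {es ds : List (Edge n)} → Pointwise Flip es ds →
                (∀ t → coeff ds t ≡ coeff es t) ⊎ (∀ t → coeff ds t ≡ - coeff es t)
  coeff-flips []                     = inj₁ λ _ → refl
  coeff-flips {es = (u , v) ∷ es} {_ ∷ ds} (f ∷ fs) = lemma {ds = ds} f (coeff-flips fs)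
    where
    negate : ∀ a b → - a - - b ≡ - (a - b)
    negate = solve-∀
    negate′ : ∀ a b → a - b ≡ - (b - a)
    negate′ = solve-∀
    negate″ : ∀ a b → - b - - a ≡ a - b
    negate″ = solve-∀
    lemma : ∀ {d ds} → Flip (u , v) d → (∀ t → coeff ds t ≡ coeff es t) ⊎ (∀ t → coeff ds t ≡ - coeff es t) →
            (∀ t → coeff (d ∷ ds) t ≡ coeff ((u , v) ∷ es) t) ⊎ (∀ t → coeff (d ∷ ds) t ≡ - coeff ((u , v) ∷ es) t)
    lemma (inj₁ refl) (inj₁ e) = inj₁ λ t → cong₂ _-_ (e (t ⊖ v)) (e (t ⊖ u))
    lemma (inj₁ refl) (inj₂ e) = inj₂ λ t →
      trans (cong₂ _-_ (e (t ⊖ v)) (e (t ⊖ u))) (negate (coeff es (t ⊖ v)) (coeff es (t ⊖ u)))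
    lemma (inj₂ refl) (inj₁ e) = inj₂ λ t →
      trans (cong₂ _-_ (e (t ⊖ u)) (e (t ⊖ v))) (negate′ (coeff es (t ⊖ u)) (coeff es (t ⊖ v)))
    lemma (inj₂ refl) (inj₂ e) = inj₁ λ t →
      trans (cong₂ _-_ (e (t ⊖ u)) (e (t ⊖ v))) (negate″ (coeff es (t ⊖ v)) (coeff es (t ⊖ u)))

  heads tails : List (Edge n) → Exponent n
  heads es w = ∑ es λ (_ , v) → δ v w
  tails es w = ∑ es λ (u , _) → δ u w

  private
    sub-move : ∀ a b {c} → a - b ≡ c → a ≡ b + c
    sub-move a b e = trans (lemma a b) (cong (b +_) e)
      where
      lemma : ∀ a b → a ≡ b + (a - b)
      lemma = solve-∀

  -- If the difference of two coefficients is nonzero, so is one of the two. Following a nonzero one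
  -- orients each edge towards the end that pays for it, until the exponent is used up; the exponent
  -- is then the indegree.
  choose-orientation : ∀ (es : List (Edge n)) t → coeff es t ≢ 0ℤ →
                       ∃[ ds ] Pointwise Flip es ds × (∀ v → t v ≡ heads ds v)
  choose-orientation []             t ≢0 with isZero? t
  ... | yes z = [] , [] , z
  ... | no ¬z = contradiction (coeff-[]-zero t ¬z) ≢0
  choose-orientation ((u , v) ∷ es) t ≢0 with coeff es (t ⊖ v) ℤ.≟ 0ℤ
  ... | no ≢0′ = let ds , fs , e = choose-orientation es (t ⊖ v) ≢0′ in
    (u , v) ∷ ds , inj₁ refl ∷ fs , λ w → sub-move (t w) (δ v w) (e w)
  ... | yes ≡0 = let ds , fs , e = choose-orientation es (t ⊖ u) λ ≡0′ → ≢0 (cong₂ _-_ ≡0 ≡0′) in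
    (v , u) ∷ ds , inj₂ refl ∷ fs , λ w → sub-move (t w) (δ u w) (e w)

  sign : ℕ → ℤ
  sign zero    = 1ℤ
  sign (suc k) = - sign k

  sign-parity : ∀ k → (2 ∣ k → sign k ≡ 1ℤ) × (¬ 2 ∣ k → sign k ≡ -1ℤ)
  sign-parity zero          = (λ _ → refl) , λ 2∤0 → contradiction (divides 0 refl) 2∤0
  sign-parity (suc zero)    = (λ { (divides (suc zero) ()) ; (divides (suc (suc _)) ()) }) , λ _ → refl
  sign-parity (suc (suc k)) =
    (λ 2∣k+2 → trans (ℤ.neg-involutive (sign k)) (proj₁ (sign-parity k) (∣m+n∣m⇒∣n 2∣k+2 ∣-refl))) ,
    λ 2∤k+2 → trans (ℤ.neg-involutive (sign k)) (proj₂ (sign-parity k)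
      λ { (divides q refl) → 2∤k+2 (divides (suc q) refl) })

  subsets : List A → List (List A)
  subsets []       = [] ∷ []
  subsets (x ∷ xs) = subsets xs ++ map (x ∷_) (subsets xs)

  -- A term of the expansion of the product reverses the arcs of a subset S of the orientation ds,
  -- and it has the same exponent as ds exactly when S is balanced.
  coeff-subsets : ∀ (ds : List (Edge n)) t →
    coeff ds t ≡ ∑ (subsets ds) λ S → sign (length S) * coeff [] (λ w → t w - heads ds w + heads S w - tails S w)
  coeff-subsets []             t = begin
    coeff [] t                                        ≡⟨ coeff-cong [] (λ w → lemma (t w)) ⟩
    coeff [] t₀                                       ≡⟨ lemma′ (coeff [] t₀) ⟩
    1ℤ * coeff [] t₀ + 0ℤ                             ∎
    where
    t₀ = λ w → t w - 0ℤ + 0ℤ - 0ℤ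
    lemma : ∀ a → a ≡ a - 0ℤ + 0ℤ - 0ℤ
    lemma = solve-∀
    lemma′ : ∀ a → a ≡ 1ℤ * a + 0ℤ
    lemma′ = solve-∀
  coeff-subsets {n} ((u , v) ∷ ds) t = begin
    coeff ds (t ⊖ v) - coeff ds (t ⊖ u)
      ≡⟨ cong₂ (λ a b → a - b) (coeff-subsets ds (t ⊖ v)) (coeff-subsets ds (t ⊖ u)) ⟩
    ∑ Ss (term ds (t ⊖ v)) - ∑ Ss (term ds (t ⊖ u))
      ≡⟨ cong (∑ Ss (term ds (t ⊖ v)) +_) (sym (∑-neg Ss (term ds (t ⊖ u)))) ⟩
    ∑ Ss (term ds (t ⊖ v)) + ∑ Ss (λ S → - term ds (t ⊖ u) S)
      ≡⟨ cong₂ _+_ (∑-cong Ss λ S → cong (sign (length S) *_) (coeff-cong [] λ w →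
                     keep (t w) (δ v w) (heads ds w) (heads S w) (tails S w)))
                   (∑-cong Ss λ S → trans (ℤ.neg-distribˡ-* (sign (length S)) _)
                     (cong (- sign (length S) *_) (coeff-cong [] λ w →
                       reverse (t w) (δ v w) (δ u w) (heads ds w) (heads S w) (tails S w)))) ⟩
    ∑ Ss (term ((u , v) ∷ ds) t) + ∑ Ss (λ S → term ((u , v) ∷ ds) t ((u , v) ∷ S))
      ≡⟨ cong (∑ Ss (term ((u , v) ∷ ds) t) +_) (sym (∑-map ((u , v) ∷_) Ss (term ((u , v) ∷ ds) t))) ⟩
    ∑ Ss (term ((u , v) ∷ ds) t) + ∑ (map ((u , v) ∷_) Ss) (term ((u , v) ∷ ds) t)
      ≡⟨ sym (∑-++ Ss _ (term ((u , v) ∷ ds) t)) ⟩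
    ∑ (subsets ((u , v) ∷ ds)) (term ((u , v) ∷ ds) t) ∎
    where
    Ss = subsets ds
    term : List (Edge n) → Exponent n → List (Edge n) → ℤ
    term ds t S = sign (length S) * coeff [] (λ w → t w - heads ds w + heads S w - tails S w)
    keep : ∀ t v h a b → t - v - h + a - b ≡ t - (v + h) + a - b
    keep = solve-∀
    reverse : ∀ t v u h a b → t - u - h + a - b ≡ t - (v + h) + (v + a) - (u + b)
    reverse = solve-∀

  -- Circulations as subsets of an orientation

  subset-⊆ : ∀ {xs S : List A} → S ∈ subsets xs → ∀ {x} → x ∈ S → x ∈ xs
  subset-⊆ {xs = []}     (here refl) ()
  subset-⊆ {xs = x ∷ xs} p with ∈-++⁻ (subsets xs) p
  ... | inj₁ q = there ∘ subset-⊆ q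
  ... | inj₂ q with ∈-map⁻ (x ∷_) q
  ... | S , q′ , refl = λ { (here refl) → here refl ; (there r) → there (subset-⊆ q′ r) }

  subsets-unique : ∀ {xs : List A} → Unique xs → Unique (subsets xs)
  subsets-unique []                          = [] ∷ []
  subsets-unique {xs = x ∷ xs} (x∉xs ∷ xs!) = Unique.++⁺ (subsets-unique xs!)
    (Unique.map⁺ (λ { refl → refl }) (subsets-unique xs!))
    λ (p , q) → case ∈-map⁻ (x ∷_) q of λ where
      (S , _ , refl) → All.lookup x∉xs (subset-⊆ p (here refl)) refl

  subset-unique : ∀ {xs S : List A} → Unique xs → S ∈ subsets xs → Unique S
  subset-unique [] (here refl) = []
  subset-unique {xs = x ∷ xs} (x∉xs ∷ xs!) p with ∈-++⁻ (subsets xs) p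
  ... | inj₁ q = subset-unique xs! q
  ... | inj₂ q with ∈-map⁻ (x ∷_) q
  ... | S , q′ , refl = All.tabulate (λ r → All.lookup x∉xs (subset-⊆ q′ r)) ∷ subset-unique xs! q′

  filter-∈-subsets : ∀ {P : Pred A 0ℓ} (P? : Decidable₁ P) xs → filter P? xs ∈ subsets xs
  filter-∈-subsets P? []       = here refl
  filter-∈-subsets P? (x ∷ xs) with does (P? x)
  ... | true  = ∈-++⁺ʳ (subsets xs) (∈-map⁺ (x ∷_) (filter-∈-subsets P? xs))
  ... | false = ∈-++⁺ˡ (filter-∈-subsets P? xs)

  -- Members of `subsets xs` keep the order of `xs`, so without repetitions they are determined by
  -- their elements.
  filter-subset : ∀ {P : Pred A 0ℓ} (P? : Decidable₁ P) {xs S} → Unique xs → S ∈ subsets xs →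
                  (∀ {x} → x ∈ xs → P x → x ∈ S) → (∀ {x} → x ∈ S → P x) → filter P? xs ≡ S
  filter-subset P? [] (here refl) f g = refl
  filter-subset P? {x ∷ xs} (x∉xs ∷ xs!) p f g with ∈-++⁻ (subsets xs) p
  ... | inj₁ q = trans
    (List.filter-reject P? λ Px → All.lookup x∉xs (subset-⊆ q (f (here refl) Px)) refl)
    (filter-subset P? xs! q (f ∘ there) g)
  ... | inj₂ q with ∈-map⁻ (x ∷_) q
  ... | S , q′ , refl = trans (List.filter-accept P? (g (here refl)))
    (cong (x ∷_) (filter-subset P? xs! q′
      (λ y∈xs Py → case f (there y∈xs) Py of λ where
        (here refl) → contradiction refl (All.lookup x∉xs y∈xs)
        (there r)   → r)
      (g ∘ there)))

  _∈ᴱ?_ : (e : Edge n) (S : List (Edge n)) → Dec (e ∈ S)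
  _∈ᴱ?_ = DecMembership._∈?_ (≡-dec Fin._≟_ Fin._≟_)

  digraph : List (Edge n) → Digraph n
  digraph S = fromDec λ u v → (u , v) ∈ᴱ? S

  module _ (S : List (Edge n)) where

    arc⁺ : ∀ {u v} → (u , v) ∈ S → Arc (digraph S) u v
    arc⁺ = fromDec⁺ (λ u v → (u , v) ∈ᴱ? S) _ _

    arc⁻ : ∀ {u v} → Arc (digraph S) u v → (u , v) ∈ S
    arc⁻ = fromDec⁻ (λ u v → (u , v) ∈ᴱ? S) _ _

  -- Degrees become integer sums through this, so that interchanging and reindexing sums applies to
  -- them.
  count-∑ : {P : Pred (Fin n) 0ℓ} (P? : Decidable₁ P) → pos (count P?) ≡ ∑ (allFin n) (λ u → 𝟙 (P? u))
  count-∑ {n} {P} P? = go (allFin n)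
    where
    go : ∀ us → pos (length (filter P? us)) ≡ ∑ us (λ u → 𝟙 (P? u))
    go []       = refl
    go (u ∷ us) with does (P? u)
    ... | true  = cong (1ℤ +_) (go us)
    ... | false = trans (go us) (sym (ℤ.+-identityˡ _))

  -- The sum counts the occurrences of (u , v) in `S`, of which there is at most one.
  𝟙-∈ : ∀ {S : List (Edge n)} → Unique S → ∀ u v →
        𝟙 ((u , v) ∈ᴱ? S) ≡ ∑ S λ (a , b) → δ a u * δ b v
  𝟙-∈ []                              u v = refl
  𝟙-∈ {S = (a , b) ∷ S} (ab∉S ∷ S!) u v = case ≡-dec Fin._≟_ Fin._≟_ (u , v) (a , b) of λ where
      (yes refl) → begin
        𝟙 ((u , v) ∈ᴱ? ((u , v) ∷ S))        ≡⟨ 𝟙-yes ((u , v) ∈ᴱ? ((u , v) ∷ S)) (here refl) ⟩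
        1ℤ + 0ℤ                              ≡⟨ cong₂ _+_ (sym (cong₂ _*_ (δ-≡ u) (δ-≡ v)))
                                                 (trans (sym (𝟙-no ((u , v) ∈ᴱ? S) λ p → All.lookup ab∉S p refl)) (𝟙-∈ S! u v)) ⟩
        δ u u * δ v v + ∑ S (λ (a , b) → δ a u * δ b v) ∎
      (no ≢ab) → begin
        𝟙 ((u , v) ∈ᴱ? ((a , b) ∷ S))        ≡⟨ 𝟙-⇔ ((u , v) ∈ᴱ? ((a , b) ∷ S)) ((u , v) ∈ᴱ? S)
                                                 (λ { (here e) → contradiction e ≢ab ; (there p) → p }) there ⟩
        𝟙 ((u , v) ∈ᴱ? S)                    ≡⟨ 𝟙-∈ S! u v ⟩
        ∑ S (λ (a , b) → δ a u * δ b v)      ≡⟨ sym (ℤ.+-identityˡ _) ⟩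
        0ℤ + ∑ S (λ (a , b) → δ a u * δ b v) ≡⟨ cong (_+ ∑ S (λ (a , b) → δ a u * δ b v)) (sym (off-diagonal ≢ab)) ⟩
        δ a u * δ b v + ∑ S (λ (a , b) → δ a u * δ b v) ∎
    where
    off-diagonal : (u , v) ≢ (a , b) → δ a u * δ b v ≡ 0ℤ
    off-diagonal ≢ab = case a Fin.≟ u of λ where
      (no a≢u)   → trans (cong (_* δ b v) (δ-≢ a≢u)) refl
      (yes refl) → trans (cong (δ a a *_) (δ-≢ {v = b} {v} λ { refl → ≢ab refl })) (ℤ.*-zeroʳ (δ a a))

  module _ {S : List (Edge n)} (S! : Unique S) where

    private
      𝟙-arc : ∀ u v → 𝟙 (arc? (digraph S) u v) ≡ ∑ S λ (a , b) → δ a u * δ b v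
      𝟙-arc u v = trans (𝟙-⇔ (arc? (digraph S) u v) ((u , v) ∈ᴱ? S) (arc⁻ S) (arc⁺ S)) (𝟙-∈ S! u v)

    indegree-digraph : ∀ v → pos (indegree (digraph S) v) ≡ heads S v
    indegree-digraph v = begin
      pos (indegree (digraph S) v)                              ≡⟨ count-∑ (λ u → arc? (digraph S) u v) ⟩
      ∑ (allFin n) (λ u → 𝟙 (arc? (digraph S) u v))             ≡⟨ ∑-cong (allFin n) (λ u → 𝟙-arc u v) ⟩
      (∑ (allFin n) λ u → ∑ S λ (a , b) → δ a u * δ b v)        ≡⟨ ∑-comm (allFin n) S _ ⟩
      (∑ S λ (a , b) → ∑ (allFin n) λ u → δ a u * δ b v)
        ≡⟨ ∑-cong S (λ (a , b) → trans (∑-cong (allFin n) λ u → ℤ.*-comm (δ a u) (δ b v)) (∑-*δ (λ _ → δ b v) a)) ⟩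
      heads S v                                                 ∎

    outdegree-digraph : ∀ u → pos (outdegree (digraph S) u) ≡ tails S u
    outdegree-digraph u = begin
      pos (outdegree (digraph S) u)                             ≡⟨ count-∑ (λ v → arc? (digraph S) u v) ⟩
      ∑ (allFin n) (λ v → 𝟙 (arc? (digraph S) u v))             ≡⟨ ∑-cong (allFin n) (λ v → 𝟙-arc u v) ⟩
      (∑ (allFin n) λ v → ∑ S λ (a , b) → δ a u * δ b v)        ≡⟨ ∑-comm (allFin n) S _ ⟩
      (∑ S λ (a , b) → ∑ (allFin n) λ v → δ a u * δ b v)        ≡⟨ ∑-cong S (λ (a , b) → ∑-*δ (λ _ → δ a u) b) ⟩
      tails S u                                                 ∎

    size-digraph : size (digraph S) ≡ length S
    size-digraph = ℤ.+-injective (begin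
      pos (size (digraph S))                                    ≡⟨ pos-sum (allFin n) ⟩
      ∑ (allFin n) (λ u → pos (outdegree (digraph S) u))        ≡⟨ ∑-cong (allFin n) outdegree-digraph ⟩
      (∑ (allFin n) λ u → ∑ S λ (a , _) → δ a u)                ≡⟨ ∑-comm (allFin n) S _ ⟩
      (∑ S λ (a , _) → ∑ (allFin n) (δ a))                      ≡⟨ ∑-cong S (λ (a , _) → ∑-δ a) ⟩
      (∑ S λ _ → 1ℤ)                                            ≡⟨ ∑-one S ⟩
      pos (length S)                                            ∎)
      where
      pos-sum : ∀ us → pos (sum (map (outdegree (digraph S)) us)) ≡ ∑ us (λ u → pos (outdegree (digraph S) u))
      pos-sum []       = refl
      pos-sum (u ∷ us) = cong (pos (outdegree (digraph S) u) +_) (pos-sum us)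

  digraph-extensional : ∀ {D E : Digraph n} → (∀ u v → Arc D u v → Arc E u v) →
                        (∀ u v → Arc E u v → Arc D u v) → D ≡ E
  digraph-extensional {D = D} {E} D⊆E E⊆D =
    trans (sym (tabulate∘lookup D))
      (trans (tabulate-cong λ u → ⊆-antisym (D⊆E u _) (E⊆D u _)) (tabulate∘lookup E))

  signedCount : ∀ (D : Digraph n) → ℤ
  signedCount {n} D = ∑ (digraphs n) λ E → 𝟙 (isCirculationIn? D E) * sign (size E)

  signedCount-even-odd : (D : Digraph n) → signedCount D ≡ pos (#evenCirculations D) - pos (#oddCirculations D)
  signedCount-even-odd {n} D = go (digraphs n)
    where
    even? = λ E → isCirculationIn? D E ×-dec (2 ∣? size E)
    odd?  = λ E → isCirculationIn? D E ×-dec ¬? (2 ∣? size E)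
    shift₁ : ∀ a b → 1ℤ + (a - b) ≡ 1ℤ + a - b
    shift₁ = solve-∀
    shift₂ : ∀ a b → -1ℤ + (a - b) ≡ a - (1ℤ + b)
    shift₂ = solve-∀
    go : ∀ Es → ∑ Es (λ E → 𝟙 (isCirculationIn? D E) * sign (size E)) ≡
                pos (length (filter even? Es)) - pos (length (filter odd? Es))
    go [] = refl
    go (E ∷ Es) = case isCirculationIn? D E of λ where
      (no ¬c) → trans (cong₂ _+_ (trans (cong (_* sign (size E)) (𝟙-no (isCirculationIn? D E) ¬c)) refl) (go Es))
        (trans (ℤ.+-identityˡ _) (cong₂ (λ xs ys → pos (length xs) - pos (length ys))
          (sym (List.filter-reject even? {xs = Es} (¬c ∘ proj₁))) (sym (List.filter-reject odd? {xs = Es} (¬c ∘ proj₁)))))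
      (yes c) → case 2 ∣? size E of λ where
        (yes even) → trans (cong₂ _+_ (cong₂ _*_ (𝟙-yes (isCirculationIn? D E) c) (proj₁ (sign-parity (size E)) even)) (go Es))
          (trans (shift₁ (pos (length (filter even? Es))) (pos (length (filter odd? Es))))
            (cong₂ (λ xs ys → pos (length xs) - pos (length ys))
              (sym (List.filter-accept even? {xs = Es} (c , even))) (sym (List.filter-reject odd? {xs = Es} λ (_ , odd) → odd even))))
        (no odd) → trans (cong₂ _+_ (cong₂ _*_ (𝟙-yes (isCirculationIn? D E) c) (proj₂ (sign-parity (size E)) odd)) (go Es))
          (trans (shift₂ (pos (length (filter even? Es))) (pos (length (filter odd? Es))))
            (cong₂ (λ xs ys → pos (length xs) - pos (length ys))
              (sym (List.filter-reject even? {xs = Es} (odd ∘ proj₂))) (sym (List.filter-accept odd? {xs = Es} (c , odd)))))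

  ∑-filter : {P : Pred A 0ℓ} (P? : Decidable₁ P) (xs : List A) (f : A → ℤ) →
             (∀ x → ¬ P x → f x ≡ 0ℤ) → ∑ (filter P? xs) f ≡ ∑ xs f
  ∑-filter P? []       f z = refl
  ∑-filter P? (x ∷ xs) f z = case P? x of λ where
    (yes Px) → trans (cong (λ ys → ∑ ys f) (List.filter-accept P? {xs = xs} Px)) (cong (f x +_) (∑-filter P? xs f z))
    (no ¬Px) → trans (cong (λ ys → ∑ ys f) (List.filter-reject P? {xs = xs} ¬Px))
      (trans (∑-filter P? xs f z) (trans (sym (ℤ.+-identityˡ _)) (cong (_+ ∑ xs f) (sym (z x ¬Px)))))

  module _ {ds : List (Edge n)} (ds! : Unique ds) where

    private
      D : Digraph n
      D = digraph ds

      contained? : (E : Digraph n) → Dec (∀ u v → Arc E u v → Arc D u v)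
      contained? E = Fin.all? λ u → Fin.all? λ v → arc? E u v →-dec arc? D u v

      restrict : Digraph n → List (Edge n)
      restrict E = filter (λ (u , v) → arc? E u v) ds

      restrict-digraph : ∀ {S} → S ∈ subsets ds → restrict (digraph S) ≡ S
      restrict-digraph {S} S∈ = filter-subset _ ds! S∈ (λ _ → arc⁻ S) (arc⁺ S)

      digraph-restrict : ∀ {E} → (∀ u v → Arc E u v → Arc D u v) → E ≡ digraph (restrict E)
      digraph-restrict {E} E⊆D = digraph-extensional
        (λ u v a → arc⁺ (restrict E) (∈-filter⁺ (λ (u , v) → arc? E u v) (arc⁻ ds (E⊆D u v a)) a))
        (λ u v a → proj₂ (∈-filter⁻ (λ (u , v) → arc? E u v) {xs = ds} (arc⁻ (restrict E) a)))

      subdigraphs : filter contained? (digraphs n) ↭ map digraph (subsets ds)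
      subdigraphs = unique∧set⇒↭ (Unique.filter⁺ contained? (digraphs-unique n))
        -- Distinct sublists give distinct digraphs because `restrict` recovers the sublist.
        (Unique.map⁻ {f = restrict} (subst Unique
          (sym (trans (sym (List.map-∘ (subsets ds))) (map-id-∈ (subsets ds) restrict-digraph)))
          (subsets-unique ds!)))
        (λ {E} p → let E⊆D = proj₂ (∈-filter⁻ contained? {xs = digraphs n} p) in
          subst (_∈ map digraph (subsets ds)) (sym (digraph-restrict E⊆D))
            (∈-map⁺ digraph (filter-∈-subsets _ ds)))
        (λ {E} p → case ∈-map⁻ digraph p of λ where
          (S , S∈ , refl) → ∈-filter⁺ contained? (digraphs-complete (digraph S))
            λ u v a → arc⁺ ds (subset-⊆ S∈ (arc⁻ S a)))
        where
        map-id-∈ : ∀ {f : A → A} xs → (∀ {x} → x ∈ xs → f x ≡ x) → map f xs ≡ xs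
        map-id-∈ []       e = refl
        map-id-∈ (x ∷ xs) e = cong₂ _∷_ (e (here refl)) (map-id-∈ xs (e ∘ there))

    -- The Alon-Tarsi identity. At the exponent `heads ds` the term of a sublist `S` in
    -- `coeff-subsets` survives exactly when heads and tails of `S` balance, that is when `S` is a
    -- circulation, and its sign is the parity of its size. Sublists of `ds` correspond to
    -- subdigraphs of `D`.
    coeff-heads : coeff ds (heads ds) ≡ signedCount D
    coeff-heads = sym (begin
      signedCount D
        ≡⟨ sym (∑-filter contained? (digraphs n) _ λ E ⊈ → trans
             (cong (_* sign (size E)) (𝟙-no (isCirculationIn? D E) (⊈ ∘ IsCirculationIn.contained))) refl) ⟩
      ∑ (filter contained? (digraphs n)) (λ E → 𝟙 (isCirculationIn? D E) * sign (size E))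
        ≡⟨ ∑-↭ _ subdigraphs ⟩
      ∑ (map digraph (subsets ds)) (λ E → 𝟙 (isCirculationIn? D E) * sign (size E))
        ≡⟨ ∑-map digraph (subsets ds) _ ⟩
      ∑ (subsets ds) (λ S → 𝟙 (isCirculationIn? D (digraph S)) * sign (size (digraph S)))
        ≡⟨ ∑-cong-∈ (subsets ds) (λ {S} S∈ → let S! = subset-unique ds! S∈ in
           trans (ℤ.*-comm (𝟙 (isCirculationIn? D (digraph S))) _)
             (cong₂ _*_ (cong sign (size-digraph S!))
               (𝟙-⇔ (isCirculationIn? D (digraph S)) (isZero? (excess S))
                 (λ (circulation _ b) w → balanced⁺ S S! w (b w))
                 (λ z → circulation (λ u v a → arc⁺ ds (subset-⊆ S∈ (arc⁻ S a))) λ w → balanced⁻ S S! w (z w))))) ⟩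
      ∑ (subsets ds) (λ S → sign (length S) * coeff [] (excess S))
        ≡⟨ sym (coeff-subsets ds (heads ds)) ⟩
      coeff ds (heads ds) ∎)
      where
      excess : List (Edge n) → Exponent n
      excess S w = heads ds w - heads ds w + heads S w - tails S w
      simplify : ∀ a b c → a - a + b - c ≡ b - c
      simplify = solve-∀
      balanced⁺ : ∀ S → Unique S → ∀ w → indegree (digraph S) w ≡ outdegree (digraph S) w →
                  heads ds w - heads ds w + heads S w - tails S w ≡ 0ℤ
      balanced⁺ S S! w e = trans (simplify (heads ds w) (heads S w) (tails S w))
        (ℤ.i≡j⇒i-j≡0
          (trans (sym (indegree-digraph S! w)) (trans (cong pos e) (outdegree-digraph S! w))))
      balanced⁻ : ∀ S → Unique S → ∀ w → heads ds w - heads ds w + heads S w - tails S w ≡ 0ℤ →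
                  indegree (digraph S) w ≡ outdegree (digraph S) w
      balanced⁻ S S! w e = ℤ.+-injective (trans (indegree-digraph S! w) (trans
        (ℤ.i-j≡0⇒i≡j (heads S w) (tails S w) (trans (sym (simplify (heads ds w) (heads S w) (tails S w))) e))
        (sym (outdegree-digraph S! w))))

  -- From a nonzero coefficient to a bound on the Alon-Tarsi number

  AT≤maxIndegree+1 : (𝒢 : Graph n) (D : Digraph n) → IsOrientation 𝒢 D → #evenCirculations D ≢ #oddCirculations D →
             AT 𝒢 ℕ.≤ suc (maxIndegree D)
  AT≤maxIndegree+1 𝒢 D o e = proj₂ (AT-isLeast 𝒢) (suc (maxIndegree D)) (D , realizes o refl e)

  enumeration-orientation : (𝒢 : Graph n) {ds : List (Edge n)} → Enumerates (Graph._~_ 𝒢) ds →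
                            IsOrientation 𝒢 (digraph ds)
  enumeration-orientation 𝒢 {ds} enum = orientation
    (λ u v → sound ∘ arc⁻ ds)
    (λ u v → Sum.map (arc⁺ ds) (arc⁺ ds) ∘ complete)
    (λ u v a a′ → oneWay (Graph.irrefl 𝒢) (arc⁻ ds a) (arc⁻ ds a′))
    where open Enumerates enum

  -- `maximum` starts from the value 0, which `0 < b` takes care of.
  maxIndegree-< : {ds : List (Edge n)} → Unique ds → ∀ {b} → 0 ℕ.< b →
                  (∀ v → heads ds v < pos b) → maxIndegree (digraph ds) ℕ.< b
  maxIndegree-< {n} {ds} ds! {b} 0<b heads< = max<v⁺ {xs = map (indegree (digraph ds)) (allFin n)} 0<b (All.map⁺ (All.universal
    (λ v → ℤ.drop‿+<+ (subst (_< pos b) (sym (indegree-digraph ds! v)) (heads< v))) (allFin n)))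

  even≢odd : {ds : List (Edge n)} → Unique ds → coeff ds (heads ds) ≢ 0ℤ →
             #evenCirculations (digraph ds) ≢ #oddCirculations (digraph ds)
  even≢odd {ds = ds} ds! ≢0 e = ≢0 (trans (coeff-heads ds!)
    (trans (signedCount-even-odd (digraph ds)) (ℤ.i≡j⇒i-j≡0 (cong pos e))))

  AT-orientation : (𝒢 : Graph n) {ds : List (Edge n)} → Enumerates (Graph._~_ 𝒢) ds → coeff ds (heads ds) ≢ 0ℤ →
                   ∀ {b} → 0 ℕ.< b → (∀ v → heads ds v < pos b) → AT 𝒢 ℕ.≤ b
  AT-orientation 𝒢 {ds} enum ≢0 0<b heads<b = ℕ.≤-trans
    (AT≤maxIndegree+1 𝒢 (digraph ds) (enumeration-orientation 𝒢 enum) (even≢odd ds! ≢0))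
    (maxIndegree-< ds! 0<b heads<b)
    where
    ds! : Unique ds
    ds! = Enumerates.unique enum

  -- The chosen orientation has indegrees `t`, and passing to it changes the coefficient at most in
  -- sign. So its numbers of even and odd circulations differ.
  AT-≤ : (𝒢 : Graph n) {es : List (Edge n)} → Enumerates (Graph._~_ 𝒢) es →
         ∀ t → coeff es t ≢ 0ℤ → ∀ {b} → 0 ℕ.< b → (∀ v → t v < pos b) → AT 𝒢 ℕ.≤ b
  AT-≤ 𝒢 {es} enum t ≢0 {b} 0<b t<b =
    let ds , flips , t≡heads = choose-orientation es t ≢0
    in AT-orientation 𝒢 (enumerates-flips (Graph.symm 𝒢) flips enum)
         (λ e → ≢0 (coeff-zero-flips flips (trans (coeff-cong ds t≡heads) e)))
         0<b (λ v → subst (_< pos b) (t≡heads v) (t<b v))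
    where
    coeff-zero-flips : ∀ {ds} → Pointwise Flip es ds → coeff ds t ≡ 0ℤ → coeff es t ≡ 0ℤ
    coeff-zero-flips flips e = case coeff-flips flips of λ where
      (inj₁ same)     → trans (sym (same t)) e
      (inj₂ opposite) → ℤ.neg-injective (trans (sym (opposite t)) e)

  -- Complete graphs

  enumerates : ∀ {R : Rel (Fin n) 0ℓ} {es} → Unique es → (∀ {u v} → (u , v) ∈ es → (v , u) ∉ es) →
               (∀ {u v} → (u , v) ∈ es → R u v) → (∀ {u v} → R u v → (u , v) ∈ es ⊎ (v , u) ∈ es) →
               Enumerates R es
  enumerates es! oneWay sound complete = record
    { distinct = go es! oneWay ; sound = sound ; complete = complete }
    where
    go : ∀ {es : List (Edge _)} → Unique es → (∀ {u v} → (u , v) ∈ es → (v , u) ∉ es) → AllPairs Distinct es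
    go []           oneWay = []
    go (e∉es ∷ es!) oneWay =
      All.tabulate (λ e′∈es → All.lookup e∉es e′∈es , λ { refl → oneWay (here refl) (there e′∈es) })
      ∷ go es! λ p q → oneWay (there p) (there q)

  flips-map : (f : Edge n → Edge n) → (∀ e → Flip e (f e)) → ∀ es → Pointwise Flip es (map f es)
  flips-map f flip []       = []
  flips-map f flip (e ∷ es) = flip e ∷ flips-map f flip es

  -- Once the entries of `es` that `es′` lists in the opposite direction are reversed, the two lists
  -- are permutations of each other. This lets each symmetry argument pick the enumeration that
  -- suits it.
  coeff-enumerations : ∀ {R : Rel (Fin n) 0ℓ} {es es′} → Symmetric R → Irreflexive _≡_ R →
    Enumerates R es → Enumerates R es′ →
    (∀ t → coeff es t ≡ coeff es′ t) ⊎ (∀ t → coeff es t ≡ - coeff es′ t)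
  coeff-enumerations {n} {R} {es} {es′} R-sym R-irrefl enum enum′ =
    Sum.map (λ e t → trans (sym (e t)) (coeff-↭ permuted t))
            (λ e t → trans (sym (ℤ.neg-involutive _)) (cong -_ (trans (sym (e t)) (coeff-↭ permuted t))))
            (coeff-flips flips)
    where
    module E  = Enumerates enum
    module E′ = Enumerates enum′

    align : Edge n → Edge n
    align e with e ∈ᴱ? es′
    ... | yes _ = e
    ... | no  _ = swap e

    align-flip : ∀ e → Flip e (align e)
    align-flip e with e ∈ᴱ? es′
    ... | yes _ = inj₁ refl
    ... | no  _ = inj₂ refl

    align-∈ : ∀ {u v} → R u v → align (u , v) ∈ es′
    align-∈ {u} {v} r with (u , v) ∈ᴱ? es′
    ... | yes p = p
    ... | no ¬p = [ (λ p → contradiction p ¬p) , id ]′ (E′.complete r)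

    align-fixed : ∀ {e} → e ∈ es′ → align e ≡ e
    align-fixed {e} p with e ∈ᴱ? es′
    ... | yes _ = refl
    ... | no ¬p = contradiction p ¬p

    align-swap : ∀ {u v} → (u , v) ∈ es′ → align (v , u) ≡ (u , v)
    align-swap {u} {v} p with (v , u) ∈ᴱ? es′
    ... | yes q = contradiction q (E′.oneWay R-irrefl p)
    ... | no _  = refl

    flips : Pointwise Flip es (map align es)
    flips = flips-map align align-flip es

    permuted : map align es ↭ es′
    permuted = unique∧set⇒↭ (Enumerates.unique (enumerates-flips R-sym flips enum)) E′.unique
      (λ p → case ∈-map⁻ align p of λ where
        (_ , q , refl) → align-∈ (E.sound q))
      (λ p → case E.complete (E′.sound p) of λ where
        (inj₁ q) → subst (_∈ map align es) (align-fixed p) (∈-map⁺ align q)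
        (inj₂ q) → subst (_∈ map align es) (align-swap p) (∈-map⁺ align q))

  transpose-left : ∀ (a b : Fin n) → transpose a b a ≡ b
  transpose-left a b rewrite dec-true (a Fin.≟ a) refl = refl

  transpose-right : ∀ (a b : Fin n) → transpose a b b ≡ a
  transpose-right a b with b Fin.≟ a
  ... | yes b≡a = b≡a
  ... | no  _   rewrite dec-true (b Fin.≟ b) refl = refl

  transpose-other : ∀ {a b w : Fin n} → w ≢ a → w ≢ b → transpose a b w ≡ w
  transpose-other {a = a} {b} {w} w≢a w≢b
    rewrite dec-false (w Fin.≟ a) w≢a | dec-false (w Fin.≟ b) w≢b = refl

  i≡-i⇒i≡0 : ∀ {i} → i ≡ - i → i ≡ 0ℤ
  i≡-i⇒i≡0 {pos zero} _ = refl
  i≡-i⇒i≡0 {pos (suc _)} ()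
  i≡-i⇒i≡0 { -[1+ _ ]} ()

  module _ {es : List (Edge n)} (enum : Enumerates _≢_ es) where

    -- Reorienting the edges so that every edge meeting exactly one of a and b points towards it,
    -- the transposition of a and b permutes the edges other than ab and reverses ab.
    coeff-transpose : ∀ {a b} → a ≢ b → ∀ t → coeff es (t ∘ transpose a b) ≡ - coeff es t
    coeff-transpose {a} {b} a≢b t = case coeff-enumerations (λ ≢ → ≢ ∘ sym) (λ e ≢ → ≢ e) enum enum′ of λ where
        (inj₁ same)     → trans (same _) (trans reversed (cong -_ (sym (same t))))
        (inj₂ opposite) → trans (opposite _) (cong -_ (trans reversed (sym (opposite t))))
      where
      τ = transpose a b

      -- One direction of every edge except ab. The order of the labels decides only between
      -- vertices that the transposition fixes, hence `P` is invariant under it.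
      P : Pred (Edge n) 0ℓ
      P (u , v) = (u ≢ a × u ≢ b) × ((v ≡ a ⊎ v ≡ b) ⊎ toℕ u ℕ.< toℕ v)

      P? : Decidable₁ P
      P? (u , v) = (¬? (u Fin.≟ a) ×-dec ¬? (u Fin.≟ b)) ×-dec
                   (((v Fin.≟ a) ⊎-dec (v Fin.≟ b)) ⊎-dec (toℕ u ℕ.<? toℕ v))

      rest = filter P? (cartesianProduct (allFin n) (allFin n))

      ∈-rest⁻ : ∀ {e} → e ∈ rest → P e
      ∈-rest⁻ p = proj₂ (∈-filter⁻ P? {xs = cartesianProduct (allFin n) (allFin n)} p)

      ∈-rest⁺ : ∀ {e} → P e → e ∈ rest
      ∈-rest⁺ {u , v} Pe = ∈-filter⁺ P? (∈-cartesianProduct⁺ (∈-allFin u) (∈-allFin v)) Pe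

      rest! : Unique rest
      rest! = Unique.filter⁺ P? (Unique.cartesianProduct⁺ (Unique.allFin⁺ n) (Unique.allFin⁺ n))

      P-asym : ∀ {u v} → P (u , v) → ¬ P (v , u)
      P-asym (_ , inj₁ (inj₁ v≡a))       ((v≢a , _) , _)                   = v≢a v≡a
      P-asym (_ , inj₁ (inj₂ v≡b))       ((_ , v≢b) , _)                   = v≢b v≡b
      P-asym ((u≢a , _) , inj₂ _)        (_ , inj₁ (inj₁ u≡a))             = u≢a u≡a
      P-asym ((_ , u≢b) , inj₂ _)        (_ , inj₁ (inj₂ u≡b))             = u≢b u≡b
      P-asym (_ , inj₂ u<v)              (_ , inj₂ v<u)                    = ℕ.<-asym u<v v<u

      P-sound : ∀ {u v} → P (u , v) → u ≢ v
      P-sound p refl = P-asym p p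

      oneWay : ∀ {u v} → (u , v) ∈ (a , b) ∷ rest → (v , u) ∉ (a , b) ∷ rest
      oneWay (here refl) (here e)    = a≢b (cong proj₂ e)
      oneWay (here refl) (there q)   = proj₂ (proj₁ (∈-rest⁻ q)) refl
      oneWay (there p)   (here refl) = proj₂ (proj₁ (∈-rest⁻ p)) refl
      oneWay (there p)   (there q)   = P-asym (∈-rest⁻ p) (∈-rest⁻ q)

      complete : ∀ {u v} → u ≢ v → (u , v) ∈ (a , b) ∷ rest ⊎ (v , u) ∈ (a , b) ∷ rest
      complete {u} {v} u≢v = case ((u Fin.≟ a) ,′ (u Fin.≟ b) ,′ (v Fin.≟ a) ,′ (v Fin.≟ b)) of λ where
        (yes refl , _ , yes refl , _)           → contradiction refl u≢v
        (yes refl , _ , no _ , yes refl)        → inj₁ (here refl)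
        (yes refl , _ , no v≢a , no v≢b)        → inj₂ (there (∈-rest⁺ ((v≢a , v≢b) , inj₁ (inj₁ refl))))
        (no _ , yes refl , yes refl , _)        → inj₂ (here refl)
        (no _ , yes refl , no _ , yes refl)     → contradiction refl u≢v
        (no _ , yes refl , no v≢a , no v≢b)     → inj₂ (there (∈-rest⁺ ((v≢a , v≢b) , inj₁ (inj₂ refl))))
        (no u≢a , no u≢b , yes refl , _)        → inj₁ (there (∈-rest⁺ ((u≢a , u≢b) , inj₁ (inj₁ refl))))
        (no u≢a , no u≢b , no _ , yes refl)     → inj₁ (there (∈-rest⁺ ((u≢a , u≢b) , inj₁ (inj₂ refl))))
        (no u≢a , no u≢b , no v≢a , no v≢b)     → case Fin.<-cmp u v of λ where
          (tri< u<v _ _) → inj₁ (there (∈-rest⁺ ((u≢a , u≢b) , inj₂ u<v)))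
          (tri≈ _ u≡v _) → contradiction u≡v u≢v
          (tri> _ _ v<u) → inj₂ (there (∈-rest⁺ ((v≢a , v≢b) , inj₂ v<u)))

      enum′ : Enumerates _≢_ ((a , b) ∷ rest)
      enum′ = enumerates
        (All.tabulate (λ p → λ { refl → proj₁ (proj₁ (∈-rest⁻ p)) refl }) ∷ rest!)
        oneWay (λ { (here refl) → a≢b ; (there p) → P-sound (∈-rest⁻ p) }) complete

      τ-involutive : ∀ v → τ (τ v) ≡ v
      τ-involutive v = case ((v Fin.≟ a) ,′ (v Fin.≟ b)) of λ where
        (yes refl , _)      → trans (cong τ (transpose-left a b)) (transpose-right a b)
        (no _ , yes refl)   → trans (cong τ (transpose-right a b)) (transpose-left a b)
        (no v≢a , no v≢b)   → trans (cong τ (transpose-other v≢a v≢b)) (transpose-other v≢a v≢b)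

      P-τ : ∀ {u v} → P (u , v) → P (τ u , τ v)
      P-τ {u} {v} ((u≢a , u≢b) , q) rewrite transpose-other u≢a u≢b =
        (u≢a , u≢b) ,′ (case ((v Fin.≟ a) ,′ (v Fin.≟ b)) of λ where
          (yes refl , _)    → inj₁ (inj₂ (transpose-left a b))
          (no _ , yes refl) → inj₁ (inj₁ (transpose-right a b))
          (no v≢a , no v≢b) → subst (λ w → (w ≡ a ⊎ w ≡ b) ⊎ toℕ u ℕ.< toℕ w) (sym (transpose-other v≢a v≢b)) q)

      τ-injective : ∀ {u v} → τ u ≡ τ v → u ≡ v
      τ-injective {u} {v} e = trans (sym (τ-involutive u)) (trans (cong τ e) (τ-involutive v))

      rest-τ : map (mapEdge τ) rest ↭ rest
      rest-τ = unique∧set⇒↭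
        (Unique.map⁺ (λ e → cong₂ _,_ (τ-injective (cong proj₁ e)) (τ-injective (cong proj₂ e))) rest!) rest!
        (λ p → case ∈-map⁻ (mapEdge τ) p of λ where
          (_ , q , refl) → ∈-rest⁺ (P-τ (∈-rest⁻ q)))
        (λ {e} p → subst (_∈ map (mapEdge τ) rest) (cong₂ _,_ (τ-involutive (proj₁ e)) (τ-involutive (proj₂ e)))
          (∈-map⁺ (mapEdge τ) (∈-rest⁺ (P-τ (∈-rest⁻ p)))))

      reversed : coeff ((a , b) ∷ rest) (t ∘ τ) ≡ - coeff ((a , b) ∷ rest) t
      reversed = begin
        coeff ((a , b) ∷ rest) (t ∘ τ)
          ≡⟨ sym (coeff-map τ τ τ-involutive τ-involutive ((a , b) ∷ rest) t) ⟩
        coeff (map (mapEdge τ) rest) (t ⊖ τ b) - coeff (map (mapEdge τ) rest) (t ⊖ τ a)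
          ≡⟨ cong₂ (λ x y → coeff (map (mapEdge τ) rest) (t ⊖ x) - coeff (map (mapEdge τ) rest) (t ⊖ y))
               (transpose-right a b) (transpose-left a b) ⟩
        coeff (map (mapEdge τ) rest) (t ⊖ a) - coeff (map (mapEdge τ) rest) (t ⊖ b)
          ≡⟨ cong₂ _-_ (coeff-↭ rest-τ (t ⊖ a)) (coeff-↭ rest-τ (t ⊖ b)) ⟩
        coeff rest (t ⊖ a) - coeff rest (t ⊖ b)
          ≡⟨ lemma (coeff rest (t ⊖ a)) (coeff rest (t ⊖ b)) ⟩
        - (coeff rest (t ⊖ b) - coeff rest (t ⊖ a)) ∎
        where
        lemma : ∀ x y → x - y ≡ - (y - x)
        lemma = solve-∀

    -- The exponent is invariant under the transposition of `a` and `b`, so by antisymmetry the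
    -- coefficient equals its own negative.
    coeff-repeated : ∀ {a b} → a ≢ b → ∀ t → t a ≡ t b → coeff es t ≡ 0ℤ
    coeff-repeated {a} {b} a≢b t ta≡tb = i≡-i⇒i≡0 (trans (coeff-cong es invariant) (coeff-transpose a≢b t))
      where
      invariant : ∀ v → t v ≡ t (transpose a b v)
      invariant v = case ((v Fin.≟ a) ,′ (v Fin.≟ b)) of λ where
        (yes refl , _)      → trans ta≡tb (cong t (sym (transpose-left a b)))
        (no _ , yes refl)   → trans (sym ta≡tb) (cong t (sym (transpose-right a b)))
        (no v≢a , no v≢b)   → cong t (sym (transpose-other v≢a v≢b))

    coeff-swapped : ∀ {a b} → a ≢ b → ∀ s t → s a ≡ t b → s b ≡ t a → (∀ v → v ≢ a → v ≢ b → s v ≡ t v) →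
                    coeff es s ≡ - coeff es t
    coeff-swapped {a} {b} a≢b s t sa sb s≡t = trans (coeff-cong es swapped) (coeff-transpose a≢b t)
      where
      swapped : ∀ v → s v ≡ t (transpose a b v)
      swapped v = case ((v Fin.≟ a) ,′ (v Fin.≟ b)) of λ where
        (yes refl , _)      → trans sa (cong t (sym (transpose-left a b)))
        (no _ , yes refl)   → trans sb (cong t (sym (transpose-right a b)))
        (no v≢a , no v≢b)   → trans (s≡t v v≢a v≢b) (cong t (sym (transpose-other v≢a v≢b)))

  completeEdges : ∀ n → List (Edge n)
  completeEdges zero    = []
  completeEdges (suc n) = map (λ i → zero , suc i) (allFin n) ++ map (mapEdge suc) (completeEdges n)

  ∈-completeEdges⁻ : ∀ {u v : Fin n} → (u , v) ∈ completeEdges n → toℕ u ℕ.< toℕ v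
  ∈-completeEdges⁻ {suc n} p with ∈-++⁻ (map (λ i → zero , suc i) (allFin n)) p
  ... | inj₁ q with ∈-map⁻ (λ i → zero , suc i) q
  ...   | _ , _ , refl = ℕ.s≤s ℕ.z≤n
  ∈-completeEdges⁻ {suc n} p | inj₂ q with ∈-map⁻ (mapEdge suc) q
  ...   | _ , r , refl = ℕ.s≤s (∈-completeEdges⁻ r)

  ∈-completeEdges⁺ : ∀ {u v : Fin n} → toℕ u ℕ.< toℕ v → (u , v) ∈ completeEdges n
  ∈-completeEdges⁺ {suc n} {zero}  {suc v} _           = ∈-++⁺ˡ (∈-map⁺ (λ i → zero , suc i) (∈-allFin v))
  ∈-completeEdges⁺ {suc n} {suc u} {suc v} (ℕ.s≤s u<v) =
    ∈-++⁺ʳ (map (λ i → zero , suc i) (allFin n)) (∈-map⁺ (mapEdge suc) (∈-completeEdges⁺ u<v))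

  completeEdges-unique : ∀ n → Unique (completeEdges n)
  completeEdges-unique zero    = []
  completeEdges-unique (suc n) = Unique.++⁺
    (Unique.map⁺ (λ { refl → refl }) (Unique.allFin⁺ n))
    (Unique.map⁺ (λ { refl → refl }) (completeEdges-unique n))
    λ (p , q) → case (∈-map⁻ (λ i → zero , suc i) p ,′ ∈-map⁻ (mapEdge suc) q) of λ where
      ((_ , _ , refl) , (_ , _ , ()))

  completeEdges-enumerates : Enumerates {n} _≢_ (completeEdges n)
  completeEdges-enumerates {n} = enumerates (completeEdges-unique n)
    (λ p q → ℕ.<-asym (∈-completeEdges⁻ p) (∈-completeEdges⁻ q))
    (λ { p refl → ℕ.<-irrefl refl (∈-completeEdges⁻ p) })
    (λ {u} {v} u≢v → case Fin.<-cmp u v of λ where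
      (tri< u<v _ _) → inj₁ (∈-completeEdges⁺ u<v)
      (tri≈ _ u≡v _) → contradiction u≡v u≢v
      (tri> _ _ v<u) → inj₂ (∈-completeEdges⁺ v<u))

  -- The exponent 0 at the centre forces every edge of the star to contribute its other end.
  coeff-star : ∀ {n} (is : List (Fin n)) es (t : Exponent (suc n)) → t zero ≡ 0ℤ →
    coeff (map (λ i → zero , suc i) is ++ es) t ≡ coeff es (λ v → t v - ∑ is λ i → δ (suc i) v)
  coeff-star []       es t t₀≡0 = coeff-cong es λ v → sym (ℤ.+-identityʳ (t v))
  coeff-star (i ∷ is) es t t₀≡0 = begin
    coeff (star ++ es) (t ⊖ suc i) - coeff (star ++ es) (t ⊖ zero)
      ≡⟨ cong₂ _-_ (coeff-star is es (t ⊖ suc i) (trans (ℤ.+-identityʳ (t zero)) t₀≡0))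
           (coeff-negative (star ++ es) (t ⊖ zero) zero (subst (λ x → x - 1ℤ < 0ℤ) (sym t₀≡0) -<+)) ⟩
    coeff es (λ v → (t ⊖ suc i) v - ∑ is (λ i → δ (suc i) v)) - 0ℤ
      ≡⟨ ℤ.+-identityʳ _ ⟩
    coeff es (λ v → (t ⊖ suc i) v - ∑ is (λ i → δ (suc i) v))
      ≡⟨ coeff-cong es (λ v → sub-sub (t v) (δ (suc i) v) _) ⟩
    coeff es (λ v → t v - ∑ (i ∷ is) (λ i → δ (suc i) v)) ∎
    where
    star = map (λ i → zero , suc i) is
    sub-sub : ∀ a b c → a - b - c ≡ a - (b + c)
    sub-sub = solve-∀

  rank : Exponent n
  rank v = pos (toℕ v)

  -- The diagonal term of the Vandermonde determinant. Vertex `zero` has exponent 0, so its edges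
  -- lower every other rank by one, and the same problem for one vertex less remains.
  coeff-rank : ∀ n → coeff (completeEdges n) rank ≡ 1ℤ
  coeff-rank zero    = refl
  coeff-rank (suc n) = begin
    coeff (completeEdges (suc n)) rank                  ≡⟨ coeff-star (allFin n) _ rank refl ⟩
    coeff (map (mapEdge suc) (completeEdges n)) t       ≡⟨ coeff-⊎ {1} [] (completeEdges n) t ⟩
    coeff {1} [] (λ _ → t zero) * coeff (completeEdges n) (λ v → t (suc v))
      ≡⟨ cong₂ _*_ (coeff-[]-one {1} (λ _ → t zero) (λ _ → cong (λ x → 0ℤ - x) (∑-zero (allFin n) λ i → refl)))
           (coeff-cong (completeEdges n) λ v → cong (λ d → pos (suc (toℕ v)) - d)
             (trans (∑-cong (allFin n) λ i → δ-sym i v) (∑-δ v))) ⟩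
    1ℤ * coeff (completeEdges n) rank                   ≡⟨ trans (ℤ.*-identityˡ _) (coeff-rank n) ⟩
    1ℤ                                                  ∎
    where
    t : Exponent (suc n)
    t v = rank v - ∑ (allFin n) λ i → δ (suc i) v

  module _ {es : List (Edge n)} (enum : Enumerates _≢_ es) where

    -- Composing with a transposition gives `x` the rank `y` and only negates the coefficient. Apart
    -- from `x`, only the vertex that had rank `y` is affected, so ranks can be prescribed one after
    -- another.
    assign : ∀ (σ : Permutation′ n) → coeff es (rank ∘ (σ ⟨$⟩ʳ_)) ≢ 0ℤ → ∀ x y →
      ∃[ ρ ] coeff es (rank ∘ (ρ ⟨$⟩ʳ_)) ≢ 0ℤ × ρ ⟨$⟩ʳ x ≡ y ×
             (∀ w → w ≢ x → σ ⟨$⟩ʳ w ≢ y → ρ ⟨$⟩ʳ w ≡ σ ⟨$⟩ʳ w)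
    assign σ ≢0 x y with x Fin.≟ σ ⟨$⟩ˡ y
    ... | yes refl = σ , ≢0 , inverseʳ σ , λ _ _ _ → refl
    ... | no x≢z =
      Permutation.transpose x z ∘ₚ σ ,
      (λ e → ≢0 (ℤ.neg-injective (trans (sym (coeff-transpose enum x≢z (rank ∘ (σ ⟨$⟩ʳ_)))) e))) ,
      trans (cong (σ ⟨$⟩ʳ_) (transpose-left x z)) (inverseʳ σ) ,
      λ w w≢x σw≢y → cong (σ ⟨$⟩ʳ_) (transpose-other w≢x λ { refl → σw≢y (inverseʳ σ) })
      where z = σ ⟨$⟩ˡ y

    module _ (s : Exponent n) (a b c : Fin n) (a≢b : a ≢ b) (a≢c : a ≢ c) (b≢c : b ≢ c)
             (sa≡sb : s a ≡ s b) (sb≡sc : s b ≡ s c) where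

      private
        ⊖⊕-other : ∀ {u w x} → x ≢ u → x ≢ w → (s ⊖ u ⊕ w) x ≡ s x
        ⊖⊕-other {u} {w} {x} x≢u x≢w = trans
          (cong₂ (λ d d′ → s x - d + d′) (δ-≢ (x≢u ∘ sym)) (δ-≢ (x≢w ∘ sym)))
          (lemma (s x))
          where
          lemma : ∀ i → i - 0ℤ + 0ℤ ≡ i
          lemma = solve-∀

        ⊖⊕-from : ∀ {u w} → u ≢ w → (s ⊖ u ⊕ w) u ≡ s u - 1ℤ
        ⊖⊕-from {u} {w} u≢w = trans (cong₂ (λ d d′ → s u - d + d′) (δ-≡ u) (δ-≢ (u≢w ∘ sym))) (ℤ.+-identityʳ _)

        ⊖⊕-to : ∀ {u w} → u ≢ w → (s ⊖ u ⊕ w) w ≡ s w + 1ℤ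
        ⊖⊕-to {u} {w} u≢w = trans (cong₂ (λ d d′ → s w - d + d′) (δ-≢ u≢w) (δ-≡ w)) (lemma (s w))
          where
          lemma : ∀ i → i - 0ℤ + 1ℤ ≡ i + 1ℤ
          lemma = solve-∀

      -- A move from a vertex other than `b` and `c` leaves the exponents of these two equal, so its
      -- coefficient is zero. The moves from `b` and from `c` differ by the transposition of `b` and
      -- `c` and have opposite coefficients.
      transfer-triple : ∀ f → transfer es s f a ≡ coeff es (s ⊖ c ⊕ a) * (f c - f b)
      transfer-triple f = begin
        ∑ (allFin n) (λ u → f u * coeff es (s ⊖ u ⊕ a))
          ≡⟨ ∑-cong (allFin n) (λ u → cong (f u *_) (value u)) ⟩
        ∑ (allFin n) (λ u → f u * (X * (δ c u - δ b u)))
          ≡⟨ ∑-cong (allFin n) (λ u → expand (f u) X (δ c u) (δ b u)) ⟩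
        ∑ (allFin n) (λ u → X * (f u * δ c u + - (f u * δ b u)))
          ≡⟨ ∑-*ˡ (allFin n) X _ ⟩
        X * ∑ (allFin n) (λ u → f u * δ c u + - (f u * δ b u))
          ≡⟨ cong (X *_) (trans (∑-+ (allFin n) _ _) (cong₂ _+_ (∑-*δ f c) (trans (∑-neg (allFin n) _) (cong -_ (∑-*δ f b))))) ⟩
        X * (f c - f b) ∎
        where
        X = coeff es (s ⊖ c ⊕ a)
        expand : ∀ x y p q → x * (y * (p - q)) ≡ y * (x * p + - (x * q))
        expand = solve-∀
        times1 : ∀ x → x ≡ x * (1ℤ - 0ℤ)
        times1 = solve-∀
        times-1 : ∀ x → - x ≡ x * (0ℤ - 1ℤ)
        times-1 = solve-∀
        times0 : ∀ x → 0ℤ ≡ x * (0ℤ - 0ℤ)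
        times0 = solve-∀
        value : ∀ u → coeff es (s ⊖ u ⊕ a) ≡ X * (δ c u - δ b u)
        value u = case ((u Fin.≟ c) ,′ (u Fin.≟ b)) of λ where
          (yes refl , _) → trans (times1 X) (sym (cong₂ (λ p q → X * (p - q)) (δ-≡ c) (δ-≢ b≢c)))
          (no _ , yes refl) → trans
            (coeff-swapped enum b≢c (s ⊖ b ⊕ a) (s ⊖ c ⊕ a)
              (trans (⊖⊕-from (a≢b ∘ sym)) (trans (cong (_- 1ℤ) sb≡sc) (sym (⊖⊕-from (a≢c ∘ sym)))))
              (trans (⊖⊕-other (b≢c ∘ sym) (a≢c ∘ sym)) (trans (sym sb≡sc) (sym (⊖⊕-other b≢c (a≢b ∘ sym)))))
              (λ v v≢b v≢c → cong (_+ δ a v) (cong (λ d → s v - d) (trans (δ-≢ (v≢b ∘ sym)) (sym (δ-≢ (v≢c ∘ sym)))))))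
            (trans (times-1 X) (sym (cong₂ (λ p q → X * (p - q)) (δ-≢ (b≢c ∘ sym)) (δ-≡ b))))
          (no u≢c , no u≢b) → trans
            (coeff-repeated enum b≢c (s ⊖ u ⊕ a)
              (trans (⊖⊕-other (u≢b ∘ sym) (a≢b ∘ sym)) (trans sb≡sc (sym (⊖⊕-other (u≢c ∘ sym) (a≢c ∘ sym))))))
            (trans (times0 X) (sym (cong₂ (λ p q → X * (p - q)) (δ-≢ (u≢c ∘ sym)) (δ-≢ (u≢b ∘ sym)))))

      -- Here and in `coeff-shift-reverse`, a move of one unit gives the three vertices the old
      -- common exponent, one more and one less in some order. A transposition of two of them
      -- relates any two of the moves compared.
      coeff-shift-swap : coeff es (s ⊖ c ⊕ b) ≡ - coeff es (s ⊖ c ⊕ a)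
      coeff-shift-swap = coeff-swapped enum a≢b (s ⊖ c ⊕ b) (s ⊖ c ⊕ a)
        (trans (⊖⊕-other a≢c a≢b) (trans sa≡sb (sym (⊖⊕-other b≢c (a≢b ∘ sym)))))
        (trans (⊖⊕-to (b≢c ∘ sym)) (trans (cong (_+ 1ℤ) (sym sa≡sb)) (sym (⊖⊕-to (a≢c ∘ sym)))))
        (λ v v≢a v≢b → cong (s v - δ c v +_) (trans (δ-≢ (v≢b ∘ sym)) (sym (δ-≢ (v≢a ∘ sym)))))

      coeff-shift-reverse : coeff es (s ⊖ a ⊕ c) ≡ - coeff es (s ⊖ c ⊕ a)
      coeff-shift-reverse = coeff-swapped enum a≢c (s ⊖ a ⊕ c) (s ⊖ c ⊕ a)
        (trans (⊖⊕-from a≢c) (trans (cong (_- 1ℤ) (trans sa≡sb sb≡sc)) (sym (⊖⊕-from (a≢c ∘ sym)))))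
        (trans (⊖⊕-to a≢c) (trans (cong (_+ 1ℤ) (sym (trans sa≡sb sb≡sc))) (sym (⊖⊕-to (a≢c ∘ sym)))))
        (λ v v≢a v≢c → trans (⊖⊕-other v≢a v≢c) (sym (⊖⊕-other v≢c v≢a)))

  third : ∀ (b c : Fin (3 ℕ.+ n)) → ∃[ a ] a ≢ b × a ≢ c
  third zero             zero             = suc zero       , (λ ()) , λ ()
  third zero             (suc zero)       = suc (suc zero) , (λ ()) , λ ()
  third zero             (suc (suc _))    = suc zero       , (λ ()) , λ ()
  third (suc zero)       zero             = suc (suc zero) , (λ ()) , λ ()
  third (suc (suc _))    zero             = suc zero       , (λ ()) , λ ()
  third (suc _)          (suc _)          = zero           , (λ ()) , λ ()

  zero-sum : ∀ {x y z} → x + y + z ≡ 0ℤ → x ≢ 0ℤ → x ≢ y ⊎ x ≢ z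
  zero-sum {x} {y} {z} e x≢0 with x ℤ.≟ y | x ℤ.≟ z
  ... | no x≢y   | _        = inj₁ x≢y
  ... | yes _    | no x≢z   = inj₂ x≢z
  ... | yes refl | yes refl = contradiction (ℤ.*-cancelˡ-≡ (pos 3) x 0ℤ (trans (triple x) e)) x≢0
    where
    triple : ∀ x → pos 3 * x ≡ x + x + x
    triple = solve-∀

  module _ {n : ℕ} {es : List (Edge (3 ℕ.+ n))} (enum : Enumerates _≢_ es)
           (rank≢0 : coeff es rank ≢ 0ℤ) where

    private
      order = 3 ℕ.+ n

      -- The ranks are a permutation of 0, ..., n + 2 with the three largest values at `a`, `b`,
      -- `c`. Only `a` attains n + 2, the degree of the graph, which the exponents sought have to
      -- stay below.
      record Ranking (a b c : Fin order) : Set where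
        field
          r    : Exponent order
          r≢0  : coeff es r ≢ 0ℤ
          r-a  : r a ≡ pos (2 ℕ.+ n)
          r-b  : r b ≡ pos (1 ℕ.+ n)
          r-c  : r c ≡ pos n
          r-<  : ∀ v → v ≢ a → r v < pos (2 ℕ.+ n)

      ranking : ∀ {a b c} → a ≢ b → a ≢ c → b ≢ c → Ranking a b c
      ranking {a} {b} {c} a≢b a≢c b≢c with assign enum Permutation.id rank≢0 a (Fin.fromℕ (2 ℕ.+ n))
      ... | σ₁ , ≢0₁ , σ₁a , _ with assign enum σ₁ ≢0₁ b (Fin.inject₁ (Fin.fromℕ (1 ℕ.+ n)))
      ... | σ₂ , ≢0₂ , σ₂b , fix₂ with assign enum σ₂ ≢0₂ c (Fin.inject₁ (Fin.inject₁ (Fin.fromℕ n)))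
      ... | σ₃ , ≢0₃ , σ₃c , fix₃ = record
        { r   = rank ∘ (σ₃ ⟨$⟩ʳ_)
        ; r≢0 = ≢0₃
        ; r-a = cong pos (trans (cong toℕ σ₃a) (Fin.toℕ-fromℕ (2 ℕ.+ n)))
        ; r-b = cong pos (trans (cong toℕ σ₃b) toℕ-second)
        ; r-c = cong pos (trans (cong toℕ σ₃c) toℕ-third)
        ; r-< = λ v v≢a → +<+ (ℕ.≤∧≢⇒< (ℕ.s≤s⁻¹ (Fin.toℕ<n (σ₃ ⟨$⟩ʳ v)))
            λ e → v≢a (σ₃-injective (Fin.toℕ-injective
              (trans e (sym (trans (cong toℕ σ₃a) (Fin.toℕ-fromℕ (2 ℕ.+ n))))))))
        }
        where
        first second third′ : Fin order
        first  = Fin.fromℕ (2 ℕ.+ n)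
        second = Fin.inject₁ (Fin.fromℕ (1 ℕ.+ n))
        third′ = Fin.inject₁ (Fin.inject₁ (Fin.fromℕ n))
        toℕ-second : toℕ second ≡ 1 ℕ.+ n
        toℕ-second = trans (Fin.toℕ-inject₁ _) (Fin.toℕ-fromℕ (1 ℕ.+ n))
        toℕ-third : toℕ third′ ≡ n
        toℕ-third = trans (Fin.toℕ-inject₁ _) (trans (Fin.toℕ-inject₁ _) (Fin.toℕ-fromℕ n))
        first≢second : first ≢ second
        first≢second e = ℕ.1+n≢n (trans (sym (Fin.toℕ-fromℕ (2 ℕ.+ n))) (trans (cong toℕ e) toℕ-second))
        first≢third : first ≢ third′
        first≢third e = ℕ.m≢1+n+m n {1} (sym (trans (sym (Fin.toℕ-fromℕ (2 ℕ.+ n))) (trans (cong toℕ e) toℕ-third)))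
        second≢third : second ≢ third′
        second≢third e = ℕ.1+n≢n (trans (sym toℕ-second) (trans (cong toℕ e) toℕ-third))
        σ₂a : σ₂ ⟨$⟩ʳ a ≡ first
        σ₂a = trans (fix₂ a a≢b (subst (_≢ second) (sym σ₁a) first≢second)) σ₁a
        σ₃a : σ₃ ⟨$⟩ʳ a ≡ first
        σ₃a = trans (fix₃ a a≢c (subst (_≢ third′) (sym σ₂a) first≢third)) σ₂a
        σ₃b : σ₃ ⟨$⟩ʳ b ≡ second
        σ₃b = trans (fix₃ b b≢c (subst (_≢ third′) (sym σ₂b) second≢third)) σ₂b
        σ₃-injective : ∀ {v w} → σ₃ ⟨$⟩ʳ v ≡ σ₃ ⟨$⟩ʳ w → v ≡ w
        σ₃-injective e = trans (sym (inverseˡ σ₃)) (trans (cong (σ₃ ⟨$⟩ˡ_) e) (inverseˡ σ₃))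

      ⊖-≤ : ∀ (t : Exponent order) u v → (t ⊖ u) v ≤ t v
      ⊖-≤ t u v = ℤ.≤-trans (ℤ.+-monoʳ-≤ (t v) (ℤ.neg-mono-≤ (0≤𝟙 (u Fin.≟ v)))) (ℤ.≤-reflexive (ℤ.+-identityʳ (t v)))

      ⊖-< : ∀ {a b c} (R : Ranking a b c) → ∀ v → (Ranking.r R ⊖ a) v < pos (2 ℕ.+ n)
      ⊖-< {a} R v = case v Fin.≟ a of λ where
          (yes refl) → subst (_< pos (2 ℕ.+ n)) (sym (cong₂ _-_ r-a (δ-≡ v))) (+<+ ℕ.≤-refl)
          (no v≢a)   → ℤ.≤-<-trans (⊖-≤ r a v) (r-< v v≢a)
        where open Ranking R

    complete-reducible : Reducible es (2 ℕ.+ n)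
    complete-reducible = record { initial = initial ; step = step }
      where
      -- Taking one unit from the largest rank makes it equal to the second largest. Giving the unit
      -- back to `a` restores `r`, giving it to `b` yields `r` with both exchanged, so the two
      -- coefficients are nonzero and opposite.
      initial : ∃[ s ] (∀ u → s u < pos (2 ℕ.+ n)) × NonConstant (λ v → coeff es (s ⊕ v))
      initial = r ⊖ a , ⊖-< R , a , b , λ e → r≢0 (i≡-i⇒i≡0 (begin
        coeff es r                ≡⟨ coeff-cong es (λ v → restore (r v) (δ a v)) ⟩
        coeff es (r ⊖ a ⊕ a)      ≡⟨ e ⟩
        coeff es (r ⊖ a ⊕ b)      ≡⟨ coeff-swapped enum a≢b (r ⊖ a ⊕ b) r at-a at-b other ⟩
        - coeff es r              ∎))
        where
        a b c : Fin order
        a = zero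
        b = suc zero
        c = suc (suc zero)
        a≢b : a ≢ b
        a≢b ()
        R = ranking {a} {b} {c} a≢b (λ ()) (λ ())
        open Ranking R
        restore : ∀ x y → x ≡ x - y + y
        restore = solve-∀
        at-a : r a - 1ℤ + 0ℤ ≡ r b
        at-a = trans (cong (λ x → x - 1ℤ + 0ℤ) r-a) (trans (ℤ.+-identityʳ _) (sym r-b))
        at-b : r b - 0ℤ + 1ℤ ≡ r a
        at-b = trans (cong (λ x → x - 0ℤ + 1ℤ) r-b)
          (trans (cong pos (trans (ℕ.+-comm _ 1) (cong suc (ℕ.+-identityʳ (1 ℕ.+ n))))) (sym r-a))
        other : ∀ v → v ≢ a → v ≢ b → r v - δ a v + δ b v ≡ r v
        other v v≢a v≢b = trans (cong₂ (λ d d′ → r v - d + d′) (δ-≢ (v≢a ∘ sym)) (δ-≢ (v≢b ∘ sym)))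
          (trans (ℤ.+-identityʳ _) (ℤ.+-identityʳ _))

      step : ∀ f → NonConstant f →
             ∃[ s ] (∀ u → s u < pos (2 ℕ.+ n)) × coeff es s ≡ 0ℤ × NonConstant (transfer es s f)
      step f (b , c , fb≢fc) with third b c
      ... | a , a≢b , a≢c = s , s< , coeff-repeated enum a≢b s sa≡sb , nonConstant
        where
        b≢c : b ≢ c
        b≢c refl = fb≢fc refl
        R = ranking a≢b a≢c b≢c
        open Ranking R
        -- Moving one unit from the largest rank to the third largest makes the three exponents
        -- equal to n + 1 and removes the only one that is too large. Moving it back restores `r`,
        -- which is why `X` is nonzero.
        s : Exponent order
        s = r ⊖ a ⊕ c
        sa≡ : s a ≡ pos (1 ℕ.+ n)
        sa≡ = cong₂ _+_ (cong₂ _-_ r-a (δ-≡ a)) (δ-≢ (a≢c ∘ sym)) ⟨ trans ⟩ cong pos (ℕ.+-identityʳ (1 ℕ.+ n))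
        sb≡ : s b ≡ pos (1 ℕ.+ n)
        sb≡ = cong₂ _+_ (cong₂ _-_ r-b (δ-≢ a≢b)) (δ-≢ (b≢c ∘ sym)) ⟨ trans ⟩ trans (ℤ.+-identityʳ _) (ℤ.+-identityʳ _)
        sc≡ : s c ≡ pos (1 ℕ.+ n)
        sc≡ = cong₂ _+_ (cong₂ _-_ r-c (δ-≢ a≢c)) (δ-≡ c) ⟨ trans ⟩
              trans (cong (_+ 1ℤ) (ℤ.+-identityʳ (pos n))) (cong pos (ℕ.+-comm n 1))
        sa≡sb : s a ≡ s b
        sa≡sb = trans sa≡ (sym sb≡)
        sb≡sc : s b ≡ s c
        sb≡sc = trans sb≡ (sym sc≡)
        s< : ∀ v → s v < pos (2 ℕ.+ n)
        s< v = case v Fin.≟ c of λ where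
          (yes refl) → subst (_< pos (2 ℕ.+ n)) (sym sc≡) (+<+ ℕ.≤-refl)
          (no v≢c)   → subst (_< pos (2 ℕ.+ n))
            (trans (sym (ℤ.+-identityʳ ((r ⊖ a) v))) (cong ((r ⊖ a) v +_) (sym (δ-≢ (v≢c ∘ sym))))) (⊖-< R v)
        X = coeff es (s ⊖ c ⊕ a)
        X≢0 : X ≢ 0ℤ
        X≢0 e = r≢0 (trans (coeff-cong es λ v → restore (r v) (δ a v) (δ c v)) e)
          where
          restore : ∀ x y z → x ≡ x - y + z - z + y
          restore = solve-∀
        at-a : transfer es s f a ≡ X * (f c - f b)
        at-a = transfer-triple enum s a b c a≢b a≢c b≢c sa≡sb sb≡sc f
        at-b : transfer es s f b ≡ - X * (f c - f a)
        at-b = trans (transfer-triple enum s b a c (a≢b ∘ sym) b≢c a≢c (sym sa≡sb) (trans sa≡sb sb≡sc) f)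
          (cong (_* (f c - f a)) (coeff-shift-swap enum s a b c a≢b a≢c b≢c sa≡sb sb≡sc))
        at-c : transfer es s f c ≡ - X * (f a - f b)
        at-c = trans (transfer-triple enum s c b a (b≢c ∘ sym) (a≢c ∘ sym) (a≢b ∘ sym) (sym sb≡sc) (sym sa≡sb) f)
          (cong (_* (f a - f b)) (coeff-shift-reverse enum s a b c a≢b a≢c b≢c sa≡sb sb≡sc))
        -- The new coefficients at the three vertices sum to zero while the one at `a` is nonzero,
        -- so they are not all equal.
        sum-zero : transfer es s f a + transfer es s f b + transfer es s f c ≡ 0ℤ
        sum-zero = trans (cong₂ _+_ (cong₂ _+_ at-a at-b) at-c) (cancel X (f a) (f b) (f c))
          where
          cancel : ∀ x p q r → x * (r - q) + - x * (r - p) + - x * (p - q) ≡ 0ℤ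
          cancel = solve-∀
        at-a≢0 : transfer es s f a ≢ 0ℤ
        at-a≢0 e = [ X≢0 , (λ fc-fb≡0 → fb≢fc (sym (ℤ.i-j≡0⇒i≡j (f c) (f b) fc-fb≡0))) ]′
          (ℤ.i*j≡0⇒i≡0∨j≡0 X (trans (sym at-a) e))
        nonConstant : NonConstant (transfer es s f)
        nonConstant = case zero-sum sum-zero at-a≢0 of λ where
          (inj₁ a≢b′) → a , b , a≢b′
          (inj₂ a≢c′) → a , c , a≢c′

  -- Odd cycles

  ∑-reindex : (f : Fin n → Fin n) → (∀ {i j} → f i ≡ f j → i ≡ j) → (∀ j → ∃[ i ] f i ≡ j) →
              (g : Fin n → ℤ) → ∑ (allFin n) (g ∘ f) ≡ ∑ (allFin n) g
  ∑-reindex {n} f injective surjective g = trans (sym (∑-map f (allFin n) g))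
    (∑-↭ g (unique∧set⇒↭ (Unique.map⁺ injective (Unique.allFin⁺ n)) (Unique.allFin⁺ n)
      (λ _ → ∈-allFin _)
      (λ {j} _ → let i , fi≡j = surjective j in subst (_∈ map f (allFin n)) fi≡j (∈-map⁺ f (∈-allFin i)))))

  prev : Fin (suc n) → Fin (suc n)
  prev zero    = Fin.fromℕ _
  prev (suc i) = Fin.inject₁ i

  prev-injective : ∀ {i j : Fin (suc n)} → prev i ≡ prev j → i ≡ j
  prev-injective {i = zero}  {zero}  e = refl
  prev-injective {i = zero}  {suc j} e = contradiction e Fin.fromℕ≢inject₁
  prev-injective {i = suc i} {zero}  e = contradiction (sym e) Fin.fromℕ≢inject₁
  prev-injective {i = suc i} {suc j} e = cong suc (Fin.inject₁-injective e)

  prev-surjective : ∀ (j : Fin (suc n)) → ∃[ i ] prev i ≡ j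
  prev-surjective = >-weakInduction _ (zero , refl) λ i _ → suc i , refl

  -- Iterating `prev` from `zero` goes to the last vertex and then down through all the others.
  prev-induction : (P : Pred (Fin (suc n)) 0ℓ) → P zero → (∀ i → P i → P (prev i)) → ∀ i → P i
  prev-induction P P₀ step = >-weakInduction P (step zero P₀) λ i → step (suc i)

  pathEdges : ∀ n → List (Edge (suc n))
  pathEdges zero    = []
  pathEdges (suc n) = (suc zero , zero) ∷ map (mapEdge suc) (pathEdges n)

  -- The closing edge comes first, so that unfolding `coeff` once leaves paths. It is directed like
  -- the others, from a vertex to its predecessor, so that rotations preserve the list without any
  -- sign.
  cycleEdges : ∀ n → List (Edge (suc n))
  cycleEdges n = (zero , Fin.fromℕ n) ∷ pathEdges n

  pathEdges-tabulate : ∀ n → pathEdges n ≡ tabulate (λ i → suc i , Fin.inject₁ i)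
  pathEdges-tabulate zero    = refl
  pathEdges-tabulate (suc n) = cong ((suc zero , zero) ∷_)
    (trans (cong (map (mapEdge suc)) (pathEdges-tabulate n)) (List.map-tabulate _ (mapEdge suc)))

  cycleEdges-map : ∀ n → cycleEdges n ≡ map (λ i → i , prev i) (allFin (suc n))
  cycleEdges-map n = trans (cong ((zero , Fin.fromℕ n) ∷_) (pathEdges-tabulate n))
    (sym (List.map-tabulate id (λ i → i , prev i)))

  ∈-cycleEdges⁻ : ∀ {u v : Fin (suc n)} → (u , v) ∈ cycleEdges n → v ≡ prev u
  ∈-cycleEdges⁻ {n} {u} {v} p with ∈-map⁻ (λ i → i , prev i) (subst ((u , v) ∈_) (cycleEdges-map n) p)
  ... | _ , _ , refl = refl

  ∈-cycleEdges⁺ : ∀ (u : Fin (suc n)) → (u , prev u) ∈ cycleEdges n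
  ∈-cycleEdges⁺ {n} u = subst ((u , prev u) ∈_) (sym (cycleEdges-map n)) (∈-map⁺ (λ i → i , prev i) (∈-allFin u))

  cycleEdges-unique : Unique (cycleEdges n)
  cycleEdges-unique {n} = subst Unique (sym (cycleEdges-map n)) (Unique.map⁺ (cong proj₁) (Unique.allFin⁺ (suc n)))

  prev-prev : ∀ (i : Fin (3 ℕ.+ n)) → i ≢ prev (prev i)
  prev-prev zero          ()
  prev-prev (suc zero)    ()
  prev-prev (suc (suc i)) e = ℕ.m≢1+n+m (toℕ i) {1} (sym (trans (cong toℕ e)
    (trans (Fin.toℕ-inject₁ (Fin.inject₁ i)) (Fin.toℕ-inject₁ i))))

  cyclicSuc-prev : ∀ (i : Fin (suc n)) → CyclicSuc (prev i) i
  cyclicSuc-prev {n} zero = inj₂ (cong suc (Fin.toℕ-fromℕ n) , refl)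
  cyclicSuc-prev (suc i)  = inj₁ (cong suc (sym (Fin.toℕ-inject₁ i)))

  cyclicSuc⇒prev : ∀ {i j : Fin (suc n)} → CyclicSuc i j → i ≡ prev j
  cyclicSuc⇒prev {n} {i} {zero}  (inj₂ (e , _)) = Fin.toℕ-injective (trans (ℕ.suc-injective e) (sym (Fin.toℕ-fromℕ n)))
  cyclicSuc⇒prev {n} {i} {suc j} (inj₁ e) = Fin.toℕ-injective (trans (sym (ℕ.suc-injective e)) (sym (Fin.toℕ-inject₁ j)))

  cycleEdges-enumerates : Enumerates {3 ℕ.+ n} (λ i j → CyclicSuc i j ⊎ CyclicSuc j i) (cycleEdges (2 ℕ.+ n))
  cycleEdges-enumerates = enumerates cycleEdges-unique
    (λ {u} p q → prev-prev u (trans (∈-cycleEdges⁻ q) (cong prev (∈-cycleEdges⁻ p))))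
    (λ {u} p → inj₂ (subst (λ v → CyclicSuc v u) (sym (∈-cycleEdges⁻ p)) (cyclicSuc-prev u)))
    (λ {u} {v} → λ where
      (inj₁ s) → inj₂ (subst (λ w → (v , w) ∈ cycleEdges _) (sym (cyclicSuc⇒prev s)) (∈-cycleEdges⁺ v))
      (inj₂ s) → inj₁ (subst (λ w → (u , w) ∈ cycleEdges _) (sym (cyclicSuc⇒prev s)) (∈-cycleEdges⁺ u)))

  coeff-rotate : ∀ (t : Exponent (suc n)) → coeff (cycleEdges n) (t ∘ prev) ≡ coeff (cycleEdges n) t
  coeff-rotate {n} t = trans
    (sym (coeff-map prev (proj₁ ∘ prev-surjective) (proj₂ ∘ prev-surjective)
      (λ v → prev-injective (proj₂ (prev-surjective (prev v)))) (cycleEdges n) t))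
    (coeff-↭ rotated t)
    where
    rotated : map (mapEdge prev) (cycleEdges n) ↭ cycleEdges n
    rotated = unique∧set⇒↭
      (Unique.map⁺ (λ e → cong₂ _,_ (prev-injective (cong proj₁ e)) (prev-injective (cong proj₂ e))) cycleEdges-unique)
      cycleEdges-unique
      (λ p → case ∈-map⁻ (mapEdge prev) p of λ where
        ((u , v) , q , refl) → subst (λ w → (prev u , prev w) ∈ cycleEdges n) (sym (∈-cycleEdges⁻ q)) (∈-cycleEdges⁺ (prev u)))
      (λ {e} p → case ∈-cycleEdges⁻ p ,′ prev-surjective (proj₁ e) of λ where
        (refl , u , refl) → ∈-map⁺ (mapEdge prev) (∈-cycleEdges⁺ u))

  ones : Exponent n
  ones _ = 1ℤ

  coeff-shift : ∀ {n} (es : List (Edge n)) t → coeff (map (mapEdge suc) es) t ≡ coeff {1} [] (λ _ → t zero) * coeff es (t ∘ suc)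
  coeff-shift {n} es t = trans (coeff-⊎ {1} [] es t)
    (cong (_* coeff es (t ∘ suc)) (coeff-cong {1} [] {λ u → t (u ↑ˡ n)} {λ _ → t zero} λ { zero → refl }))

  coeff-shift-zero : ∀ (es : List (Edge n)) t → t zero ≡ 0ℤ → coeff (map (mapEdge suc) es) t ≡ coeff es (t ∘ suc)
  coeff-shift-zero es t t₀≡0 = trans (coeff-shift es t)
    (trans (cong (_* coeff es (t ∘ suc)) (coeff-[]-one {1} (λ _ → t zero) λ _ → t₀≡0)) (ℤ.*-identityˡ _))

  coeff-shift-nonzero : ∀ (es : List (Edge n)) t → t zero ≢ 0ℤ → coeff (map (mapEdge suc) es) t ≡ 0ℤ
  coeff-shift-nonzero es t t₀≢0 = trans (coeff-shift es t)
    (cong (_* coeff es (t ∘ suc)) (coeff-[]-zero {1} (λ _ → t zero) λ z → t₀≢0 (z zero)))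

  -- When one end of the path has exponent 0, all choices are forced from that end on. Here every
  -- edge contributes its head; in `coeff-path-first` every edge contributes its tail, which gives a
  -- sign for each edge.
  coeff-path-last : ∀ n → coeff (pathEdges n) (ones ⊖ Fin.fromℕ n) ≡ 1ℤ
  coeff-path-last zero    = refl
  coeff-path-last (suc n) = trans
    (cong₂ _-_ (trans (coeff-shift-zero (pathEdges n) (ones ⊖ suc (Fin.fromℕ n) ⊖ zero) refl)
             (trans (coeff-cong (pathEdges n) λ v → ℤ.+-identityʳ _) (coeff-path-last n)))
           (coeff-shift-nonzero (pathEdges n) (ones ⊖ suc (Fin.fromℕ n) ⊖ suc zero) λ ()))
    refl

  coeff-path-first : ∀ n → coeff (pathEdges n) (ones ⊖ zero) ≡ sign n
  coeff-path-first zero    = refl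
  coeff-path-first (suc n) = trans
    (cong₂ _-_ (coeff-shift-nonzero (pathEdges n) (ones ⊖ zero ⊖ zero) λ ())
           (trans (coeff-shift-zero (pathEdges n) (ones ⊖ zero ⊖ suc zero) refl)
             (trans (coeff-cong (pathEdges n) λ v → refl) (coeff-path-first n))))
    (ℤ.+-identityˡ _)

  -- An end of the path lies on one edge only and cannot have exponent 2.
  coeff-path-high-first : ∀ n t → t zero ≡ pos 2 → coeff (pathEdges (suc n)) t ≡ 0ℤ
  coeff-path-high-first n t t₀≡2 = cong₂ _-_
    (coeff-shift-nonzero (pathEdges n) (t ⊖ zero) λ e → case trans (cong (_- 1ℤ) (sym t₀≡2)) e of λ ())
    (coeff-shift-nonzero (pathEdges n) (t ⊖ suc zero) λ e → case trans (sym t₀≡2) (trans (sym (ℤ.+-identityʳ _)) e) of λ ())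

  coeff-path-high-last : ∀ n t → t (Fin.fromℕ (suc n)) ≡ pos 2 → coeff (pathEdges (suc n)) t ≡ 0ℤ
  coeff-path-high-last zero t t₁≡2 = cong₂ _-_
    (vanish (t ⊖ zero) λ e → case trans (sym t₁≡2) (trans (sym (ℤ.+-identityʳ _)) e) of λ ())
    (vanish (t ⊖ suc zero) λ e → case trans (cong (_- 1ℤ) (sym t₁≡2)) e of λ ())
    where
    vanish : ∀ (s : Exponent 2) → s (suc zero) ≢ 0ℤ → coeff (map (mapEdge suc) (pathEdges 0)) s ≡ 0ℤ
    vanish s s₁≢0 = coeff-[]-zero s λ z → s₁≢0 (z (suc zero))
  coeff-path-high-last (suc n) t tₙ≡2 = cong₂ _-_
    (vanish (t ⊖ zero) (trans (ℤ.+-identityʳ _) tₙ≡2)) (vanish (t ⊖ suc zero) (trans (ℤ.+-identityʳ _) tₙ≡2))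
    where
    vanish : ∀ s → s (suc (Fin.fromℕ (suc n))) ≡ pos 2 → coeff (map (mapEdge suc) (pathEdges (suc n))) s ≡ 0ℤ
    vanish s sₙ≡2 = trans (coeff-shift (pathEdges (suc n)) s)
      (trans (cong (coeff {1} [] (λ _ → s zero) *_) (coeff-path-high-last n (s ∘ suc) sₙ≡2))
             (ℤ.*-zeroʳ (coeff {1} [] (λ _ → s zero))))

  ⊖⊕-inverse : ∀ (t : Exponent n) v w → (t ⊖ v ⊕ v) w ≡ t w
  ⊖⊕-inverse t v w = lemma (t w) (δ v w)
    where
    lemma : ∀ a b → a - b + b ≡ a
    lemma = solve-∀

  module _ (n : ℕ) (even : 2 ∣ n) where

    private
      es : List (Edge (3 ℕ.+ n))
      es = cycleEdges (2 ℕ.+ n)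

      path : List (Edge (3 ℕ.+ n))
      path = pathEdges (2 ℕ.+ n)

      last : Fin (3 ℕ.+ n)
      last = Fin.fromℕ (2 ℕ.+ n)

      all : List (Fin (3 ℕ.+ n))
      all = allFin (3 ℕ.+ n)

      path-first : coeff path (ones ⊖ zero) ≡ 1ℤ
      path-first = trans (coeff-path-first (2 ℕ.+ n)) (trans (ℤ.neg-involutive (sign n)) (proj₁ (sign-parity n) even))

      -- The closing edge contributes `last` or `zero`. In the first case the exponent 2 at the end
      -- `zero` of the path is fatal unless `u` is `zero`; `at-last` is the mirror image, with the
      -- roles of the two ends and hence the sign exchanged.
      at-zero : ∀ u → coeff es (ones ⊖ u ⊕ zero) ≡ δ zero u - coeff path (ones ⊖ u)
      at-zero u = cong₂ _-_ (tail u) (coeff-cong path λ v → cancel (1ℤ - δ u v) (δ zero v))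
        where
        cancel : ∀ a b → a + b - b ≡ a
        cancel = solve-∀
        tail : ∀ u → coeff path (ones ⊖ u ⊕ zero ⊖ last) ≡ δ zero u
        tail zero    = trans (coeff-cong path λ v → cong (_- δ last v) (⊖⊕-inverse ones zero v)) (coeff-path-last (2 ℕ.+ n))
        tail (suc u) = coeff-path-high-first (1 ℕ.+ n) (ones ⊖ suc u ⊕ zero ⊖ last) refl

      at-last : ∀ u → coeff es (ones ⊖ u ⊕ last) ≡ coeff path (ones ⊖ u) - δ last u
      at-last u = cong₂ _-_ (coeff-cong path λ v → cancel (1ℤ - δ u v) (δ last v)) tail
        where
        cancel : ∀ a b → a + b - b ≡ a
        cancel = solve-∀
        tail : coeff path (ones ⊖ u ⊕ last ⊖ zero) ≡ δ last u
        tail = case u Fin.≟ last of λ where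
          (yes refl) → trans (coeff-cong path λ v → cong (_- δ zero v) (⊖⊕-inverse ones last v))
                             (trans path-first (sym (δ-≡ last)))
          (no u≢)    → trans (coeff-path-high-last (1 ℕ.+ n) (ones ⊖ u ⊕ last ⊖ zero)
              (cong₂ (λ a b → 1ℤ - a + b - 0ℤ) (δ-≢ u≢) (δ-≡ last)))
            (sym (δ-≢ (u≢ ∘ sym)))

      -- The two cyclic orientations contribute 1 and (-1)^(n + 3), which cancel as n is even.
      ones-coeff : coeff es ones ≡ 0ℤ
      ones-coeff = begin
        coeff es ones                                  ≡⟨ coeff-cong es (λ v → sym (⊖⊕-inverse ones zero v)) ⟩
        coeff es (ones ⊖ zero ⊕ zero)                  ≡⟨ at-zero zero ⟩
        1ℤ - coeff path (ones ⊖ zero)                  ≡⟨ cong (λ x → 1ℤ - x) path-first ⟩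
        0ℤ                                             ∎

      T : (Fin (3 ℕ.+ n) → ℤ) → Fin (3 ℕ.+ n) → ℤ
      T = transfer es ones

      T-rotate : ∀ c v → T (c ∘ prev) v ≡ T c (prev v)
      T-rotate c v = trans
        (∑-cong all λ u → cong (c (prev u) *_) (trans
          (coeff-cong es λ w → sym (cong₂ (λ a b → 1ℤ - a + b)
            (δ-injective prev prev-injective u w) (δ-injective prev prev-injective v w)))
          (coeff-rotate (ones ⊖ prev u ⊕ prev v))))
        (∑-reindex prev prev-injective prev-surjective λ u → c u * coeff es (ones ⊖ u ⊕ prev v))

      -- Across the closing edge, the path coefficients in `at-zero` and `at-last` cancel. Rotation
      -- carries this to all other edges; it changes `c`, so `c` stays quantified in the induction.
      T-relation : ∀ v c → T c v + T c (prev v) ≡ c v - c (prev v)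
      T-relation = prev-induction _ base λ v ih c → begin
        T c (prev v) + T c (prev (prev v))             ≡⟨ sym (cong₂ _+_ (T-rotate c v) (T-rotate c (prev v))) ⟩
        T (c ∘ prev) v + T (c ∘ prev) (prev v)         ≡⟨ ih (c ∘ prev) ⟩
        c (prev v) - c (prev (prev v))                 ∎
        where
        combine-terms : ∀ x p q r → x * (p - q) + x * (q - r) ≡ x * p + - (x * r)
        combine-terms = solve-∀
        base : ∀ c → T c zero + T c last ≡ c zero - c last
        base c = begin
          T c zero + T c last
            ≡⟨ sym (∑-+ all (λ u → c u * coeff es (ones ⊖ u ⊕ zero)) (λ u → c u * coeff es (ones ⊖ u ⊕ last))) ⟩
          ∑ all (λ u → c u * coeff es (ones ⊖ u ⊕ zero) + c u * coeff es (ones ⊖ u ⊕ last))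
            ≡⟨ ∑-cong all (λ u → trans
                 (cong₂ _+_ (cong (c u *_) (at-zero u)) (cong (c u *_) (at-last u)))
                 (combine-terms (c u) (δ zero u) (coeff path (ones ⊖ u)) (δ last u))) ⟩
          ∑ all (λ u → c u * δ zero u + - (c u * δ last u))
            ≡⟨ ∑-+ all (λ u → c u * δ zero u) (λ u → - (c u * δ last u)) ⟩
          ∑ all (λ u → c u * δ zero u) + ∑ all (λ u → - (c u * δ last u))
            ≡⟨ cong₂ _+_ (∑-*δ c zero) (trans (∑-neg all (λ u → c u * δ last u)) (cong -_ (∑-*δ c last))) ⟩
          c zero - c last ∎

      -- If T c is constant then so are the differences c v - c (prev v); they sum to zero around
      -- the cycle, hence vanish.
      constant⇒constant : ∀ c → (∀ v → T c v ≡ T c zero) → ∀ v → c v ≡ c zero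
      constant⇒constant c const = prev-induction _ refl λ v cv≡c₀ → trans (sym (c≡c∘prev v)) cv≡c₀
        where
        κ = T c zero + T c zero
        difference : ∀ v → κ ≡ c v - c (prev v)
        difference v = trans (sym (cong₂ _+_ (const v) (const (prev v)))) (T-relation v c)
        total : pos (3 ℕ.+ n) * κ ≡ 0ℤ
        total = begin
          pos (3 ℕ.+ n) * κ                                                    ≡⟨ ℤ.*-comm (pos (3 ℕ.+ n)) κ ⟩
          κ * pos (3 ℕ.+ n)
            ≡⟨ cong (λ ℓ → κ * pos ℓ) (sym (List.length-tabulate {n = 3 ℕ.+ n} id)) ⟩
          κ * pos (length all)                                  ≡⟨ cong (κ *_) (sym (∑-one all)) ⟩
          κ * ∑ all (λ _ → 1ℤ)                                  ≡⟨ sym (∑-*ˡ all κ (λ _ → 1ℤ)) ⟩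
          ∑ all (λ _ → κ * 1ℤ)
            ≡⟨ ∑-cong all (λ v → trans (ℤ.*-identityʳ κ) (difference v)) ⟩
          ∑ all (λ v → c v - c (prev v))                        ≡⟨ ∑-+ all c (λ v → - c (prev v)) ⟩
          ∑ all c + ∑ all (λ v → - c (prev v))
            ≡⟨ cong (∑ all c +_) (trans (∑-neg all (c ∘ prev)) (cong -_ (∑-reindex prev prev-injective prev-surjective c))) ⟩
          ∑ all c - ∑ all c                      ≡⟨ ℤ.+-inverseʳ (∑ all c) ⟩
          0ℤ                                                                   ∎
        κ≡0 : κ ≡ 0ℤ
        κ≡0 = ℤ.*-cancelˡ-≡ (pos (3 ℕ.+ n)) κ 0ℤ (trans total (sym (ℤ.*-zeroʳ (pos (3 ℕ.+ n)))))
        c≡c∘prev : ∀ v → c v ≡ c (prev v)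
        c≡c∘prev v = ℤ.i-j≡0⇒i≡j (c v) (c (prev v)) (trans (sym (difference v)) κ≡0)

    cycle-reducible : Reducible es 2
    cycle-reducible = record { initial = initial ; step = step }
      where
      initial : ∃[ s ] (∀ u → s u < pos 2) × NonConstant (λ v → coeff es (s ⊕ v))
      initial = ones ⊖ zero ,
        (λ u → ℤ.≤-<-trans (ℤ.≤-trans (ℤ.+-monoʳ-≤ 1ℤ (ℤ.neg-mono-≤ (0≤𝟙 (zero Fin.≟ u)))) ℤ.≤-refl) (+<+ ℕ.≤-refl)) ,
        zero , last , λ e → case trans (sym value₀) (trans e valueₗ) of λ ()
        where
        value₀ : coeff es (ones ⊖ zero ⊕ zero) ≡ 0ℤ
        value₀ = trans (at-zero zero) (cong (λ x → 1ℤ - x) path-first)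
        valueₗ : coeff es (ones ⊖ zero ⊕ last) ≡ 1ℤ
        valueₗ = trans (at-last zero) (trans (ℤ.+-identityʳ _) path-first)
      step : ∀ c → NonConstant c →
             ∃[ s ] (∀ u → s u < pos 2) × coeff es s ≡ 0ℤ × NonConstant (transfer es s c)
      step c (u , v , cu≢cv) = ones , (λ _ → +<+ ℕ.≤-refl) , ones-coeff ,
        -- Only the impossibility of a constant result is known; decidable equality on finitely many
        -- vertices turns it into a witness.
        (case Fin.¬∀⟶∃¬ (3 ℕ.+ n) _ (λ v → T c v ℤ.≟ T c zero)
           (λ const → cu≢cv (trans (constant⇒constant c const u) (sym (constant⇒constant c const v)))) of λ where
          (w , w≢) → w , zero , w≢)

  -- Enumerations of G and its maximum degree

  enumerates-⇔ : ∀ {R S : Rel (Fin n) 0ℓ} {es} → (∀ {u v} → R u v → S u v) → (∀ {u v} → S u v → R u v) →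
                 Enumerates R es → Enumerates S es
  enumerates-⇔ f g enum = record { distinct = distinct ; sound = f ∘ sound ; complete = complete ∘ g }
    where open Enumerates enum

  enumerates-map : ∀ {R : Rel (Fin N) 0ℓ} {es} (f : Fin n → Fin N) (g : Fin N → Fin n) →
                   (∀ v → f (g v) ≡ v) → (∀ v → g (f v) ≡ v) →
                   Enumerates (λ u v → R (f u) (f v)) es → Enumerates R (map (mapEdge f) es)
  enumerates-map {R = R} {es} f g fg gf enum = record
    { distinct = AllPairs.map⁺ (AllPairs.map
        (λ (≢ , ≢ˢ) → (≢ ∘ mapEdge-injective) , (≢ˢ ∘ mapEdge-injective)) distinct)
    ; sound    = λ p → case ∈-map⁻ (mapEdge f) p of λ where
        (_ , q , refl) → sound q
    ; complete = λ {u} {v} r → subst₂ (λ u v → (u , v) ∈ map (mapEdge f) es ⊎ (v , u) ∈ map (mapEdge f) es) (fg u) (fg v)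
        (Sum.map (∈-map⁺ (mapEdge f)) (∈-map⁺ (mapEdge f)) (complete (subst₂ R (sym (fg u)) (sym (fg v)) r)))
    }
    where
    open Enumerates enum
    f-injective : ∀ {u v} → f u ≡ f v → u ≡ v
    f-injective {u} {v} e = trans (sym (gf u)) (trans (cong g e) (gf v))
    mapEdge-injective : ∀ {e e′} → mapEdge f e ≡ mapEdge f e′ → e ≡ e′
    mapEdge-injective e = cong₂ _,_ (f-injective (cong proj₁ e)) (f-injective (cong proj₂ e))

  -- Thanks to this a lower bound on Δ(G) suffices, and the degree of a single vertex provides one.
  reducible-≤ : ∀ {es : List (Edge n)} {d d′} → d ℕ.≤ d′ → Reducible es d → Reducible es d′
  reducible-≤ d≤d′ red = record
    { initial = let s , s< , nc = initial in s , (λ u → ℤ.<-≤-trans (s< u) (+≤+ d≤d′)) , nc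
    ; step    = λ c c-nc → let s , s< , z , nc = step c c-nc in s , (λ u → ℤ.<-≤-trans (s< u) (+≤+ d≤d′)) , z , nc
    }
    where open Reducible red

  reducible-permute : ∀ {es : List (Edge n)} {d} (π : Permutation′ n) → Reducible es d →
                      Reducible (map (mapEdge (π ⟨$⟩ʳ_)) es) d
  reducible-permute {n} {es} {d} π red = record { initial = initial′ ; step = step′ }
    where
    open Reducible red
    f g : Fin n → Fin n
    f = π ⟨$⟩ʳ_
    g = π ⟨$⟩ˡ_

    es′ : List (Edge n)
    es′ = map (mapEdge f) es

    f-injective : ∀ {u v} → f u ≡ f v → u ≡ v
    f-injective e = trans (sym (inverseˡ π)) (trans (cong g e) (inverseˡ π))

    coeff-es′ : ∀ t → coeff es′ t ≡ coeff es (t ∘ f)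
    coeff-es′ = coeff-map f g (λ _ → inverseʳ π) (λ _ → inverseˡ π) es

    δ-f : ∀ v u → δ (f v) (f u) ≡ δ v u
    δ-f = δ-injective f f-injective

    nonConstant-f : {c c′ : Fin n → ℤ} → (∀ v → c′ (f v) ≡ c v) → NonConstant c → NonConstant c′
    nonConstant-f c′f≡c (u , v , u≢v) = f u , f v , λ e → u≢v (trans (sym (c′f≡c u)) (trans e (c′f≡c v)))

    initial′ : ∃[ s ] (∀ u → s u < pos d) × NonConstant (λ v → coeff es′ (s ⊕ v))
    initial′ with initial
    ... | s , s< , nc = s ∘ g , s< ∘ g , nonConstant-f
      (λ v → trans (coeff-es′ ((s ∘ g) ⊕ f v)) (coeff-cong es λ w → cong₂ _+_ (cong s (inverseˡ π)) (δ-f v w))) nc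

    step′ : ∀ c → NonConstant c →
            ∃[ s ] (∀ u → s u < pos d) × coeff es′ s ≡ 0ℤ × NonConstant (transfer es′ s c)
    step′ c (u , v , cu≢cv) with step (c ∘ f) (g u , g v , λ e → cu≢cv
      (trans (cong c (sym (inverseʳ π))) (trans e (cong c (inverseʳ π)))))
    ... | s , s< , z , nc = s ∘ g , s< ∘ g ,
      trans (coeff-es′ (s ∘ g)) (trans (coeff-cong es λ w → cong s (inverseˡ π)) z) ,
      nonConstant-f (λ v → trans
        (sym (∑-reindex f f-injective (λ j → g j , inverseʳ π) λ u → c u * coeff es′ ((s ∘ g) ⊖ u ⊕ f v)))
        (∑-cong (allFin n) λ u → cong (c (f u) *_) (trans (coeff-es′ ((s ∘ g) ⊖ f u ⊕ f v))
          (coeff-cong es λ w → cong₂ _+_ (cong₂ _-_ (cong s (inverseˡ π)) (δ-f u w)) (δ-f v w))))) nc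

  ∑-mono : ∀ (xs : List A) {f g : A → ℤ} → (∀ x → f x ≤ g x) → ∑ xs f ≤ ∑ xs g
  ∑-mono []       f≤g = ℤ.≤-refl
  ∑-mono (x ∷ xs) f≤g = ℤ.+-mono-≤ (f≤g x) (∑-mono xs f≤g)

  degree≤Δ : (G : Graph n) → ∀ u → degree G u ℕ.≤ Δ G
  degree≤Δ {n} G u = All.lookup (xs≤max 0 (map (degree G) (allFin n))) (∈-map⁺ (degree G) (∈-allFin u))

  complete-degree : ∀ (G : Graph (suc n)) → IsComplete G → degree G zero ≡ n
  complete-degree {n} G G-complete = ℤ.+-injective (begin
    pos (degree G zero)                                       ≡⟨ count-∑ (zero ~?_) ⟩
    ∑ (allFin (suc n)) (λ v → 𝟙 (zero ~? v))                  ≡⟨ ∑-allFin-suc (λ v → 𝟙 (zero ~? v)) ⟩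
    𝟙 (zero ~? zero) + ∑ (allFin n) (λ v → 𝟙 (zero ~? suc v)) ≡⟨ cong₂ _+_ (𝟙-no (zero ~? zero) (irrefl refl))
                                                                   (∑-cong (allFin n) λ v → 𝟙-yes (zero ~? suc v) (G-complete zero (suc v) λ ())) ⟩
    0ℤ + ∑ (allFin n) (λ _ → 1ℤ)                              ≡⟨ ℤ.+-identityˡ _ ⟩
    ∑ (allFin n) (λ _ → 1ℤ)                                   ≡⟨ ∑-one (allFin n) ⟩
    pos (length (allFin n))                                   ≡⟨ cong pos (List.length-tabulate {n = n} id) ⟩
    pos n                                                     ∎)
    where open Graph G

  two-neighbours : ∀ (G : Graph n) {u a b} → Graph._~_ G u a → Graph._~_ G u b → a ≢ b → 2 ℕ.≤ degree G u
  two-neighbours {n} G {u} {a} {b} ua ub a≢b = ℤ.drop‿+≤+ (ℤ.≤-trans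
    (ℤ.≤-reflexive (sym (trans (∑-+ (allFin n) (δ a) (δ b)) (cong₂ _+_ (∑-δ a) (∑-δ b)))))
    (ℤ.≤-trans (∑-mono (allFin n) bound) (ℤ.≤-reflexive (sym (count-∑ (u ~?_))))))
    where
    open Graph G
    bound : ∀ v → δ a v + δ b v ≤ 𝟙 (u ~? v)
    bound v = case (v Fin.≟ a) ,′ (v Fin.≟ b) of λ where
      (yes refl , _) → ℤ.≤-reflexive (trans (cong₂ _+_ (δ-≡ a) (δ-≢ (a≢b ∘ sym))) (sym (𝟙-yes (u ~? a) ua)))
      (no _ , yes refl) → ℤ.≤-reflexive (trans (cong₂ _+_ (δ-≢ a≢b) (δ-≡ b)) (sym (𝟙-yes (u ~? b) ub)))
      (no v≢a , no v≢b) → ℤ.≤-trans (ℤ.≤-reflexive (cong₂ _+_ (δ-≢ (v≢a ∘ sym)) (δ-≢ (v≢b ∘ sym)))) (0≤𝟙 (u ~? v))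

  ReducibleEnumeration : Graph n → Set
  ReducibleEnumeration {n} G = ∃[ es ] Enumerates (Graph._~_ G) es × Reducible es (Δ G)

  complete-enumeration : (G : Graph (3 ℕ.+ n)) → IsComplete G → ReducibleEnumeration G
  complete-enumeration {n} G G-complete =
    completeEdges (3 ℕ.+ n) ,
    enumerates-⇔ (λ {u} {v} → G-complete u v) (λ u~v u≡v → Graph.irrefl G u≡v u~v) completeEdges-enumerates ,
    reducible-≤ (ℕ.≤-trans (ℕ.≤-reflexive (sym (complete-degree G G-complete))) (degree≤Δ G zero))
      (complete-reducible completeEdges-enumerates λ e → case trans (sym (coeff-rank (3 ℕ.+ n))) e of λ ())

  even⊎even-suc : ∀ k → 2 ∣ k ⊎ 2 ∣ suc k
  even⊎even-suc zero    = inj₁ (divides 0 refl)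
  even⊎even-suc (suc k) with even⊎even-suc k
  ... | inj₁ (divides q refl) = inj₂ (divides (suc q) refl)
  ... | inj₂ p                = inj₁ p

  oddCycle-enumeration : (G : Graph (3 ℕ.+ n)) → IsOddCycle G → ReducibleEnumeration G
  oddCycle-enumeration {n} G ((_ , c , adj) , odd) =
    map (mapEdge (c ⟨$⟩ʳ_)) (cycleEdges (2 ℕ.+ n)) ,
    enumerates-map (c ⟨$⟩ʳ_) (c ⟨$⟩ˡ_) (λ _ → inverseʳ c) (λ _ → inverseˡ c)
      (enumerates-⇔ (Equivalence.from (adj _ _)) (Equivalence.to (adj _ _)) cycleEdges-enumerates) ,
    reducible-≤ (ℕ.≤-trans (two-neighbours G (neighbour (inj₁ (inj₁ refl)))
                   (neighbour (inj₂ (cyclicSuc-prev zero))) distinct-neighbours) (degree≤Δ G (c ⟨$⟩ʳ zero)))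
      (reducible-permute c (cycle-reducible n (case even⊎even-suc n of λ where
        (inj₁ even) → even
        -- If n + 1 were even, so would be the number n + 3 of vertices.
        (inj₂ (divides q e)) → contradiction (divides (suc q) (cong (2 ℕ.+_) e)) odd)))
    where
    neighbour : ∀ {j} → CyclicSuc zero j ⊎ CyclicSuc j zero → Graph._~_ G (c ⟨$⟩ʳ zero) (c ⟨$⟩ʳ j)
    neighbour = Equivalence.from (adj _ _)
    distinct-neighbours : c ⟨$⟩ʳ suc zero ≢ c ⟨$⟩ʳ prev zero
    distinct-neighbours e = case trans (sym (inverseˡ c)) (trans (cong (c ⟨$⟩ˡ_) e) (inverseˡ c)) of λ ()

  -- The Cartesian product

  -- A description of the members of `layers` without the recursion on copies. As in `crossEdge`, an
  -- edge between copies points to the upper one, which has the smaller index.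
  data LayerEdge (gs : List (Edge n)) {i : ℕ} (R : Rel (Fin i) 0ℓ) : Edge (i ℕ.* n) → Set where
    within : ∀ (a : Fin i) {u v} → (u , v) ∈ gs → LayerEdge gs R (combine a u , combine a v)
    across : ∀ {a b : Fin i} u → toℕ b ℕ.< toℕ a → R b a → LayerEdge gs R (combine a u , combine b u)

  module _ {gs : List (Edge n)} where

    ∈-crossings⁻ : ∀ {i} {J : List (Fin i)} {c} → c ∈ crossings n J → ∃₂ λ j u → j ∈ J × c ≡ (combine j u , u)
    ∈-crossings⁻ {J = J} p with ∈-map⁻ (λ (j , u) → combine j u , u) p
    ... | (j , u) , q , refl = j , u , proj₁ (∈-cartesianProduct⁻ J (allFin n) q) , refl

    ∈-layers⁻ : ∀ {i} {R : Rel (Fin i) 0ℓ} (R? : Decidable R) {e} → e ∈ layers gs i R? → LayerEdge gs R e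
    ∈-layers⁻ {suc i} R? p with ∈-++⁻ (map crossEdge (crossings n (lowerNeighbours R?))) p
    ... | inj₁ q with ∈-map⁻ crossEdge q
    ...   | _ , r , refl with ∈-crossings⁻ r
    ...     | j , u , j∈ , refl = across {a = suc j} {zero} u (ℕ.s≤s ℕ.z≤n)
                (proj₂ (∈-filter⁻ (λ j → R? zero (suc j)) {xs = allFin i} j∈))
    ∈-layers⁻ {suc i} R? p | inj₂ q with ∈-++⁻ (map (mapEdge (_↑ˡ (i ℕ.* n))) gs) q
    ... | inj₁ r with ∈-map⁻ (mapEdge (_↑ˡ (i ℕ.* n))) r
    ...   | _ , s , refl = within zero s
    ∈-layers⁻ {suc i} R? p | inj₂ q | inj₂ r with ∈-map⁻ (mapEdge (n ↑ʳ_)) r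
    ...   | _ , s , refl with ∈-layers⁻ (λ a b → R? (suc a) (suc b)) s
    ...     | within a g     = within (suc a) g
    ...     | across u b<a r = across u (ℕ.s≤s b<a) r

    ∈-layers⁺ : ∀ {i} {R : Rel (Fin i) 0ℓ} (R? : Decidable R) {e} → LayerEdge gs R e → e ∈ layers gs i R?
    ∈-layers⁺ {suc i} R? (within zero g) =
      ∈-++⁺ʳ (map crossEdge (crossings n (lowerNeighbours R?))) (∈-++⁺ˡ (∈-map⁺ (mapEdge (_↑ˡ (i ℕ.* n))) g))
    ∈-layers⁺ {suc i} R? (within (suc a) g) =
      ∈-++⁺ʳ (map crossEdge (crossings n (lowerNeighbours R?))) (∈-++⁺ʳ (map (mapEdge (_↑ˡ (i ℕ.* n))) gs)
        (∈-map⁺ (mapEdge (n ↑ʳ_)) (∈-layers⁺ (λ a b → R? (suc a) (suc b)) (within a g))))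
    ∈-layers⁺ {suc i} R? (across {suc j} {zero} u b<a r) =
      ∈-++⁺ˡ (∈-map⁺ crossEdge (∈-map⁺ (λ (j , u) → combine j u , u) (∈-cartesianProduct⁺
        (∈-filter⁺ (λ j → R? zero (suc j)) (∈-allFin j) r) (∈-allFin u))))
    ∈-layers⁺ {suc i} R? (across {suc a} {suc b} u (ℕ.s≤s b<a) r) =
      ∈-++⁺ʳ (map crossEdge (crossings n (lowerNeighbours R?))) (∈-++⁺ʳ (map (mapEdge (_↑ˡ (i ℕ.* n))) gs)
        (∈-map⁺ (mapEdge (n ↑ʳ_)) (∈-layers⁺ (λ a b → R? (suc a) (suc b)) (across u b<a r))))

    layers-unique : Unique gs → ∀ {i} {R : Rel (Fin i) 0ℓ} (R? : Decidable R) → Unique (layers gs i R?)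
    layers-unique gs! {zero}  R? = []
    layers-unique gs! {suc i} R? = Unique.++⁺ crossings!
      (Unique.++⁺ (Unique.map⁺ ↑ˡ-edge-injective gs!)
                  (Unique.map⁺ ↑ʳ-edge-injective (layers-unique gs! (λ a b → R? (suc a) (suc b))))
                  λ (p , q) → ↑ˡ≢↑ʳ-edge (∈-map⁻ (mapEdge (_↑ˡ M)) p) (∈-map⁻ (mapEdge (n ↑ʳ_)) q))
      λ (p , q) → cross≢ (∈-map⁻ crossEdge p)
        (Sum.map (∈-map⁻ (mapEdge (_↑ˡ M))) (∈-map⁻ (mapEdge (n ↑ʳ_))) (∈-++⁻ (map (mapEdge (_↑ˡ M)) gs) q))
      where
      M = i ℕ.* n

      ↑ˡ-edge-injective : ∀ {e e′ : Edge n} → mapEdge (_↑ˡ M) e ≡ mapEdge (_↑ˡ M) e′ → e ≡ e′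
      ↑ˡ-edge-injective e = cong₂ _,_ (Fin.↑ˡ-injective M _ _ (cong proj₁ e)) (Fin.↑ˡ-injective M _ _ (cong proj₂ e))

      ↑ʳ-edge-injective : ∀ {e e′ : Edge M} → mapEdge (n ↑ʳ_) e ≡ mapEdge (n ↑ʳ_) e′ → e ≡ e′
      ↑ʳ-edge-injective e = cong₂ _,_ (Fin.↑ʳ-injective n _ _ (cong proj₁ e)) (Fin.↑ʳ-injective n _ _ (cong proj₂ e))

      crossEdge-injective : ∀ {c c′ : Fin M × Fin n} → crossEdge c ≡ crossEdge c′ → c ≡ c′
      crossEdge-injective e = cong₂ _,_ (Fin.↑ʳ-injective n _ _ (cong proj₁ e)) (Fin.↑ˡ-injective M _ _ (cong proj₂ e))

      crossing-injective : ∀ {p q : Fin i × Fin n} →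
        (combine (proj₁ p) (proj₂ p) , proj₂ p) ≡ (combine (proj₁ q) (proj₂ q) , proj₂ q) → p ≡ q
      crossing-injective {j , u} {j′ , u′} e =
        let j≡j′ , u≡u′ = Fin.combine-injective j u j′ u′ (cong proj₁ e) in cong₂ _,_ j≡j′ u≡u′

      crossings! : Unique (map crossEdge (crossings n (lowerNeighbours R?)))
      crossings! = Unique.map⁺ crossEdge-injective (Unique.map⁺ crossing-injective
        (Unique.cartesianProduct⁺ (Unique.filter⁺ (λ j → R? zero (suc j)) (Unique.allFin⁺ i)) (Unique.allFin⁺ n)))

      module _ {e : Edge (n ℕ.+ M)} where

        ↑ˡ≢↑ʳ-edge : (∃[ g ] g ∈ gs × e ≡ mapEdge (_↑ˡ M) g) → {xs : List (Edge M)} →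
                     ¬ (∃[ f ] f ∈ xs × e ≡ mapEdge (n ↑ʳ_) f)
        ↑ˡ≢↑ʳ-edge ((u , _) , _ , e≡) ((v , _) , _ , e≡′) = ↑ˡ≢↑ʳ u v (cong proj₁ (trans (sym e≡) e≡′))

        cross≢ : {C : List (Fin M × Fin n)} {xs : List (Edge M)} → (∃[ c ] c ∈ C × e ≡ crossEdge c) →
                 ¬ ((∃[ g ] g ∈ gs × e ≡ mapEdge (_↑ˡ M) g) ⊎ (∃[ f ] f ∈ xs × e ≡ mapEdge (n ↑ʳ_) f))
        cross≢ ((y , _) , _ , e≡) (inj₁ ((u , _) , _ , e≡′)) = ↑ˡ≢↑ʳ u y (cong proj₁ (trans (sym e≡′) e≡))
        cross≢ ((_ , u) , _ , e≡) (inj₂ ((_ , y) , _ , e≡′)) = ↑ˡ≢↑ʳ u y (cong proj₂ (trans (sym e≡) e≡′))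

    layers-oneWay : (∀ {u v} → (u , v) ∈ gs → (v , u) ∉ gs) → ∀ {i} {R : Rel (Fin i) 0ℓ} {e} →
                    LayerEdge gs R e → ∀ {x y} → e ≡ (y , x) → ¬ LayerEdge gs R (x , y)
    layers-oneWay oneWay e e≡ e′ = go e e′ (cong swap e≡)
      where
      -- The indices are values of `combine`, on which pattern matching cannot unify, so the
      -- reversal is kept as an equation and decomposed by injectivity.
      go : ∀ {i} {R : Rel (Fin i) 0ℓ} {e e′} → LayerEdge gs R e → LayerEdge gs R e′ → swap e ≢ e′
      go (within a {u} {v} p) (within b {u′} {v′} q) eq with
        Fin.combine-injective a v b u′ (cong proj₁ eq) | Fin.combine-injective a u b v′ (cong proj₂ eq)
      ... | _ , refl | _ , refl = oneWay p q
      go (within a {u} {v} p) (across {c} {d} w d<c _) eq with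
        Fin.combine-injective a v c w (cong proj₁ eq) | Fin.combine-injective a u d w (cong proj₂ eq)
      ... | refl , _ | refl , _ = ℕ.<-irrefl refl d<c
      go (across {c} {d} w d<c _) (within a {u} {v} p) eq with
        Fin.combine-injective d w a u (cong proj₁ eq) | Fin.combine-injective c w a v (cong proj₂ eq)
      ... | refl , _ | refl , _ = ℕ.<-irrefl refl d<c
      go (across {a} {b} u b<a _) (across {c} {d} v d<c _) eq with
        Fin.combine-injective b u c v (cong proj₁ eq) | Fin.combine-injective a u d v (cong proj₂ eq)
      ... | refl , _ | refl , _ = ℕ.<-asym b<a d<c

  ProductAdjacent : ∀ {n m} → Graph n → Graph m → Rel (Fin n × Fin m) 0ℓ
  ProductAdjacent G H (u , h) (u′ , h′) = (u ≡ u′ × Graph._~_ H h h′) ⊎ (h ≡ h′ × Graph._~_ G u u′)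

  □-adjacent⁺ : ∀ {n m} (G : Graph n) (H : Graph m) {u u′ h h′} →
    ProductAdjacent G H (u , h) (u′ , h′) → Graph._~_ (G □ H) (combine u h) (combine u′ h′)
  □-adjacent⁺ G H {u} {u′} {h} {h′} =
    subst₂ (ProductAdjacent G H) (sym (Fin.remQuot-combine u h)) (sym (Fin.remQuot-combine u′ h′))

  □-adjacent⁻ : ∀ {n m} (G : Graph n) (H : Graph m) {u u′ h h′} →
    Graph._~_ (G □ H) (combine u h) (combine u′ h′) → ProductAdjacent G H (u , h) (u′ , h′)
  □-adjacent⁻ G H {u} {u′} {h} {h′} =
    subst₂ (ProductAdjacent G H) (Fin.remQuot-combine u h) (Fin.remQuot-combine u′ h′)

  opposite-< : ∀ {a b : Fin n} → toℕ a ℕ.< toℕ b → toℕ (Fin.opposite b) ℕ.< toℕ (Fin.opposite a)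
  opposite-< {n} {a} {b} a<b = subst₂ ℕ._<_ (sym (Fin.opposite-prop b)) (sym (Fin.opposite-prop a))
    (ℕ.∸-monoʳ-< (ℕ.s≤s a<b) (Fin.toℕ<n b))

  opposite-suc : ∀ {a b : Fin n} → toℕ b ≡ suc (toℕ a) → toℕ (Fin.opposite a) ≡ suc (toℕ (Fin.opposite b))
  opposite-suc {n} {a} {b} e = begin
    toℕ (Fin.opposite a)           ≡⟨ Fin.opposite-prop a ⟩
    n ℕ.∸ suc (toℕ a)              ≡⟨ cong (n ℕ.∸_) (sym e) ⟩
    suc n ℕ.∸ suc (toℕ b)          ≡⟨ ℕ.+-∸-assoc 1 (Fin.toℕ<n b) ⟩
    suc (n ℕ.∸ suc (toℕ b))        ≡⟨ cong suc (sym (Fin.opposite-prop b)) ⟩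
    suc (toℕ (Fin.opposite b))     ∎

  later? : ∀ {i} {R : Rel (Fin i) 0ℓ} → Decidable R → (a : Fin i) → Decidable₁ (λ b → toℕ a ℕ.< toℕ b × R a b)
  later? R? a b = (toℕ a ℕ.<? toℕ b) ×-dec R? a b

  -- Index `zero` is later than no other index, so peeling off its copy does not change the counts
  -- of the remaining ones.
  backBounded : ∀ {k i} {R : Rel (Fin i) 0ℓ} (R? : Decidable R) → 1 ℕ.≤ k →
                (∀ a → count (later? R? a) ℕ.≤ k) → BackBounded k i R?
  backBounded {i = zero}  R? 1≤k bound = 1≤k
  backBounded {i = suc i} {R} R? 1≤k bound =
    subst (ℕ._≤ _) first (bound zero) ,
    backBounded (λ a b → R? (suc a) (suc b)) 1≤k λ a → subst (ℕ._≤ _) (later a) (bound (suc a))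
    where
    count-suc : {P : Pred (Fin (suc i)) 0ℓ} {Q : Pred (Fin i) 0ℓ} (P? : Decidable₁ P) (Q? : Decidable₁ Q) →
                ¬ P zero → (∀ j → P (suc j) → Q j) → (∀ j → Q j → P (suc j)) → count P? ≡ count Q?
    count-suc P? Q? ¬P₀ f g = ℤ.+-injective (begin
      pos (count P?)                                      ≡⟨ count-∑ P? ⟩
      ∑ (allFin (suc i)) (λ u → 𝟙 (P? u))                 ≡⟨ ∑-allFin-suc (λ u → 𝟙 (P? u)) ⟩
      𝟙 (P? zero) + ∑ (allFin i) (λ j → 𝟙 (P? (suc j)))
        ≡⟨ cong₂ _+_ (𝟙-no (P? zero) ¬P₀) (∑-cong (allFin i) λ j → 𝟙-⇔ (P? (suc j)) (Q? j) (f j) (g j)) ⟩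
      0ℤ + ∑ (allFin i) (λ j → 𝟙 (Q? j))                  ≡⟨ ℤ.+-identityˡ _ ⟩
      ∑ (allFin i) (λ j → 𝟙 (Q? j))                       ≡⟨ sym (count-∑ Q?) ⟩
      pos (count Q?)                                      ∎)
    first : count (later? R? zero) ≡ length (lowerNeighbours R?)
    first = count-suc (later? R? zero) (λ j → R? zero (suc j)) (λ ()) (λ _ → proj₂) (λ _ r → ℕ.s≤s ℕ.z≤n , r)
    later : ∀ a → count (later? R? (suc a)) ≡ count (later? (λ a b → R? (suc a) (suc b)) a)
    later a = count-suc (later? R? (suc a)) (later? (λ a b → R? (suc a) (suc b)) a) (λ ())
      (λ _ (a<b , r) → ℕ.s≤s⁻¹ a<b , r) (λ _ (a<b , r) → ℕ.s≤s a<b , r)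

  -- Layer a of layers is the copy of G at the vertex opposite a of the Hamilton path, so that the
  -- last vertex of the path comes first.
  module _ {n m : ℕ} (G : Graph n) (H : Graph m) (P : HamiltonPath H) where

    private
      module G = Graph G
      module H = Graph H
      open HamiltonPath P

      w : Fin m → Fin m
      w a = vertices ⟨$⟩ʳ Fin.opposite a

      w⁻¹ : Fin m → Fin m
      w⁻¹ h = Fin.opposite (vertices ⟨$⟩ˡ h)

      w-w⁻¹ : ∀ h → w (w⁻¹ h) ≡ h
      w-w⁻¹ h = trans (cong (vertices ⟨$⟩ʳ_) (Fin.opposite-involutive (vertices ⟨$⟩ˡ h))) (inverseʳ vertices)

      w⁻¹-w : ∀ a → w⁻¹ (w a) ≡ a
      w⁻¹-w a = trans (cong Fin.opposite (inverseˡ vertices)) (Fin.opposite-involutive a)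

      w-injective : ∀ {a b} → w a ≡ w b → a ≡ b
      w-injective {a} {b} e = trans (sym (w⁻¹-w a)) (trans (cong w⁻¹ e) (w⁻¹-w b))

      -- In `layers` the copy is the first coordinate, in `_□_` it is the second; the bijection
      -- exchanges the coordinates and renames copies by `w`.
      f : Fin (m ℕ.* n) → Fin (n ℕ.* m)
      f x = let a , u = Fin.remQuot n x in combine u (w a)

      g : Fin (n ℕ.* m) → Fin (m ℕ.* n)
      g y = let u , h = Fin.remQuot m y in combine (w⁻¹ h) u

      f-combine : ∀ a u → f (combine a u) ≡ combine u (w a)
      f-combine a u = cong (λ (a , u) → combine u (w a)) (Fin.remQuot-combine a u)

      g-combine : ∀ u h → g (combine u h) ≡ combine (w⁻¹ h) u
      g-combine u h = cong (λ (u , h) → combine (w⁻¹ h) u) (Fin.remQuot-combine u h)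

      f-g : ∀ y → f (g y) ≡ y
      f-g y with Fin.combine-surjective {n} {m} y
      ... | u , h , refl = trans (cong f (g-combine u h)) (trans (f-combine (w⁻¹ h) u) (cong (combine u) (w-w⁻¹ h)))

      g-f : ∀ x → g (f x) ≡ x
      g-f x with Fin.combine-surjective {m} {n} x
      ... | a , u , refl = trans (cong g (f-combine a u)) (trans (g-combine u (w a)) (cong (λ a → combine a u) (w⁻¹-w a)))

      R : Rel (Fin m) 0ℓ
      R a b = w a H.~ w b

      R? : Decidable R
      R? a b = w a H.~? w b

      path : ∀ a b → toℕ b ≡ suc (toℕ a) → R a b
      path a b e = H.symm (consecutive (Fin.opposite b) (Fin.opposite a) (opposite-suc e))

      count-later : ∀ a → count (later? R? a) ≡ backDegree P (Fin.opposite a)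
      count-later a = ℤ.+-injective (begin
        pos (count (later? R? a))                              ≡⟨ count-∑ (later? R? a) ⟩
        ∑ (allFin m) (λ b → 𝟙 (later? R? a b))
          ≡⟨ ∑-cong (allFin m) (λ b → 𝟙-⇔ (later? R? a b) (back? (Fin.opposite b))
          (λ (a<b , r) → opposite-< a<b , H.symm r)
          (λ (b<a , r) →
            subst₂ (λ a b → toℕ a ℕ.< toℕ b) (Fin.opposite-involutive a) (Fin.opposite-involutive b) (opposite-< b<a) ,
            H.symm r)) ⟩
        ∑ (allFin m) (λ b → 𝟙 (back? (Fin.opposite b)))        ≡⟨ ∑-reindex Fin.opposite
          (λ {i} {j} e → trans (sym (Fin.opposite-involutive i)) (trans (cong Fin.opposite e) (Fin.opposite-involutive j)))
          (λ j → Fin.opposite j , Fin.opposite-involutive j) (λ j → 𝟙 (back? j)) ⟩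
        ∑ (allFin m) (λ j → 𝟙 (back? j))                       ≡⟨ sym (count-∑ back?) ⟩
        pos (backDegree P (Fin.opposite a))                    ∎)
        where
        back? : Decidable₁ (λ j → toℕ j ℕ.< toℕ (Fin.opposite a) × vertices ⟨$⟩ʳ j H.~ vertices ⟨$⟩ʳ Fin.opposite a)
        back? j = (j Fin.<? Fin.opposite a) ×-dec (vertices ⟨$⟩ʳ j H.~? vertices ⟨$⟩ʳ Fin.opposite a)

    product-edges : List (Edge n) → List (Edge (n ℕ.* m))
    product-edges gs = map (mapEdge f) (layers gs m R?)

    product-enumerates : ∀ {gs} → Enumerates G._~_ gs → Enumerates (Graph._~_ (G □ H)) (product-edges gs)
    product-enumerates {gs} enum = enumerates-map f g f-g g-f (enumerates (layers-unique unique R?)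
        (λ p q → layers-oneWay (oneWay G.irrefl) (∈-layers⁻ R? p) refl (∈-layers⁻ R? q))
        (λ p → layer-sound (∈-layers⁻ R? p))
        (λ {x} {y} → layer-complete x y))
      where
      open Enumerates enum

      layer-sound : ∀ {e} → LayerEdge gs R e → Graph._~_ (G □ H) (f (proj₁ e)) (f (proj₂ e))
      layer-sound (within a {u} {v} p) = subst₂ (Graph._~_ (G □ H)) (sym (f-combine a u)) (sym (f-combine a v))
        (□-adjacent⁺ G H (inj₂ (refl , sound p)))
      layer-sound (across {a} {b} u _ r) = subst₂ (Graph._~_ (G □ H)) (sym (f-combine a u)) (sym (f-combine b u))
        (□-adjacent⁺ G H (inj₁ (refl , H.symm r)))

      layer-complete : ∀ x y → Graph._~_ (G □ H) (f x) (f y) → (x , y) ∈ layers gs m R? ⊎ (y , x) ∈ layers gs m R?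
      layer-complete x y adj with Fin.combine-surjective {m} {n} x | Fin.combine-surjective {m} {n} y
      ... | a , u , refl | b , v , refl
        with □-adjacent⁻ G H (subst₂ (Graph._~_ (G □ H)) (f-combine a u) (f-combine b v) adj)
      ... | inj₂ (wa≡wb , u~v) rewrite w-injective wa≡wb =
        Sum.map (∈-layers⁺ R? ∘ within b) (∈-layers⁺ R? ∘ within b) (complete u~v)
      ... | inj₁ (refl , r) with Fin.<-cmp a b
      ... | tri< a<b _ _    = inj₂ (∈-layers⁺ R? (across u a<b r))
      ... | tri≈ _ refl _   = contradiction r (H.irrefl refl)
      ... | tri> _ _ b<a    = inj₁ (∈-layers⁺ R? (across u b<a (H.symm r)))

    AT-product-≤ : ∀ {d k gs i} → m ≡ suc (suc i) → Enumerates G._~_ gs → Reducible gs d →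
                   (∀ a → backDegree P a ℕ.≤ k) → 1 ℕ.≤ k → AT (G □ H) ℕ.≤ d ℕ.+ k
    AT-product-≤ {d} {k} {gs} refl enum red bound 1≤k =
      let t , t< , ≢0 = coeff-layers-≢0 red _ R? path
            (backBounded R? 1≤k λ a → subst (ℕ._≤ k) (sym (count-later a)) (bound (Fin.opposite a)))
      in AT-≤ (G □ H) (product-enumerates enum) (t ∘ g)
           (λ e → ≢0 (trans (coeff-cong (layers gs m R?) λ v → cong t (sym (g-f v)))
              (trans (sym (coeff-map f g f-g g-f (layers gs m R?) (t ∘ g))) e)))
           (ℕ.≤-trans 1≤k (ℕ.m≤n+m k d)) (t< ∘ g)

  reducible-enumeration : (G : Graph n) → 3 ℕ.≤ n → IsComplete G ⊎ IsOddCycle G → ReducibleEnumeration G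
  reducible-enumeration G (ℕ.s≤s (ℕ.s≤s (ℕ.s≤s ℕ.z≤n))) (inj₁ complete) = complete-enumeration G complete
  reducible-enumeration G (ℕ.s≤s (ℕ.s≤s (ℕ.s≤s ℕ.z≤n))) (inj₂ oddCycle) = oddCycle-enumeration G oddCycle

  -- The second vertex of the path is adjacent to the first, which yields `1 ≤ k` for the lowest
  -- copy.
  1≤backDegree : ∀ {m} {H : Graph (2 ℕ.+ m)} (P : HamiltonPath H) → 1 ℕ.≤ backDegree P (suc zero)
  1≤backDegree {m} {H} P = ℕ.n≢0⇒n>0 (count-some
    (λ j → (j Fin.<? suc (zero {n = m})) ×-dec (vertices ⟨$⟩ʳ j ~? vertices ⟨$⟩ʳ suc zero)) zero
    (ℕ.s≤s ℕ.z≤n , consecutive zero (suc zero) refl))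
    where
    open Graph H
    open HamiltonPath P

open import Data.Nat.Base using (_+_; _≤_)

theorem7 : ∀ {n m} (G : Graph n) (H : Graph m) (k : ℕ) →
    3 ≤ n →
    IsComplete G ⊎ IsOddCycle G →
    2 ≤ m →
    (w : HamiltonPath H) →
    (∀ i → backDegree w i ≤ k) →
    AT (G □ H) ≤ Δ G + k
theorem7 G H k 3≤n G-type (ℕ.s≤s (ℕ.s≤s ℕ.z≤n)) w bound =
  let gs , enum , red = reducible-enumeration G 3≤n G-type
  in AT-product-≤ G H w refl enum red bound (ℕ.≤-trans (1≤backDegree w) (bound (suc zero)))
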